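{- Let $a,b,c$ be distinct primes with $a<b$ and $N(a,b,c)>1$, and suppose $(a,b,c)\notin\{(2,3,5),(2,3,11),(2,5,3),(2,7,3),(3,5,2),(3,13,2)\}$. Then $c\equiv 5\pmod{12}$, and the equation $a^x+b^y=c^z$ has exactly two solutions $(x_1,y_1,z_1)$ and $(x_2,y_2,z_2)$ in positive integers, with $2\mid x_1$, $2\mid y_1$, $z_1=1$, and $2\nmid y_2$.
   Context: For coprime positive integers $a,b,c$ with $\min\{a,b,c\}>1$, $N(a,b,c)$ denotes the number of solutions $(x,y,z)$ in positive integers of $a^x+b^y=c^z$. -}

module Defs where

open import Data.Nat using (ℕ; _+_; _^_; _<_)
open import Data.Product using (_×_)
open import Relation.Binary.PropositionalEquality using (_≡_)

Sol : ℕ → ℕ → ℕ → ℕ → ℕ → ℕ → Set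
Sol a b c x y z = (0 < x) × (0 < y) × (0 < z) × (a ^ x + b ^ y ≡ c ^ z)

{-# OPTIONS --safe #-}
-- For fixed parities of x and y, write a^x = eX² and b^y = fY² with e ∈ {a, a²} and f ∈ {b, b²}. The elements
-- X√e + Y√-f whose norm is a power of the prime c are, up to sign and conjugation, the odd powers α^m of one of them
-- of least norm (a Euclidean descent on the exponent; no class group is needed). The coordinates of α divide those of
-- α^m, so for a solution α^m with m > 1 the quotients R and S are powers of a and b. If neither a nor b divides m,
-- then R and S are units; if b divides m, then the quotient S of a b-th power is at most b. Both are too small for the
-- norm, so each parity class contains at most one solution, apart from small exceptions.
--
-- Different parity classes are compared modulo 3, 4 and 8. For c = 2 the 2-adic valuations of a + 1, b - 1 and b + 1
-- contradict each other. For a = 2 and b, c ≠ 3 only two classes survive, one of them with x and y even and z odd;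
-- there class number one of Q(√-1) and a 2-adic estimate give z = 1. The cases b = 3 and c = 3 reduce to
-- factorisations of differences of squares, to class number one of Q(√-2), and to one congruence sieve.
module Submission where

open import Defs
open import Data.Nat using (ℕ; zero; suc; _<_; _%_)
import Data.Nat as N
import Data.Nat.Properties as N
import Data.Nat.Divisibility as N
import Data.Nat.DivMod as N
import Data.Nat.Solver as NS
open import Data.Nat.Coprimality using (Coprime)
import Data.Nat.Coprimality as Coprime
open import Data.Nat.Divisibility using (_∣_; divides; _∣?_)
open import Data.Nat.Induction using (<-rec)
open import Data.Nat.Primality
  using (Prime; euclidsLemma; prime?; prime[2]; prime⇒irreducible; prime⇒nonTrivial; prime⇒nonZero)
open import Data.Integer using (ℤ; 0ℤ; 1ℤ)
import Data.Integer.Properties as Z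
import Data.Integer.Divisibility.Signed as Z
open import Data.Integer.Tactic.RingSolver using (solve-∀)
open import Data.Fin using (Fin; toℕ; fromℕ<)
import Data.Fin.Properties as Fin
open import Data.Empty using (⊥; ⊥-elim)
open import Data.Product using (_×_; _,_; ∃-syntax; proj₁; proj₂)
open import Data.Sum using (_⊎_; inj₁; inj₂; [_,_]′)
open import Data.Unit using (⊤; tt)
open import Relation.Nullary using (¬_; Dec; yes; no)
open import Relation.Nullary.Decidable using (¬?; _×-dec_; _→-dec_; decidable-stable; from-yes; from-no)
open import Relation.Binary.Definitions using (tri<; tri≈; tri>)
open import Relation.Binary.PropositionalEquality
  using (_≡_; _≢_; refl; sym; trans; cong; cong₂; subst; subst₂; module ≡-Reasoning)

-- The elements X√e + Y√-f are not closed under multiplication: the quotient of two of them lies in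
-- the ring of √-ef, and only a second division by α leads back. This is why only odd powers occur
-- and why the exponent falls by twice that of α at each turn. The excluded triples are where the
-- estimates really fail. Proper powers of one element produce 3 + 5³ = 2⁷, 5 + 3³ = 2⁵, 13 + 3⁵ =
-- 2⁸ and 2 + 5² = 3³; differences of squares produce 4² + 3² = 5² and 2⁵ + 7² = 3⁴; and 2³ + 3 = 11
-- = 2 + 3² passes every congruence. One more proper power, 2² + 11² = 5³, belongs to no excluded
-- triple and is removed because (2, 11, 5) has no solution in another class. If f = 1 and α = u√e +
-- √-1, then b does not divide ω = 4, and divisibility by b gives no bound at all. The 2-adic
-- estimate and a congruence modulo 5 fill this gap.

-- Divisibility by primes and their powers.

module PrimePowers where
  open import Data.Nat hiding (_/_)

  prime>1 : ∀ {p} → Prime p → 1 < p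
  prime>1 pr = nonTrivial⇒n>1 _ ⦃ prime⇒nonTrivial pr ⦄

  prime∤1 : ∀ {p} → Prime p → ¬ p ∣ 1
  prime∤1 pr p∣1 = N.<⇒≢ (prime>1 pr) (sym (N.∣1⇒≡1 p∣1))

  prime>0 : ∀ {p} → Prime p → 0 < p
  prime>0 pr = N.<⇒≤ (prime>1 pr)

  prime∣^⇒∣ : ∀ {p m} → Prime p → ∀ k → p ∣ m ^ k → p ∣ m
  prime∣^⇒∣ pr zero    p∣1 = ⊥-elim (prime∤1 pr p∣1)
  prime∣^⇒∣ {m = m} pr (suc k) p∣ with euclidsLemma m (m ^ k) pr p∣
  ... | inj₁ p∣m = p∣m
  ... | inj₂ p∣  = prime∣^⇒∣ pr k p∣

  prime∣prime⇒≡ : ∀ {p r} → Prime p → Prime r → p ∣ r → p ≡ r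
  prime∣prime⇒≡ pp pr p∣r with prime⇒irreducible pr p∣r
  ... | inj₁ refl = ⊥-elim (prime∤1 pp N.∣-refl)
  ... | inj₂ p≡r  = p≡r

  prime∣prime^⇒≡ : ∀ {p r} → Prime p → Prime r → ∀ k → p ∣ r ^ k → p ≡ r
  prime∣prime^⇒≡ pp pr k p∣ = prime∣prime⇒≡ pp pr (prime∣^⇒∣ pp k p∣)

  ∤⇒coprime : ∀ {p m} → Prime p → ¬ p ∣ m → Coprime p m
  ∤⇒coprime pr p∤m (d∣p , d∣m) with prime⇒irreducible pr d∣p
  ... | inj₁ d≡1  = d≡1
  ... | inj₂ refl = ⊥-elim (p∤m d∣m)

  ∣prime^⇒≡^ : ∀ {p d} → Prime p → ∀ k → d ∣ p ^ k → ∃[ s ] d ≡ p ^ s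
  ∣prime^⇒≡^ pr zero d∣1 = 0 , N.∣1⇒≡1 d∣1
  ∣prime^⇒≡^ {p} {d} pr (suc k) d∣ with p ∣? d
  ... | no p∤d = ∣prime^⇒≡^ pr k (Coprime.coprime-divisor (Coprime.sym (∤⇒coprime pr p∤d)) d∣)
  ... | yes (divides t refl)
      with ∣prime^⇒≡^ pr k (N.*-cancelˡ-∣ p ⦃ prime⇒nonZero pr ⦄ (subst (_∣ p * p ^ k) (N.*-comm t p) d∣))
  ... | s , refl = suc s , N.*-comm (p ^ s) p

  ∤⇒coprime-^ : ∀ {p m} → Prime p → ¬ p ∣ m → ∀ k → Coprime (p ^ k) m
  ∤⇒coprime-^ pr p∤m k (d∣p^k , d∣m) with ∣prime^⇒≡^ pr k d∣p^k
  ... | zero  , d≡1  = d≡1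
  ... | suc s , refl = ⊥-elim (p∤m (N.∣-trans (N.m∣m*n _) d∣m))

  ^-injectiveʳ : ∀ {p} → 1 < p → ∀ {m n} → p ^ m ≡ p ^ n → m ≡ n
  ^-injectiveʳ {p} 1<p {m} {n} eq with N.<-cmp m n
  ... | tri< m<n _ _ = ⊥-elim (N.<⇒≢ (N.^-monoʳ-< p 1<p m<n) eq)
  ... | tri≈ _ m≡n _ = m≡n
  ... | tri> _ _ m>n = ⊥-elim (N.<⇒≢ (N.^-monoʳ-< p 1<p m>n) (sym eq))

  odd⊎even : ∀ n → ∃[ i ] (n ≡ i + i ⊎ n ≡ suc (i + i))
  odd⊎even zero = 0 , inj₁ refl
  odd⊎even (suc n) with odd⊎even n
  ... | i , inj₁ refl = i , inj₂ refl
  ... | i , inj₂ refl = suc i , inj₁ (cong suc (sym (N.+-suc i i)))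

  double-injective : ∀ {i j} → i + i ≡ j + j → i ≡ j
  double-injective {i} {j} eq with N.<-cmp i j
  ... | tri< lt _ _ = ⊥-elim (N.<⇒≢ (N.+-mono-< lt lt) eq)
  ... | tri≈ _ e _ = e
  ... | tri> _ _ gt = ⊥-elim (N.<⇒≢ (N.+-mono-< gt gt) (sym eq))

  even≢odd : ∀ i j → i + i ≢ suc (j + j)
  even≢odd zero    j ()
  even≢odd (suc i) zero    eq rewrite N.+-suc i i = case eq
    where
    case : ∀ {n} → suc (suc n) ≢ 1
    case ()
  even≢odd (suc i) (suc j) eq rewrite N.+-suc i i | N.+-suc j j =
    even≢odd i j (N.suc-injective (N.suc-injective eq))

  prime≢2⇒odd : ∀ {p} → Prime p → p ≢ 2 → ∃[ k ] p ≡ suc (k + k)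
  prime≢2⇒odd {p} pr p≢2 with odd⊎even p
  ... | k , inj₂ eq = k , eq
  ... | k , inj₁ refl = ⊥-elim (p≢2 (sym (prime∣prime⇒≡ prime[2] pr
      (divides k (trans (cong (k +_) (sym (N.+-identityʳ k))) (N.*-comm 2 k))))))

  -- Used against `S-bound`, which would give q^k < b = 2k + 1: a norm q ≥ 3 contradicts this for
  -- every k.
  3^k>2k : ∀ k → suc (k + k) ≤ 3 ^ k
  3^k>2k zero    = s≤s z≤n
  3^k>2k (suc k) = begin
    suc (suc k + suc k)   ≡⟨ cong suc (cong suc (N.+-suc k k)) ⟩
    2 + suc (k + k)       ≤⟨ N.+-mono-≤ 2≤ (3^k>2k k) ⟩
    2 * 3 ^ k + 3 ^ k     ≡⟨ N.+-comm (2 * 3 ^ k) (3 ^ k) ⟩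
    3 ^ suc k             ∎
    where
    open N.≤-Reasoning
    2≤ : 2 ≤ 2 * 3 ^ k
    2≤ = N.*-monoʳ-≤ 2 (N.m^n>0 3 k)

  -- For q = 2 the same contradiction needs k ≥ 3; since 2² < 5, the case k = 2 is a genuine
  -- exception.
  2^k>2k : ∀ k → suc (3 + k + (3 + k)) ≤ 2 ^ (3 + k)
  2^k>2k zero    = N.n≤1+n 7
  2^k>2k (suc k) = begin
    suc (3 + suc k + (3 + suc k)) ≡⟨ cong suc (cong suc (N.+-suc (3 + k) (3 + k))) ⟩
    2 + suc (3 + k + (3 + k))     ≤⟨ N.+-mono-≤ 2≤ (2^k>2k k) ⟩
    2 ^ (3 + k) + 2 ^ (3 + k)     ≡⟨ cong (2 ^ (3 + k) +_) (N.+-identityʳ _) ⟨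
    2 ^ (3 + suc k)               ∎
    where
    open N.≤-Reasoning
    2≤ : 2 ≤ 2 ^ (3 + k)
    2≤ = N.≤-trans (s≤s z<s) (N.^-monoʳ-≤ 2 {3} {3 + k} (N.m≤m+n 3 k))

-- Coordinates of the odd powers of α.

-- With α = (u√e + v√-f)/g, q = eu²+fv² over g² and ω = 4fv²/g², the odd powers are
-- α^(2h+1) = (uR_h√e + vS_h√-f)/g, where S = 2P - R; passing to P keeps the recursion integral for g = 2.
module Powers where
  open import Data.Integer hiding (suc; sign)

  R P S : ℤ → ℤ → ℕ → ℤ
  R q ω zero    = 1ℤ
  R q ω (suc h) = q * R q ω h - ω * P q ω h
  P q ω zero    = 1ℤ
  P q ω (suc h) = q * (R q ω h + P q ω h) - ω * P q ω h
  S q ω h = + 2 * P q ω h - R q ω h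

  -- Multiplicativity of the norm. Substituting S = 2P - R in ER² + wS² = g²q^(2h+1), with E = eu²
  -- and w = fv², and dividing by g² leaves a form in R and P without denominators.
  norm : ∀ q ω h → q * (R q ω h * R q ω h) + ω * (P q ω h * P q ω h) - ω * (P q ω h * R q ω h) ≡ q * (q ^ h * q ^ h)
  norm q ω zero = identity q ω
    where
    identity : ∀ q ω → q * (1ℤ * 1ℤ) + ω * (1ℤ * 1ℤ) - ω * (1ℤ * 1ℤ) ≡ q * (1ℤ * 1ℤ)
    identity = solve-∀
  norm q ω (suc h) = trans (identity q ω (R q ω h) (P q ω h)) (trans (cong (q * q *_) (norm q ω h)) (reassoc q (q ^ h)))
    where
    identity : ∀ q ω r p →
      q * ((q * r - ω * p) * (q * r - ω * p)) + ω * ((q * (r + p) - ω * p) * (q * (r + p) - ω * p))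
        - ω * ((q * (r + p) - ω * p) * (q * r - ω * p))
      ≡ q * q * (q * (r * r) + ω * (p * p) - ω * (p * r))
    identity = solve-∀
    reassoc : ∀ q x → q * q * (q * (x * x)) ≡ q * (q * x * (q * x))
    reassoc = solve-∀

  -- The same identity in R and S. The relation κ(E + w) = 4q stands for q = (E + w)/g²; the proof
  -- multiplies by κ and cancels it.
  norm-form : ∀ κ E w q → .{{_ : NonZero κ}} → κ * (E + w) ≡ + 4 * q → ∀ h →
    E * (R q (κ * w) h * R q (κ * w) h) + w * (S q (κ * w) h * S q (κ * w) h) ≡ (E + w) * (q ^ h * q ^ h)
  norm-form κ E w q eq h = Z.*-cancelˡ-≡ κ _ _ (begin
    κ * (E * (r * r) + w * (s * s))                        ≡⟨ identity κ E w r p ⟩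
    κ * (E + w) * (r * r) + κ * w * (s * s - r * r)        ≡⟨ cong (λ t → t * (r * r) + κ * w * (s * s - r * r)) eq ⟩
    + 4 * q * (r * r) + κ * w * (s * s - r * r)            ≡⟨ identity' q (κ * w) r p ⟩
    + 4 * (q * (r * r) + κ * w * (p * p) - κ * w * (p * r)) ≡⟨ cong (+ 4 *_) (norm q (κ * w) h) ⟩
    + 4 * (q * (q ^ h * q ^ h))                            ≡⟨ Z.*-assoc (+ 4) q _ ⟨
    + 4 * q * (q ^ h * q ^ h)                              ≡⟨ cong (_* (q ^ h * q ^ h)) eq ⟨
    κ * (E + w) * (q ^ h * q ^ h)                          ≡⟨ Z.*-assoc κ (E + w) _ ⟩
    κ * ((E + w) * (q ^ h * q ^ h))                        ∎)
    where
    open ≡-Reasoning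
    r = R q (κ * w) h
    p = P q (κ * w) h
    s = S q (κ * w) h
    identity : ∀ κ E w r p → κ * (E * (r * r) + w * ((+ 2 * p - r) * (+ 2 * p - r)))
      ≡ κ * (E + w) * (r * r) + κ * w * ((+ 2 * p - r) * (+ 2 * p - r) - r * r)
    identity = solve-∀
    identity' : ∀ q ω r p → + 4 * q * (r * r) + ω * ((+ 2 * p - r) * (+ 2 * p - r) - r * r)
      ≡ + 4 * (q * (r * r) + ω * (p * p) - ω * (p * r))
    identity' = solve-∀

  -- One multiplication by α^(2(2h+1)), i.e. 2h+1 steps of the recursion at once.
  R-shift : ∀ q ω h k → let r = R q ω h ; p = P q ω h in
    R q ω (suc (h N.+ h) N.+ k) ≡ (q * (r * r) - ω * ((p - r) * (p - r))) * R q ω k - ω * (r * S q ω h) * P q ω k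
  P-shift : ∀ q ω h k → let r = R q ω h ; p = P q ω h in
    P q ω (suc (h N.+ h) N.+ k) ≡ q * (r * S q ω h) * R q ω k
      + (q * (r * r) - ω * ((p - r) * (p - r)) - ω * (r * S q ω h)) * P q ω k
  R-shift q ω zero k = identity q ω (R q ω k) (P q ω k)
    where
    identity : ∀ q ω x y → q * x - ω * y ≡
      (q * (1ℤ * 1ℤ) - ω * ((1ℤ - 1ℤ) * (1ℤ - 1ℤ))) * x - ω * (1ℤ * (+ 2 * 1ℤ - 1ℤ)) * y
    identity = solve-∀
  R-shift q ω (suc h) k rewrite N.+-suc h h = trans
    (cong₂ (λ x y → q * (q * x - ω * y) - ω * (q * (x + y) - ω * y)) (R-shift q ω h k) (P-shift q ω h k))
    (identity q ω (R q ω h) (P q ω h) (R q ω k) (P q ω k))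
    where
    identity : ∀ q ω r p x y →
      let s = + 2 * p - r
          a = q * (r * r) - ω * ((p - r) * (p - r))
          X = a * x - ω * (r * s) * y
          Y = q * (r * s) * x + (a - ω * (r * s)) * y
          r' = q * r - ω * p
          p' = q * (r + p) - ω * p in
      q * (q * X - ω * Y) - ω * (q * (X + Y) - ω * Y)
      ≡ (q * (r' * r') - ω * ((p' - r') * (p' - r'))) * x - ω * (r' * (+ 2 * p' - r')) * y
    identity = solve-∀
  P-shift q ω zero k = identity q ω (R q ω k) (P q ω k)
    where
    identity : ∀ q ω x y → q * (x + y) - ω * y ≡ q * (1ℤ * (+ 2 * 1ℤ - 1ℤ)) * x +
      (q * (1ℤ * 1ℤ) - ω * ((1ℤ - 1ℤ) * (1ℤ - 1ℤ)) - ω * (1ℤ * (+ 2 * 1ℤ - 1ℤ))) * y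
    identity = solve-∀
  P-shift q ω (suc h) k rewrite N.+-suc h h = trans
    (cong₂ (λ x y → q * (q * x - ω * y + (q * (x + y) - ω * y)) - ω * (q * (x + y) - ω * y)) (R-shift q ω h k)
        (P-shift q ω h k))
    (identity q ω (R q ω h) (P q ω h) (R q ω k) (P q ω k))
    where
    identity : ∀ q ω r p x y →
      let s = + 2 * p - r
          a = q * (r * r) - ω * ((p - r) * (p - r))
          X = a * x - ω * (r * s) * y
          Y = q * (r * s) * x + (a - ω * (r * s)) * y
          r' = q * r - ω * p
          p' = q * (r + p) - ω * p in
      q * (q * X - ω * Y + (q * (X + Y) - ω * Y)) - ω * (q * (X + Y) - ω * Y)
      ≡ q * (r' * (+ 2 * p' - r')) * x
        + (q * (r' * r') - ω * ((p' - r') * (p' - r')) - ω * (r' * (+ 2 * p' - r'))) * y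
    identity = solve-∀

  -- α^((2h+1)(2k+1)) as the (2k+1)-st power of α^(2h+1).
  module Iterate (q ω : ℤ) (h : ℕ) where
    q₁ ω₁ : ℤ
    q₁ = q * (q ^ h * q ^ h)
    ω₁ = ω * (S q ω h * S q ω h)

    -- Chosen so that twice the index plus 1 is (2h + 1)(2k + 1).
    iterate : ℕ → ℕ
    iterate zero    = h
    iterate (suc k) = suc (h N.+ h) N.+ iterate k

    -- The coordinates R and S of a power of α^(2h+1) are multiples of those of α^(2h+1) itself. For
    -- P = (R + S)/2 the two products mix, and (r - s)/2 = r - p explains the coefficient of the
    -- first.
    R-P-iterate : ∀ k → R q ω (iterate k) ≡ R q ω h * R q₁ ω₁ k ×
      P q ω (iterate k) ≡ (R q ω h - P q ω h) * R q₁ ω₁ k + S q ω h * P q₁ ω₁ k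
    R-P-iterate zero = id₁ (R q ω h) , id₂ (R q ω h) (P q ω h)
      where
      id₁ : ∀ r → r ≡ r * 1ℤ
      id₁ = solve-∀
      id₂ : ∀ r p → p ≡ (r - p) * 1ℤ + (+ 2 * p - r) * 1ℤ
      id₂ = solve-∀
    R-P-iterate (suc k) with R-P-iterate k
    ... | eqR , eqP =
        trans (R-shift q ω h (iterate k)) (trans (cong₂
            (λ x y → (q * (r * r) - ω * ((p - r) * (p - r))) * x - ω * (r * s) * y) eqR eqP)
          (trans (id₁ q ω r p x y) (cong (λ t → r * (t * x - ω₁ * y)) (norm q ω h))))
      , trans (P-shift q ω h (iterate k)) (trans (cong₂
          (λ x y → q * (r * s) * x + (q * (r * r) - ω * ((p - r) * (p - r)) - ω * (r * s)) * y) eqR eqP)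
          (trans (id₂ q ω r p x y) (cong (λ t → (r - p) * (t * x - ω₁ * y) + s * (t * (x + y) - ω₁ * y)) (norm q ω h))))
      where
      r = R q ω h
      p = P q ω h
      s = S q ω h
      x = R q₁ ω₁ k
      y = P q₁ ω₁ k
      id₁ : ∀ q ω r p x y →
        let s = + 2 * p - r
            n = q * (r * r) + ω * (p * p) - ω * (p * r) in
        (q * (r * r) - ω * ((p - r) * (p - r))) * (r * x) - ω * (r * s) * ((r - p) * x + s * y)
        ≡ r * (n * x - ω * (s * s) * y)
      id₁ = solve-∀
      id₂ : ∀ q ω r p x y →
        let s = + 2 * p - r
            n = q * (r * r) + ω * (p * p) - ω * (p * r) in
        q * (r * s) * (r * x) + (q * (r * r) - ω * ((p - r) * (p - r)) - ω * (r * s)) * ((r - p) * x + s * y)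
        ≡ (r - p) * (n * x - ω * (s * s) * y) + s * (n * (x + y) - ω * (s * s) * y)
      id₂ = solve-∀

    S-iterate : ∀ k → S q ω (iterate k) ≡ S q ω h * S q₁ ω₁ k
    S-iterate k with R-P-iterate k
    ... | eqR , eqP = trans (cong₂ (λ x y → + 2 * y - x) eqR eqP) (identity (R q ω h) (P q ω h) (R q₁ ω₁ k) (P q₁ ω₁ k))
      where
      identity : ∀ r p x y → + 2 * ((r - p) * x + (+ 2 * p - r) * y) - r * x ≡ (+ 2 * p - r) * (+ 2 * y - x)
      identity = solve-∀

  sign : ℕ → ℤ
  sign zero    = 1ℤ
  sign (suc h) = - sign h

  ∣sign∣ : ∀ h → ∣ sign h ∣ ≡ 1
  ∣sign∣ zero    = refl
  ∣sign∣ (suc h) = trans (Z.∣-i∣≡∣i∣ (sign h)) (∣sign∣ h)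

  -- Multiplying α by √-1 exchanges the two coordinates.
  R-P-swap : ∀ q ω ω' → ω + ω' ≡ + 4 * q → ∀ h → R q ω' h ≡ sign h * S q ω h × P q ω' h ≡ sign h * P q ω h
  R-P-swap q ω ω' eq zero = refl , refl
  R-P-swap q ω ω' eq (suc h) with R-P-swap q ω ω' eq h
  ... | eqR , eqP =
      trans (cong₂ (λ x y → q * x - ω' * y) eqR eqP) (trans (cong (λ t → q * (σ * s) - t * (σ * p)) ω'≡) (id₁ q ω σ r p))
    , trans (cong₂ (λ x y → q * (x + y) - ω' * y) eqR eqP)
        (trans (cong (λ t → q * (σ * s + σ * p) - t * (σ * p)) ω'≡) (id₂ q ω σ r p))
    where
    σ = sign h
    r = R q ω h
    p = P q ω h
    s = S q ω h
    cancel : ∀ a b → b ≡ a + b - a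
    cancel = solve-∀
    ω'≡ : ω' ≡ + 4 * q - ω
    ω'≡ = trans (cancel ω ω') (cong (_- ω) eq)
    id₁ : ∀ q ω σ r p → q * (σ * (+ 2 * p - r)) - (+ 4 * q - ω) * (σ * p)
      ≡ - σ * (+ 2 * (q * (r + p) - ω * p) - (q * r - ω * p))
    id₁ = solve-∀
    id₂ : ∀ q ω σ r p → q * (σ * (+ 2 * p - r) + σ * p) - (+ 4 * q - ω) * (σ * p) ≡ - σ * (q * (r + p) - ω * p)
    id₂ = solve-∀

  -- At ω = 0 the recursion becomes R' = qR, P' = q(R + P). In terms of S this is the first binomial
  -- term, S ≡ (2h + 1)q^h.
  R-P-mod-ω : ∀ q ω h → ∃[ x ] ∃[ y ] (R q ω h ≡ q ^ h + ω * x × P q ω h ≡ + suc h * q ^ h + ω * y)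
  R-P-mod-ω q ω zero = 0ℤ , 0ℤ , id₁ ω , id₁ ω
    where
    id₁ : ∀ ω → 1ℤ ≡ 1ℤ + ω * 0ℤ
    id₁ = solve-∀
  R-P-mod-ω q ω (suc h) with R-P-mod-ω q ω h
  ... | x , y , eqR , eqP = q * x - p , q * (x + y) - p ,
      trans (cong (λ t → q * t - ω * p) eqR) (id₁ q ω (q ^ h) x p) ,
      trans (cong₂ (λ t t' → q * (t + t') - ω * p) eqR eqP) (id₂ (+ suc h) q ω (q ^ h) x y p)
    where
    p = P q ω h
    id₁ : ∀ q ω z x p → q * (z + ω * x) - ω * p ≡ q * z + ω * (q * x - p)
    id₁ = solve-∀
    id₂ : ∀ m q ω z x y p → q * (z + ω * x + (m * z + ω * y)) - ω * p ≡ (1ℤ + m) * (q * z) + ω * (q * (x + y) - p)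
    id₂ = solve-∀

  S-mod-ω : ∀ q ω h → ∃[ x ] (S q ω h ≡ + suc (h N.+ h) * q ^ h + ω * x)
  S-mod-ω q ω h with R-P-mod-ω q ω h
  ... | x , y , eqR , eqP = + 2 * y - x , trans (cong₂ (λ a b → + 2 * b - a) eqR eqP) (identity (+ h) ω (q ^ h) x y)
    where
    identity : ∀ m ω z x y → + 2 * ((1ℤ + m) * z + ω * y) - (z + ω * x) ≡ (1ℤ + (m + m)) * z + ω * (+ 2 * y - x)
    identity = solve-∀

  -- Triangular and tetrahedral numbers, given by the recursion that the coefficients of ω in R and
  -- P obey.
  T U : ℕ → ℤ
  T zero    = 0ℤ
  T (suc h) = T h + + suc h
  U zero    = 0ℤ
  U (suc h) = U h + T h + + suc h

  2T≡ : ∀ h → + 2 * T h ≡ + h * (1ℤ + + h)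
  2T≡ zero    = refl
  2T≡ (suc h) = trans (id₁ (+ h) (T h)) (trans (cong (_+ + 2 * (1ℤ + + h)) (2T≡ h)) (id₂ (+ h)))
    where
    id₁ : ∀ h t → + 2 * (t + (1ℤ + h)) ≡ + 2 * t + + 2 * (1ℤ + h)
    id₁ = solve-∀
    id₂ : ∀ h → h * (1ℤ + h) + + 2 * (1ℤ + h) ≡ (1ℤ + h) * (1ℤ + (1ℤ + h))
    id₂ = solve-∀

  6U≡ : ∀ h → + 6 * U h ≡ + h * (1ℤ + + h) * (+ 2 + + h)
  6U≡ zero    = refl
  6U≡ (suc h) = trans (id₁ (+ h) (T h) (U h)) (trans (cong₂ (λ a b → a + + 3 * b + + 6 * (1ℤ + + h)) (6U≡ h) (2T≡ h))
      (id₂ (+ h)))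
    where
    id₁ : ∀ h t u → + 6 * (u + t + (1ℤ + h)) ≡ + 6 * u + + 3 * (+ 2 * t) + + 6 * (1ℤ + h)
    id₁ = solve-∀
    id₂ : ∀ h → h * (1ℤ + h) * (+ 2 + h) + + 3 * (h * (1ℤ + h)) + + 6 * (1ℤ + h) ≡ (1ℤ + h) * (1ℤ + (1ℤ + h)) *
        (+ 2 + (1ℤ + h))
    id₂ = solve-∀

  -- The coefficient of ω in S is (2h + 1)h(h + 1)/6 up to sign and a power of q. A prime b = 2h + 1
  -- ≥ 5 therefore divides it, which lifts the congruence for S from modulus b to b².
  6[2U-T]≡ : ∀ h → + 6 * (+ 2 * U h - T h) ≡ + suc (h N.+ h) * (+ h * (1ℤ + + h))
  6[2U-T]≡ h = trans (id₁ (T h) (U h)) (trans (cong₂ (λ a b → + 2 * a - + 3 * b) (6U≡ h) (2T≡ h)) (id₂ (+ h)))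
    where
    id₁ : ∀ t u → + 6 * (+ 2 * u - t) ≡ + 2 * (+ 6 * u) - + 3 * (+ 2 * t)
    id₁ = solve-∀
    id₂ : ∀ h → + 2 * (h * (1ℤ + h) * (+ 2 + h)) - + 3 * (h * (1ℤ + h)) ≡ (1ℤ + (h + h)) * (h * (1ℤ + h))
    id₂ = solve-∀

  -- The coefficients of ω in R and P are -T q^(h-1) and -U q^(h-1); multiplying by q avoids the
  -- negative power at h = 0.
  R-P-mod-ω² : ∀ q ω h → ∃[ x ] ∃[ y ]
    (q * R q ω h ≡ q * q ^ h - T h * (q ^ h * ω) + ω * ω * x ×
     q * P q ω h ≡ + suc h * (q * q ^ h) - U h * (q ^ h * ω) + ω * ω * y)
  R-P-mod-ω² q ω zero = 0ℤ , 0ℤ , id₁ q ω , id₁' q ω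
    where
    id₁ : ∀ q ω → q * 1ℤ ≡ q * 1ℤ - 0ℤ * (1ℤ * ω) + ω * ω * 0ℤ
    id₁ = solve-∀
    id₁' : ∀ q ω → q * 1ℤ ≡ 1ℤ * (q * 1ℤ) - 0ℤ * (1ℤ * ω) + ω * ω * 0ℤ
    id₁' = solve-∀
  R-P-mod-ω² q ω (suc h) with R-P-mod-ω² q ω h
  ... | x , y , eqR , eqP = q * x - (ω * y - U h * q ^ h) , q * (x + y) - (ω * y - U h * q ^ h) ,
      trans (id₁ q ω (R q ω h) (P q ω h)) (trans (cong₂ (λ a b → q * a - ω * b) eqR eqP)
          (id₂ (+ h) q ω (q ^ h) (T h) (U h) x y)) ,
      trans (id₃ q ω (R q ω h) (P q ω h)) (trans (cong₂ (λ a b → q * (a + b) - ω * b) eqR eqP)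
          (id₄ (+ h) q ω (q ^ h) (T h) (U h) x y))
    where
    id₁ : ∀ q ω r p → q * (q * r - ω * p) ≡ q * (q * r) - ω * (q * p)
    id₁ = solve-∀
    id₃ : ∀ q ω r p → q * (q * (r + p) - ω * p) ≡ q * (q * r + q * p) - ω * (q * p)
    id₃ = solve-∀
    id₂ : ∀ m q ω z t u x y →
      q * (q * z - t * (z * ω) + ω * ω * x) - ω * ((1ℤ + m) * (q * z) - u * (z * ω) + ω * ω * y)
      ≡ q * (q * z) - (t + (1ℤ + m)) * (q * z * ω) + ω * ω * (q * x - (ω * y - u * z))
    id₂ = solve-∀
    id₄ : ∀ m q ω z t u x y →
      q * ((q * z - t * (z * ω) + ω * ω * x) + ((1ℤ + m) * (q * z) - u * (z * ω) + ω * ω * y)) - ω *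
          ((1ℤ + m) * (q * z) - u * (z * ω) + ω * ω * y)
      ≡ (1ℤ + (1ℤ + m)) * (q * (q * z)) - (u + t + (1ℤ + m)) * (q * z * ω) + ω * ω * (q * (x + y) - (ω * y - u * z))
    id₄ = solve-∀

  S-mod-ω² : ∀ q ω h → ∃[ x ]
    (q * S q ω h ≡ + suc (h N.+ h) * (q * q ^ h) - (+ 2 * U h - T h) * (q ^ h * ω) + ω * ω * x)
  S-mod-ω² q ω h with R-P-mod-ω² q ω h
  ... | x , y , eqR , eqP = + 2 * y - x ,
      trans (id₁ q (R q ω h) (P q ω h)) (trans (cong₂ (λ a b → + 2 * b - a) eqR eqP) (id₂ (+ h) q ω (q ^ h) (T h) (U h) x y))
    where
    id₁ : ∀ q r p → q * (+ 2 * p - r) ≡ + 2 * (q * p) - q * r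
    id₁ = solve-∀
    id₂ : ∀ m q ω z t u x y →
      + 2 * ((1ℤ + m) * (q * z) - u * (z * ω) + ω * ω * y) - (q * z - t * (z * ω) + ω * ω * x)
      ≡ (1ℤ + (m + m)) * (q * z) - (+ 2 * u - t) * (z * ω) + ω * ω * (+ 2 * y - x)
    id₂ = solve-∀

-- Passage from ℤ to ℕ by absolute values.

module AbsoluteValues where
  open import Data.Nat
  open import Data.Integer as ℤ using (+_; ∣_∣)

  abs-^ : ∀ i k → ∣ i ℤ.^ k ∣ ≡ ∣ i ∣ ^ k
  abs-^ i zero    = refl
  abs-^ i (suc k) = trans (Z.abs-* i (i ℤ.^ k)) (cong (∣ i ∣ *_) (abs-^ i k))

  pos-^ : ∀ m k → + (m ^ k) ≡ (+ m) ℤ.^ k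
  pos-^ m zero    = refl
  pos-^ m (suc k) = trans (Z.pos-* m (m ^ k)) (cong (+ m ℤ.*_) (pos-^ m k))

  +∣i∣² : ∀ i → + (∣ i ∣ * ∣ i ∣) ≡ i ℤ.* i
  +∣i∣² (+ n)        = Z.pos-* n n
  +∣i∣² ℤ.-[1+ n ] = refl

  ∣i-j∣≡1 : ∀ m n → ∣ + m ℤ.- + n ∣ ≡ 1 → m ≡ suc n ⊎ n ≡ suc m
  ∣i-j∣≡1 m n eq with Z.+∣i∣≡i⊎+∣i∣≡-i (+ m ℤ.- + n)
  ... | inj₁ e = inj₁ (Z.+-injective (trans (id₁ (+ m) (+ n)) (cong (ℤ._+ + n) (trans (sym e) (cong +_ eq)))))
    where
    id₁ : ∀ x y → x ≡ (x ℤ.- y) ℤ.+ y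
    id₁ = solve-∀
  ... | inj₂ e = inj₂ (Z.+-injective (trans (id₁ (+ m) (+ n)) (cong (ℤ._+ + m) (trans (sym e) (cong +_ eq)))))
    where
    id₁ : ∀ x y → y ≡ ℤ.- (x ℤ.- y) ℤ.+ x
    id₁ = solve-∀

  ∣-abs-+ : ∀ {p} i j → p ∣ ∣ i ∣ → p ∣ ∣ i ℤ.+ j ∣ → p ∣ ∣ j ∣
  ∣-abs-+ {p} i j p∣i p∣i+j =
    Z.∣⇒∣ᵤ {+ p} (Z.∣m+n∣m⇒∣n (Z.∣ᵤ⇒∣ {+ p} {i ℤ.+ j} p∣i+j) (Z.∣ᵤ⇒∣ {+ p} {i} p∣i))

  ∣-abs-* : ∀ {p} i j → p ∣ ∣ i ∣ → p ∣ ∣ i ℤ.* j ∣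
  ∣-abs-* {p} i j p∣i = subst (p ∣_) (sym (Z.abs-* i j)) (N.∣m⇒∣m*n _ p∣i)

  m*m≡1 : ∀ {m} → m * m ≡ 1 → m ≡ 1
  m*m≡1 {m} eq = N.m*n≡1⇒m≡1 m m eq

-- Congruences and size bounds for R and S.

-- Here κ = 4/g² with g = 1 or 2, so that q, E and w satisfy κ(E + w) = 4q.
module OddPowers where
  open import Data.Nat
  open import Data.Integer as ℤ using (+_; ∣_∣)
  open PrimePowers
  open AbsoluteValues
  open Powers using (R; S; T; U)

  norm-abs : ∀ κ E w q → .⦃ NonZero κ ⦄ → κ * (E + w) ≡ 4 * q → ∀ h →
    let r = ∣ R (+ q) (+ (κ * w)) h ∣
        s = ∣ S (+ q) (+ (κ * w)) h ∣ in
    E * (r * r) + w * (s * s) ≡ (E + w) * (q ^ h * q ^ h)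
  norm-abs κ E w q eq h = Z.+-injective (begin
    + (E * (r * r) + w * (s * s))                       ≡⟨ cong₂ ℤ._+_ (Z.pos-* E (r * r)) (Z.pos-* w (s * s)) ⟩
    + E ℤ.* + (r * r) ℤ.+ + w ℤ.* + (s * s)             ≡⟨ cong₂ (λ x y → + E ℤ.* x ℤ.+ + w ℤ.* y) (+∣i∣² R') (+∣i∣² S') ⟩
    + E ℤ.* (R' ℤ.* R') ℤ.+ + w ℤ.* (S' ℤ.* S')         ≡⟨ cong
        (λ ω → + E ℤ.* (R (+ q) ω h ℤ.* R (+ q) ω h) ℤ.+ + w ℤ.* (S (+ q) ω h ℤ.* S (+ q) ω h)) (Z.pos-* κ w) ⟩
    _                                                   ≡⟨ Powers.norm-form (+ κ) (+ E) (+ w) (+ q) eqℤ h ⟩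
    + (E + w) ℤ.* ((+ q) ℤ.^ h ℤ.* (+ q) ℤ.^ h)         ≡⟨ cong (λ x → + (E + w) ℤ.* (x ℤ.* x)) (pos-^ q h) ⟨
    + (E + w) ℤ.* (+ (q ^ h) ℤ.* + (q ^ h))             ≡⟨ cong (+ (E + w) ℤ.*_) (Z.pos-* (q ^ h) (q ^ h)) ⟨
    + (E + w) ℤ.* + (q ^ h * q ^ h)                     ≡⟨ Z.pos-* (E + w) (q ^ h * q ^ h) ⟨
    + ((E + w) * (q ^ h * q ^ h))                       ∎)
    where
    open ≡-Reasoning
    R' = R (+ q) (+ (κ * w)) h
    S' = S (+ q) (+ (κ * w)) h
    r = ∣ R' ∣
    s = ∣ S' ∣
    eqℤ : + κ ℤ.* (+ E ℤ.+ + w) ≡ + 4 ℤ.* + q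
    eqℤ = trans (sym (Z.pos-* κ (E + w))) (trans (cong +_ eq) (Z.pos-* 4 q))

  -- Because b ∣ ω, `S-mod-ω` gives S ≡ (2h + 1)q^h modulo b.
  ∤⇒∤S : ∀ {b} → Prime b → ∀ q ω h → b ∣ ω → ¬ b ∣ q → ¬ b ∣ suc (h + h) → ¬ b ∣ ∣ S (+ q) (+ ω) h ∣
  ∤⇒∤S {b} pr q ω h b∣ω b∤q b∤m b∣S with Powers.S-mod-ω (+ q) (+ ω) h
  ... | x , eq with euclidsLemma (suc (h + h)) (q ^ h) pr b∣mq^h
    where
    b∣ : b ∣ ∣ + suc (h + h) ℤ.* (+ q) ℤ.^ h ∣
    b∣ = ∣-abs-+ (+ ω ℤ.* x) (+ suc (h + h) ℤ.* (+ q) ℤ.^ h) (∣-abs-* (+ ω) x b∣ω)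
           (subst (λ t → b ∣ ∣ t ∣) (trans eq (Z.+-comm (+ suc (h + h) ℤ.* (+ q) ℤ.^ h) (+ ω ℤ.* x))) b∣S)
    b∣mq^h : b ∣ suc (h + h) * q ^ h
    b∣mq^h = subst (b ∣_) (trans (Z.abs-* (+ suc (h + h)) ((+ q) ℤ.^ h)) (cong (suc (h + h) *_) (abs-^ (+ q) h))) b∣
  ... | inj₁ b∣m   = b∤m b∣m
  ... | inj₂ b∣q^h = b∤q (prime∣^⇒∣ pr h b∣q^h)

  -- Unit coordinates give α^(2h+1) the same norm as α, and q ≥ 2 then forces h = 0.
  unit-power : ∀ κ E w q → .⦃ NonZero κ ⦄ → κ * (E + w) ≡ 4 * q → 2 ≤ q → ∀ h →
    ∣ R (+ q) (+ (κ * w)) h ∣ ≡ 1 → ∣ S (+ q) (+ (κ * w)) h ∣ ≡ 1 → h ≡ 0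
  unit-power κ E w q eq 2≤q h r≡1 s≡1 = [ id , (λ q≡1 → ⊥-elim (N.<⇒≢ 2≤q (sym q≡1))) ]′ (N.m^n≡1⇒n≡0∨m≡1 q h q^h≡1)
    where
    open import Function using (id)
    E+w≢0 : NonZero (E + w)
    E+w≢0 = ≢-nonZero λ e → N.<⇒≢ (N.<-≤-trans z<s (N.*-mono-≤ {4} {4} N.≤-refl 2≤q))
      (trans (sym (N.*-zeroʳ κ)) (trans (cong (κ *_) (sym e)) eq))
    identity : E * 1 + w * 1 ≡ (E + w) * 1
    identity = sym (N.*-distribʳ-+ 1 E w)
    q^h≡1 : q ^ h ≡ 1
    q^h≡1 = m*m≡1 (N.*-cancelˡ-≡ (q ^ h * q ^ h) 1 (E + w) ⦃ E+w≢0 ⦄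
      (trans (sym (norm-abs κ E w q eq h)) (trans (cong₂ (λ r s → E * (r * r) + w * (s * s)) r≡1 s≡1) identity)))

  -- If q^h ≥ m, then E + wm² ≥ ER² + wS² = (E + w)q^(2h) ≥ (E + w)m², impossible for E > 0 and m ≥
  -- 2.
  S-bound : ∀ κ E w q → .⦃ NonZero κ ⦄ → κ * (E + w) ≡ 4 * q → 0 < E → ∀ h {m} → 2 ≤ m →
    ∣ R (+ q) (+ (κ * w)) h ∣ ≡ 1 → ∣ S (+ q) (+ (κ * w)) h ∣ ≤ m → q ^ h < m
  S-bound κ E w q eq 0<E h {m} 2≤m r≡1 s≤m with q ^ h N.<? m
  ... | yes p = p
  ... | no ¬p = ⊥-elim (N.<-irrefl refl (begin-strict
    (E + w) * (q ^ h * q ^ h)  ≡⟨ norm-abs κ E w q eq h ⟨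
    E * (r * r) + w * (s * s)  ≡⟨ cong (λ t → E * (t * t) + w * (s * s)) r≡1 ⟩
    E * 1 + w * (s * s)        ≤⟨ N.+-monoʳ-≤ (E * 1) (N.*-monoʳ-≤ w (N.*-mono-≤ s≤m s≤m)) ⟩
    E * 1 + w * (m * m)        <⟨ N.+-monoˡ-< _ (N.*-monoʳ-< E ⦃ >-nonZero 0<E ⦄ (N.*-mono-≤ {2} {m} {1} 2≤m (N.<⇒≤ 2≤m))) ⟩
    E * (m * m) + w * (m * m)  ≡⟨ N.*-distribʳ-+ (m * m) E w ⟨
    (E + w) * (m * m)          ≤⟨ N.*-monoʳ-≤ (E + w) (N.*-mono-≤ m≤ m≤) ⟩
    (E + w) * (q ^ h * q ^ h)  ∎))
    where
    open N.≤-Reasoning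
    r = ∣ R (+ q) (+ (κ * w)) h ∣
    s = ∣ S (+ q) (+ (κ * w)) h ∣
    m≤ : m ≤ q ^ h
    m≤ = N.≮⇒≥ ¬p

  -- For b = 2k+1 the coefficient of ω in qS is divisible by b, hence qS ≡ b q^(k+1) modulo b².
  b∣S⇒S≡b : ∀ {b} → Prime b → 5 ≤ b → ∀ q ω k → b ≡ suc (k + k) → b ∣ ω → ¬ b ∣ q →
    ∀ s → ∣ S (+ q) (+ ω) k ∣ ≡ b ^ s → s ≤ 1
  b∣S⇒S≡b pr 5≤b q ω k eqb b∣ω b∤q zero          _  = z≤n
  b∣S⇒S≡b pr 5≤b q ω k eqb b∣ω b∤q (suc zero)    _  = s≤s z≤n
  b∣S⇒S≡b {b} pr 5≤b q ω k eqb b∣ω b∤q (suc (suc s)) eqS with Powers.S-mod-ω² (+ q) (+ ω) k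
  ... | x , eq = ⊥-elim (b∤q (prime∣^⇒∣ pr (suc k) (N.*-cancelˡ-∣ b ⦃ prime⇒nonZero pr ⦄ b²∣)))
    where
    coeff : ℤ
    coeff = + 2 ℤ.* U k ℤ.- T k
    b∣6coeff : b ∣ 6 * ∣ coeff ∣
    b∣6coeff = subst (b ∣_) (trans (cong ∣_∣ (sym (Powers.6[2U-T]≡ k))) (Z.abs-* (+ 6) coeff))
      (subst (λ t → b ∣ ∣ + t ℤ.* (+ k ℤ.* (1ℤ ℤ.+ + k)) ∣) eqb (∣-abs-* (+ b) _ N.∣-refl))
    b∤6 : ¬ b ∣ 6
    b∤6 b∣6 with euclidsLemma 2 3 pr b∣6
    ... | inj₁ b∣2 = N.<⇒≱ (N.≤-trans (from-yes (3 ≤? 5)) 5≤b) (N.∣⇒≤ b∣2)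
    ... | inj₂ b∣3 = N.<⇒≱ (N.≤-trans (from-yes (4 ≤? 5)) 5≤b) (N.∣⇒≤ b∣3)
    b∣coeff : b ∣ ∣ coeff ∣
    b∣coeff with euclidsLemma 6 ∣ coeff ∣ pr b∣6coeff
    ... | inj₁ b∣6 = ⊥-elim (b∤6 b∣6)
    ... | inj₂ b∣c = b∣c
    b∣ᶻcoeff : + b Z.∣ coeff
    b∣ᶻcoeff = Z.∣ᵤ⇒∣ {+ b} {coeff} b∣coeff
    b∣ᶻω : + b Z.∣ + ω
    b∣ᶻω = Z.∣ᵤ⇒∣ {+ b} {+ ω} b∣ω
    identity : ∀ c b w x y z → c ℤ.* b ℤ.* (z ℤ.* (w ℤ.* b)) ℤ.- (w ℤ.* b) ℤ.* (w ℤ.* b) ℤ.* x ℤ.+ b ℤ.* b ℤ.* y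
      ≡ (c ℤ.* (z ℤ.* w) ℤ.- w ℤ.* w ℤ.* x ℤ.+ y) ℤ.* (b ℤ.* b)
    identity = solve-∀
    move : ∀ m n z y → m ℤ.- n ℤ.+ z ≡ y → m ≡ n ℤ.- z ℤ.+ y
    move m n z y e = trans (id₁ m n z) (cong (λ t → n ℤ.- z ℤ.+ t) e)
      where
      id₁ : ∀ m n z → m ≡ n ℤ.- z ℤ.+ (m ℤ.- n ℤ.+ z)
      id₁ = solve-∀
    Sq : + (b * b) Z.∣ S (+ q) (+ ω) k
    Sq = Z.∣ᵤ⇒∣ {+ (b * b)} {S (+ q) (+ ω) k} (subst (b * b ∣_) (sym eqS)
        (divides (b ^ s) (trans (sym (N.*-assoc b b _)) (N.*-comm (b * b) _))))
    b²∣ᶻ : + (b * b) Z.∣ + suc (k + k) ℤ.* ((+ q) ℤ.* (+ q) ℤ.^ k)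
    b²∣ᶻ with Sq | b∣ᶻcoeff | b∣ᶻω
    ... | Z.divides t et | Z.divides c ec | Z.divides w ew = Z.divides
        (c ℤ.* ((+ q) ℤ.^ k ℤ.* w) ℤ.- w ℤ.* w ℤ.* x ℤ.+ + q ℤ.* t)
      (trans (move _ (coeff ℤ.* ((+ q) ℤ.^ k ℤ.* + ω)) (+ ω ℤ.* + ω ℤ.* x) (+ q ℤ.* S (+ q) (+ ω) k) (sym eq))
      (trans (cong₂ (λ a o → a ℤ.* ((+ q) ℤ.^ k ℤ.* o) ℤ.- o ℤ.* o ℤ.* x ℤ.+ + q ℤ.* S (+ q) (+ ω) k) ec ew)
      (trans (cong (λ y → c ℤ.* + b ℤ.* ((+ q) ℤ.^ k ℤ.* (w ℤ.* + b)) ℤ.- (w ℤ.* + b) ℤ.* (w ℤ.* + b) ℤ.* x ℤ.+ y)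
               (trans (cong (+ q ℤ.*_) (trans et (cong (t ℤ.*_) (Z.pos-* b b)))) (rearr (+ q) t (+ b))))
      (trans (identity c (+ b) w x (+ q ℤ.* t) ((+ q) ℤ.^ k))
        (cong ((c ℤ.* ((+ q) ℤ.^ k ℤ.* w) ℤ.- w ℤ.* w ℤ.* x ℤ.+ + q ℤ.* t) ℤ.*_) (sym (Z.pos-* b b)))))))
      where
      rearr : ∀ q t b → q ℤ.* (t ℤ.* (b ℤ.* b)) ≡ b ℤ.* b ℤ.* (q ℤ.* t)
      rearr = solve-∀
    b²∣ : b * b ∣ b * q ^ suc k
    b²∣ = subst (b * b ∣_)
      (trans (Z.abs-* (+ suc (k + k)) ((+ q) ℤ.^ suc k)) (cong₂ _*_ (sym eqb) (abs-^ (+ q) (suc k))))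
      (Z.∣⇒∣ᵤ b²∣ᶻ)

  -- The data of writing α^(2h+1) as the (2k+1)-st power of β = α^(2h'+1): `E'`, `w'` and `q'` are
  -- the parameters of β, and r, s its coordinates relative to those of α.
  record Descent (κ E w q h k : ℕ) : Set where
    field
      r s h' : ℕ
    E' : ℕ
    E' = E * (r * r)
    w' : ℕ
    w' = w * (s * s)
    q' : ℕ
    q' = q * (q ^ h' * q ^ h')
    field
      R≡ : ∣ R (+ q) (+ (κ * w)) h ∣ ≡ r * ∣ R (+ q') (+ (κ * w')) k ∣
      S≡ : ∣ S (+ q) (+ (κ * w)) h ∣ ≡ s * ∣ S (+ q') (+ (κ * w')) k ∣
      κ[E+w]≡4q : κ * (E' + w') ≡ 4 * q'

  descend : ∀ κ E w q → .⦃ NonZero κ ⦄ → κ * (E + w) ≡ 4 * q → ∀ h k →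
    suc (k + k) ∣ suc (h + h) → Descent κ E w q h k
  descend κ E w q eq h k (divides t eqt) with odd⊎even t
  ... | h' , inj₁ refl = ⊥-elim (even≢odd (h' * suc (k + k)) h
    (trans (sym (N.*-distribʳ-+ (suc (k + k)) h' h')) (sym eqt)))
  ... | h' , inj₂ refl = record
    { r = ∣ R (+ q) ω h' ∣ ; s = ∣ S (+ q) ω h' ∣ ; h' = h'
    ; R≡ = trans (cong (λ n → ∣ R (+ q) ω n ∣) h≡) (trans (cong ∣_∣ (proj₁ (I.R-P-iterate k)))
        (trans (Z.abs-* (R (+ q) ω h') _) (cong₂ (λ a b → ∣ R (+ q) ω h' ∣ * ∣ R a b k ∣) q₁≡ ω₁≡)))
    ; S≡ = trans (cong (λ n → ∣ S (+ q) ω n ∣) h≡) (trans (cong ∣_∣ (I.S-iterate k))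
        (trans (Z.abs-* (S (+ q) ω h') _) (cong₂ (λ a b → ∣ S (+ q) ω h' ∣ * ∣ S a b k ∣) q₁≡ ω₁≡)))
    ; κ[E+w]≡4q = trans (cong (κ *_) (norm-abs κ E w q eq h'))
        (trans (sym (N.*-assoc κ (E + w) _)) (trans (cong (_* (q ^ h' * q ^ h')) eq) (N.*-assoc 4 q _)))
    }
    where
    ω = + (κ * w)
    module I = Powers.Iterate (+ q) ω h'
    open NS.+-*-Solver
    2h+1≡ : ∀ k → suc (I.iterate k + I.iterate k) ≡ suc (h' + h') * suc (k + k)
    2h+1≡ zero    = sym (N.*-identityʳ _)
    2h+1≡ (suc k) = trans (solve 2 (λ h i → con 1 :+ ((con 1 :+ (h :+ h) :+ i) :+ (con 1 :+ (h :+ h) :+ i))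
        := (con 1 :+ (i :+ i)) :+ (con 1 :+ (h :+ h)) :* con 2) refl h' (I.iterate k))
      (trans (cong (_+ suc (h' + h') * 2) (2h+1≡ k))
      (solve 2 (λ h k → (con 1 :+ (h :+ h)) :* (con 1 :+ (k :+ k)) :+ (con 1 :+ (h :+ h)) :* con 2
        := (con 1 :+ (h :+ h)) :* (con 1 :+ ((con 1 :+ k) :+ (con 1 :+ k)))) refl h' k))
    h≡ : h ≡ I.iterate k
    h≡ = double-injective (N.suc-injective (trans eqt (sym (2h+1≡ k))))
    q₁≡ : I.q₁ ≡ + (q * (q ^ h' * q ^ h'))
    q₁≡ = sym (trans (Z.pos-* q _) (cong (+ q ℤ.*_) (trans (Z.pos-* (q ^ h') _) (cong (λ t → t ℤ.* t) (pos-^ q h')))))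
    ω₁≡ : I.ω₁ ≡ + (κ * (w * (∣ S (+ q) ω h' ∣ * ∣ S (+ q) ω h' ∣)))
    ω₁≡ = sym (trans (cong +_ (sym (N.*-assoc κ w _)))
      (trans (Z.pos-* (κ * w) _) (cong (ω ℤ.*_) (+∣i∣² (S (+ q) ω h')))))

  -- If 9 divided w, then for s ≥ 2 the equation modulo 9 would give 9 ∣ 3; for s ≤ 1 the term mw ≥
  -- 18 is too large.
  w≡3 : ∀ m w y s → 2 ≤ m → w ≡ 3 ^ suc y → (m * w + 3 ≡ 3 ^ s ⊎ m * w ≡ 3 ^ s + 3) → w ≡ 3
  w≡3 m w zero s 2≤m eqw eq = eqw
  w≡3 m w (suc y) s 2≤m eqw eq = ⊥-elim (impossible s eq)
    where
    9∣w : 9 ∣ m * w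
    9∣w = N.∣n⇒∣m*n m (subst (9 ∣_) (sym eqw) (divides (3 ^ y) (trans (sym (N.*-assoc 3 3 (3 ^ y))) (N.*-comm 9 (3 ^ y)))))
    18≤mw : 18 ≤ m * w
    18≤mw = N.*-mono-≤ 2≤m (subst (9 ≤_) (sym eqw) (N.^-monoʳ-≤ 3 {2} {2 + y} (N.m≤m+n 2 y)))
    small : ∀ {n} → n ≤ 3 → ¬ (m * w + 3 ≡ n ⊎ m * w ≡ n + 3)
    small n≤3 (inj₁ e) = N.<⇒≱ (N.≤-<-trans n≤3 (from-yes (3 <? 18)))
        (N.≤-trans 18≤mw (N.≤-trans (N.m≤m+n _ 3) (N.≤-reflexive e)))
    small n≤3 (inj₂ e) = N.<⇒≱ (N.≤-<-trans (N.+-monoˡ-≤ 3 n≤3) (from-yes (6 <? 18))) (N.≤-trans 18≤mw (N.≤-reflexive e))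
    9∤3 : ¬ 9 ∣ 3
    9∤3 = from-no (9 ∣? 3)
    impossible : ∀ s → ¬ (m * w + 3 ≡ 3 ^ s ⊎ m * w ≡ 3 ^ s + 3)
    impossible zero       = small z<s
    impossible (suc zero) = small N.≤-refl
    impossible (suc (suc s)) (inj₁ e) = 9∤3 (N.∣m+n∣m⇒∣n (subst (9 ∣_) (sym e) (9∣ s)) 9∣w)
      where
      9∣ : ∀ s → 9 ∣ 3 ^ (2 + s)
      9∣ s = divides (3 ^ s) (trans (sym (N.*-assoc 3 3 (3 ^ s))) (N.*-comm 9 (3 ^ s)))
    impossible (suc (suc s)) (inj₂ e) = 9∤3 (N.∣m+n∣m⇒∣n (subst (9 ∣_) e 9∣w)
      (divides (3 ^ s) (trans (sym (N.*-assoc 3 3 (3 ^ s))) (N.*-comm 9 (3 ^ s)))))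

-- No proper power has admissible coordinates: a = 2.

module TrivialPowers where
  open import Data.Nat
  open import Data.Integer as ℤ using (+_; ∣_∣)
  open PrimePowers
  open AbsoluteValues
  open Powers using (R; S)
  open OddPowers

  prime^≥ : ∀ {p} → Prime p → ∀ {n} → 0 < n → p ≤ p ^ n
  prime^≥ {p} pr {suc n} _ = N.m≤m*n p (p ^ n) ⦃ N.m^n≢0 p n ⦃ prime⇒nonZero pr ⦄ ⦄

  ∣prime^ : ∀ {p n} → 0 < n → p ∣ p ^ n
  ∣prime^ {p} {suc n} _ = N.m∣m*n (p ^ n)

  power-product : ∀ {b m n s} → Prime b → m * n ≡ b ^ s → ∃[ t ] ∃[ t' ] (m ≡ b ^ t × n ≡ b ^ t')
  power-product {b} {m} {n} {s} pr eq
    with ∣prime^⇒≡^ pr s (subst (m ∣_) eq (N.m∣m*n n)) | ∣prime^⇒≡^ pr s (subst (n ∣_) eq (N.n∣m*n m))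
  ... | t , e | t' , e' = t , t' , e , e'

  power≤ : ∀ {b n} → Prime b → n ≤ 1 → b ^ n ≤ b
  power≤ {b} {n} pr n≤1 = N.≤-trans (N.^-monoʳ-≤ b ⦃ prime⇒nonZero pr ⦄ n≤1) (N.≤-reflexive (N.*-identityʳ b))

  unit-value : ∀ {b n s} → Prime b → n ≡ b ^ s → ¬ b ∣ n → n ≡ 1
  unit-value {s = zero}  pr e b∤n = e
  unit-value {b} {s = suc s} pr e b∤n = ⊥-elim (b∤n (subst (b ∣_) (sym e) (N.m∣m*n (b ^ s))))

  odd-prime≥ : ∀ {b k} → Prime b → b ≡ suc (k + k) → k ≡ 1 ⊎ (2 ≤ k × 5 ≤ b)
  odd-prime≥ {k = zero} pr refl = ⊥-elim (prime∤1 pr N.∣-refl)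
  odd-prime≥ {k = suc zero} pr refl = inj₁ refl
  odd-prime≥ {k = suc (suc k)} pr refl = inj₂ (s≤s z<s ,
    s≤s (s≤s (s≤s (N.≤-trans (N.m≤m+n 2 k) (N.m≤n+m (2 + k) k)))))

  S-one : ∀ q ω → S q ω 1 ≡ + 3 ℤ.* q ℤ.- ω
  S-one = identity
    where
    identity : ∀ q ω → + 2 ℤ.* (q ℤ.* (1ℤ ℤ.+ 1ℤ) ℤ.- ω ℤ.* 1ℤ) ℤ.- (q ℤ.* 1ℤ ℤ.- ω ℤ.* 1ℤ) ≡ + 3 ℤ.* q ℤ.- ω
    identity = solve-∀

  R-one : ∀ q ω → R q ω 1 ≡ q ℤ.- ω
  R-one = identity
    where
    identity : ∀ q ω → q ℤ.* 1ℤ ℤ.- ω ℤ.* 1ℤ ≡ q ℤ.- ω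
    identity = solve-∀

  -- The prime 3 divides 6, so `b∣S⇒S≡b` does not cover it. With E = 2^x and W = 3^Y one has R = E -
  -- 3W and S = 3E - W; R = ±1 makes S = 8W ± 3, whence W = 3, and then E = 10 or S = 21, neither a
  -- power of the required prime.
  no-cube : ∀ x Y t' → 0 < Y → ∣ R (+ (2 ^ x + 3 ^ Y)) (+ (4 * 3 ^ Y)) 1 ∣ ≡ 1 →
    ∣ S (+ (2 ^ x + 3 ^ Y)) (+ (4 * 3 ^ Y)) 1 ∣ ≡ 3 ^ t' → ⊥
  no-cube x Y t' 0<Y R₁≡1 S₁≡ = case-3 (∣i-j∣≡1 E (3 * W) (trans (cong ∣_∣ R₁) R₁≡1))
    where
    E = 2 ^ x
    W = 3 ^ Y
    R₁ : + E ℤ.- + (3 * W) ≡ R (+ (E + W)) (+ (4 * W)) 1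
    R₁ = sym (trans (R-one (+ (E + W)) (+ (4 * W)))
        (trans (cong (λ z → + (E + W) ℤ.- z) (Z.pos-* 4 W))
        (trans (identity (+ E) (+ W)) (cong (λ z → + E ℤ.- z) (sym (Z.pos-* 3 W))))))
      where
      identity : ∀ e w → (e ℤ.+ w) ℤ.- + 4 ℤ.* w ≡ e ℤ.- + 3 ℤ.* w
      identity = solve-∀
    S₁ : S (+ (E + W)) (+ (4 * W)) 1 ≡ + (3 * E) ℤ.- + W
    S₁ = trans (S-one (+ (E + W)) (+ (4 * W))) (trans (cong (λ z → + 3 ℤ.* + (E + W) ℤ.- z) (Z.pos-* 4 W))
        (trans (identity (+ E) (+ W)) (cong (ℤ._- + W) (sym (Z.pos-* 3 E)))))
      where
      identity : ∀ e w → + 3 ℤ.* (e ℤ.+ w) ℤ.- + 4 ℤ.* w ≡ + 3 ℤ.* e ℤ.- w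
      identity = solve-∀
    open NS.+-*-Solver
    difference : ∀ m n d → m ≡ n + d → ∣ + m ℤ.- + n ∣ ≡ d
    difference m n d refl = cong ∣_∣ (identity (+ n) (+ d))
      where
      identity : ∀ n d → n ℤ.+ d ℤ.- n ≡ d
      identity = solve-∀
    W-3 : 8 * W + 3 ≡ 3 ^ t' ⊎ 8 * W ≡ 3 ^ t' + 3 → W ≡ 3
    W-3 = w≡3 8 W (pred Y) t' (s≤s z<s) (cong (3 ^_) (sym (N.suc-pred Y ⦃ >-nonZero 0<Y ⦄)))
    not-power : ∀ p → Prime p → p ≢ 2 → p ∣ E → ⊥
    not-power p prp p≢2 p∣E = p≢2 (prime∣prime^⇒≡ prp prime[2] x p∣E)
    case-3 : E ≡ suc (3 * W) ⊎ 3 * W ≡ suc E → ⊥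
    case-3 (inj₁ e) = not-power 5 (from-yes (prime? 5)) (λ ())
        (subst (5 ∣_) (sym (trans e (cong (λ W → suc (3 * W)) (W-3 (inj₁ (trans (sym S≡₁) S₁≡)))))) (divides 2 refl))
      where
      S≡₁ : ∣ S (+ (E + W)) (+ (4 * W)) 1 ∣ ≡ 8 * W + 3
      S≡₁ = trans (cong ∣_∣ S₁) (difference (3 * E) W (8 * W + 3) (trans (cong (3 *_) e)
        (solve 1 (λ w → con 3 :* (con 1 :+ con 3 :* w) := w :+ (con 8 :* w :+ con 3)) refl W)))
    case-3 (inj₂ e) = not-7 (prime∣prime^⇒≡ (from-yes (prime? 7)) (from-yes (prime? 3)) t'
        (divides 3 (N.+-cancelʳ-≡ 3 _ _ (trans (sym 8W≡) (cong (8 *_) W≡3)))))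
      where
      not-7 : 7 ≢ 3
      not-7 ()
      S≡₁ : ∣ S (+ (E + W)) (+ (4 * W)) 1 ∣ + 3 ≡ 8 * W
      S≡₁ = trans (cong (_+ 3) (trans (cong ∣_∣ S₁) (difference (3 * E) W (8 * W ∸ 3)
        (trans (sym (N.m+n∸n≡m (3 * E) 3)) (trans (cong (_∸ 3)
            (trans (solve 1 (λ e → con 3 :* e :+ con 3 := con 3 :* (con 1 :+ e)) refl E)
            (trans (cong (3 *_) (sym e)) (solve 1 (λ w → con 3 :* (con 3 :* w) := w :+ con 8 :* w) refl W))))
            (N.+-∸-assoc W 3≤8W))))))
        (N.m∸n+n≡m 3≤8W)
        where
        3≤8W : 3 ≤ 8 * W
        3≤8W = N.*-mono-≤ {3} {8} {1} (s≤s (s≤s z<s)) (N.m^n>0 3 Y)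
      8W≡ : 8 * W ≡ 3 ^ t' + 3
      8W≡ = trans (sym S≡₁) (cong (_+ 3) S₁≡)
      W≡3 : W ≡ 3
      W≡3 = W-3 (inj₂ 8W≡)

  no-odd-power : ∀ {b} → Prime b → b ≢ 2 → ∀ x y → 0 < x → 0 < y → ∀ h s →
    ∣ R (+ (2 ^ x + b ^ y)) (+ (4 * b ^ y)) h ∣ ≡ 1 → ∣ S (+ (2 ^ x + b ^ y)) (+ (4 * b ^ y)) h ∣ ≡ b ^ s → h ≡ 0
  no-odd-power {b} pr b≢2 x y 0<x 0<y h s R≡1 S≡ with b ∣? suc (h + h)
  ... | no b∤m = unit-power 4 E w q refl 2≤q h R≡1 (unit-value {s = s} pr S≡ (∤⇒∤S pr q (4 * w) h (N.∣n⇒∣m*n 4 b∣w) b∤q b∤m))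
    where
    E = 2 ^ x
    w = b ^ y
    q = E + w
    2≤q : 2 ≤ q
    2≤q = N.≤-trans (prime^≥ prime[2] 0<x) (N.m≤m+n E w)
    b∣w : b ∣ w
    b∣w = ∣prime^ 0<y
    b∤q : ¬ b ∣ q
    b∤q b∣q = b≢2 (prime∣prime^⇒≡ pr prime[2] x (N.∣m+n∣m⇒∣n (subst (b ∣_) (N.+-comm E w) b∣q) b∣w))
  ... | yes b∣m with prime≢2⇒odd pr b≢2
  ... | k , b≡ = ⊥-elim (contradiction (descend 4 E w q refl h k (subst (_∣ suc (h + h)) b≡ b∣m)))
    where
    E = 2 ^ x
    w = b ^ y
    q = E + w
    contradiction : ¬ Descent 4 E w q h k
    contradiction D with power-product {m = Descent.s D} {s = s} pr (trans (sym (Descent.S≡ D)) S≡)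
    ... | t , t' , s≡ , S'≡ = cases (odd-prime≥ pr b≡)
      where
      module D = Descent D
      r≡1 : D.r ≡ 1
      r≡1 = N.m*n≡1⇒m≡1 D.r _ (trans (sym D.R≡) R≡1)
      R'≡1 : ∣ R (+ D.q') (+ (4 * D.w')) k ∣ ≡ 1
      R'≡1 = N.m*n≡1⇒n≡1 D.r _ (trans (sym D.R≡) R≡1)
      E'≡ : D.E' ≡ E
      E'≡ = trans (cong (λ t → E * (t * t)) r≡1) (N.*-identityʳ E)
      w'≡ : D.w' ≡ b ^ (y + (t + t))
      w'≡ = trans (cong (λ u → w * (u * u)) s≡) (trans (cong (w *_) (sym (N.^-distribˡ-+-* b t t)))
          (sym (N.^-distribˡ-+-* b y (t + t))))
      0<y' : 0 < y + (t + t)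
      0<y' = N.<-≤-trans 0<y (N.m≤m+n y (t + t))
      q'≡ : D.q' ≡ 2 ^ x + b ^ (y + (t + t))
      q'≡ = trans (N.*-cancelˡ-≡ D.q' (D.E' + D.w') 4 (sym D.κ[E+w]≡4q)) (cong₂ _+_ E'≡ w'≡)
      b∣w' : b ∣ D.w'
      b∣w' = subst (b ∣_) (sym w'≡) (∣prime^ 0<y')
      b∤q' : ¬ b ∣ D.q'
      b∤q' b∣q = b≢2 (prime∣prime^⇒≡ pr prime[2] x
        (N.∣m+n∣m⇒∣n (subst (b ∣_) (trans q'≡ (N.+-comm E _)) b∣q) (∣prime^ 0<y')))
      3≤q' : 3 ≤ D.q'
      3≤q' = subst (3 ≤_) (sym q'≡)
        (N.+-mono-≤ (prime^≥ prime[2] 0<x) (N.m^n>0 b ⦃ prime⇒nonZero pr ⦄ (y + (t + t))))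
      cases : k ≡ 1 ⊎ (2 ≤ k × 5 ≤ b) → ⊥
      -- `S-bound` for β, with S' at most b, gives q'^k < b = 2k + 1, against 3^k ≤ q'^k.
      cases (inj₂ (2≤k , 5≤b)) = N.<⇒≱ bound (N.≤-trans (subst (_≤ 3 ^ k) (sym b≡) (3^k>2k k)) (N.^-monoˡ-≤ k 3≤q'))
        where
        t'≤1 : t' ≤ 1
        t'≤1 = b∣S⇒S≡b pr 5≤b D.q' (4 * D.w') k b≡ (N.∣n⇒∣m*n 4 b∣w') b∤q' t' S'≡
        bound : D.q' ^ k < b
        bound = S-bound 4 D.E' D.w' D.q' D.κ[E+w]≡4q (subst (0 <_) (sym E'≡) (N.m^n>0 2 x)) k (prime>1 pr) R'≡1
          (subst (_≤ b) (sym S'≡) (power≤ pr t'≤1))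
      cases (inj₁ refl) = no-cube x (y + (t + t)) t' 0<y'
        (subst₂ (λ q w → ∣ R (+ q) (+ (4 * w)) 1 ∣ ≡ 1) (trans q'≡ (cong (λ b → E + b ^ (y + (t + t))) b≡))
            (trans w'≡ (cong (_^ (y + (t + t))) b≡)) R'≡1)
        (trans (subst₂ (λ q w → ∣ S (+ q) (+ (4 * w)) 1 ∣ ≡ b ^ t') (trans q'≡ (cong (λ b → E + b ^ (y + (t + t))) b≡))
            (trans w'≡ (cong (_^ (y + (t + t))) b≡)) S'≡) (cong (_^ t') b≡))

-- No proper power has admissible coordinates: c = 2, with halves.

module TrivialPowers₂ where
  open import Data.Nat
  open import Data.Integer as ℤ using (+_; ∣_∣)
  open PrimePowers
  open AbsoluteValues
  open Powers using (R; P; S)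
  open OddPowers
  open TrivialPowers

  -- Transfers statements about primes dividing w and the coordinate S to primes dividing E and the
  -- coordinate R.
  swap-abs : ∀ E w q → E + w ≡ 4 * q → ∀ h →
    ∣ R (+ q) (+ (1 * E)) h ∣ ≡ ∣ S (+ q) (+ (1 * w)) h ∣ × ∣ S (+ q) (+ (1 * E)) h ∣ ≡ ∣ R (+ q) (+ (1 * w)) h ∣
  swap-abs E w q eq h with Powers.R-P-swap (+ q) (+ (1 * w)) (+ (1 * E))
      (trans (cong₂ (λ a b → + a ℤ.+ + b) (N.*-identityˡ w) (N.*-identityˡ E))
          (trans (cong +_ (trans (N.+-comm w E) eq)) (Z.pos-* 4 q))) h
  ... | eqR , eqP = trans (cong ∣_∣ eqR) (unsign s)
      , trans (cong ∣_∣ (trans (cong₂ (λ a b → + 2 ℤ.* b ℤ.- a) eqR eqP) (identity (Powers.sign h) r p))) (unsign r)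
    where
    r = R (+ q) (+ (1 * w)) h
    p = P (+ q) (+ (1 * w)) h
    s = S (+ q) (+ (1 * w)) h
    unsign : ∀ i → ∣ Powers.sign h ℤ.* i ∣ ≡ ∣ i ∣
    unsign i = trans (Z.abs-* (Powers.sign h) i) (trans (cong (_* ∣ i ∣) (Powers.∣sign∣ h)) (N.*-identityˡ ∣ i ∣))
    identity : ∀ σ r p → + 2 ℤ.* (σ ℤ.* p) ℤ.- σ ℤ.* (+ 2 ℤ.* p ℤ.- r) ≡ σ ℤ.* r
    identity = solve-∀

  -- The pairs that do admit a proper power: (√3 + √-5)/2 to the fifth, and the cubes of (√5 +
  -- √-3)/2 and (√13 + √-3)/2.
  Exceptional : ℕ → ℕ → Set
  Exceptional a b = (a ≡ 3 × b ≡ 5) ⊎ (b ≡ 3 × (a ≡ 5 ⊎ a ≡ 13))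

  odd-prime∤2^ : ∀ {b} → Prime b → b ≢ 2 → ∀ n → ¬ b ∣ 2 ^ n
  odd-prime∤2^ pr b≢2 n b∣ = b≢2 (prime∣prime^⇒≡ pr prime[2] n b∣)

  -- Since a does not divide b, the swapped `∤⇒∤S` makes R' a unit. For b ≥ 5 the bound q'^k < 2k +
  -- 1, with q' a power of 2, leaves only b = 5; for b = 3 the equation R' = q' - w' = ±1 is solved
  -- directly.
  exceptional : ∀ {a b} → Prime a → Prime b → a ≢ 2 → b ≢ 2 → a ≢ b →
    ∀ x y n → 0 < x → 0 < y → 0 < n → a ^ x + b ^ y ≡ 4 * 2 ^ n → ∀ h r s →
    ∣ R (+ (2 ^ n)) (+ (1 * b ^ y)) h ∣ ≡ a ^ r → ∣ S (+ (2 ^ n)) (+ (1 * b ^ y)) h ∣ ≡ b ^ s →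
    b ∣ suc (h + h) → Exceptional a b
  exceptional {a} {b} pa pb a≢2 b≢2 a≢b x y n 0<x 0<y 0<n eq h r s R≡ S≡ b∣m with prime≢2⇒odd pb b≢2
  ... | k , b≡ = go (descend 1 E w q (trans (N.*-identityˡ _) eq) h k (subst (_∣ suc (h + h)) b≡ b∣m))
    where
    E = a ^ x
    w = b ^ y
    q = 2 ^ n
    go : Descent 1 E w q h k → Exceptional a b
    go D with power-product {m = Descent.r D} {s = r} pa (trans (sym (Descent.R≡ D)) R≡)
            | power-product {m = Descent.s D} {s = s} pb (trans (sym (Descent.S≡ D)) S≡)
    ... | u , u' , r≡ , R'≡ | t , t' , s≡ , S'≡ = cases (odd-prime≥ pb b≡)
      where
      module D = Descent D
      N' = n + (n * D.h' + n * D.h')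
      q'≡ : D.q' ≡ 2 ^ N'
      q'≡ = trans (cong (λ z → 2 ^ n * (z * z)) (N.^-*-assoc 2 n D.h'))
        (trans (cong (2 ^ n *_) (sym (N.^-distribˡ-+-* 2 (n * D.h') _))) (sym (N.^-distribˡ-+-* 2 n _)))
      0<N' : 0 < N'
      0<N' = N.<-≤-trans 0<n (N.m≤m+n n _)
      2≤q' : 2 ≤ D.q'
      2≤q' = subst (2 ≤_) (sym q'≡) (prime^≥ prime[2] 0<N')
      a∣E' : a ∣ D.E'
      a∣E' = N.∣m⇒∣m*n (D.r * D.r) (∣prime^ 0<x)
      b∣w' : b ∣ D.w'
      b∣w' = N.∣m⇒∣m*n (D.s * D.s) (∣prime^ 0<y)
      E'+w'≡ : D.E' + D.w' ≡ 4 * D.q'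
      E'+w'≡ = trans (sym (N.*-identityˡ _)) D.κ[E+w]≡4q
      ∤q' : ∀ {p} → Prime p → p ≢ 2 → ¬ p ∣ D.q'
      ∤q' pp p≢2 p∣ = odd-prime∤2^ pp p≢2 N' (subst (_ ∣_) q'≡ p∣)
      E'≡ : D.E' ≡ a ^ (x + (u + u))
      E'≡ = trans (cong (λ z → E * (z * z)) r≡) (trans (cong (E *_) (sym (N.^-distribˡ-+-* a u u)))
          (sym (N.^-distribˡ-+-* a x (u + u))))
      w'≡ : D.w' ≡ b ^ (y + (t + t))
      w'≡ = trans (cong (λ z → w * (z * z)) s≡) (trans (cong (w *_) (sym (N.^-distribˡ-+-* b t t)))
          (sym (N.^-distribˡ-+-* b y (t + t))))
      0<E' : 0 < D.E'
      0<E' = subst (0 <_) (sym E'≡) (N.m^n>0 a ⦃ prime⇒nonZero pa ⦄ (x + (u + u)))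
      a∤R' : ¬ a ∣ ∣ R (+ D.q') (+ (1 * D.w')) k ∣
      a∤R' a∣R = ∤⇒∤S pa D.q' (1 * D.E') k (N.∣n⇒∣m*n 1 a∣E') (∤q' pa a≢2)
        (λ a∣b → a≢b (prime∣prime⇒≡ pa pb (subst (a ∣_) (sym b≡) a∣b)))
        (subst (a ∣_) (sym (proj₂ (swap-abs D.E' D.w' D.q' E'+w'≡ k))) a∣R)
      R'≡1 : ∣ R (+ D.q') (+ (1 * D.w')) k ∣ ≡ 1
      R'≡1 = unit-value {s = u'} pa R'≡ a∤R'
      a≡ : ∀ {c} → Prime c → D.E' ≡ c → a ≡ c
      a≡ pc e = prime∣prime⇒≡ pa pc (subst (a ∣_) e a∣E')
      cases : k ≡ 1 ⊎ (2 ≤ k × 5 ≤ b) → Exceptional a b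
      cases (inj₂ (2≤k , 5≤b)) = small-k k refl 2≤k
        where
        t'≤1 : t' ≤ 1
        t'≤1 = b∣S⇒S≡b pb 5≤b D.q' (1 * D.w') k b≡ (N.∣n⇒∣m*n 1 b∣w') (∤q' pb b≢2) t' S'≡
        bound : D.q' ^ k < suc (k + k)
        bound = subst (D.q' ^ k <_) b≡ (S-bound 1 D.E' D.w' D.q' D.κ[E+w]≡4q 0<E' k (prime>1 pb) R'≡1
          (subst (_≤ b) (sym S'≡) (power≤ pb t'≤1)))
        small-w : ∀ w → 5 ∣ w → w < 8 → 0 < w → w ≡ 5
        small-w _ (divides zero refl) _ ()
        small-w _ (divides (suc zero) refl) _ _ = refl
        small-w _ (divides (suc (suc m)) refl) lt _ = ⊥-elim
            (N.<⇒≱ lt (N.≤-trans (from-yes (8 ≤? 10)) (N.*-monoˡ-≤ 5 {2} {2 + m} (s≤s z<s))))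
        small-k : ∀ k' → k ≡ k' → 2 ≤ k' → Exceptional a b
        small-k (suc zero) _ (s≤s ())
        small-k (suc (suc (suc k'))) refl _ =
          ⊥-elim (N.<⇒≱ bound (N.≤-trans (2^k>2k k') (N.^-monoˡ-≤ k 2≤q')))
        -- Here q'² < 5, so q' = 2 and E' + w' = 8; as 5 divides w', the only splitting is 3 + 5.
        small-k (suc (suc zero)) refl _ = inj₁ (a≡ (from-yes (prime? 3)) E'≡3 , b≡)
          where
          q'≡2 : D.q' ≡ 2
          q'≡2 = N.≤-antisym (N.≮⇒≥ λ 2<q → N.<⇒≱ bound (N.≤-trans (from-yes (5 ≤? 9)) (N.^-monoˡ-≤ 2 2<q))) 2≤q'
          sum≡8 : D.E' + D.w' ≡ 8
          sum≡8 = trans E'+w'≡ (cong (4 *_) q'≡2)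
          w'≡5 : D.w' ≡ 5
          w'≡5 = small-w D.w' (subst (_∣ D.w') b≡ b∣w')
            (N.<-≤-trans (N.m<n+m D.w' 0<E') (N.≤-reflexive sum≡8))
            (subst (0 <_) (sym w'≡) (N.m^n>0 b ⦃ prime⇒nonZero pb ⦄ (y + (t + t))))
          E'≡3 : D.E' ≡ 3
          E'≡3 = N.+-cancelʳ-≡ 5 D.E' 3 (trans (cong (λ w → D.E' + w) (sym w'≡5)) sum≡8)
      cases (inj₁ refl) = inj₂ (b≡ , by-q (∣i-j∣≡1 Q (1 * W) (trans (cong ∣_∣ (sym (R-one (+ Q) (+ (1 * W))))) R'≡1)))
        where
        Q = D.q'
        W = D.w'
        Y = y + (t + t)
        W≡3^ : W ≡ 3 ^ suc (pred Y)
        W≡3^ = trans w'≡ (cong₂ _^_ b≡ (sym (N.suc-pred Y ⦃ >-nonZero (N.<-≤-trans 0<y (N.m≤m+n y _)) ⦄)))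
        S₁≡ : ∣ + (3 * Q) ℤ.- + (1 * W) ∣ ≡ 3 ^ t'
        S₁≡ = trans (cong (λ z → ∣ z ℤ.- + (1 * W) ∣) (Z.pos-* 3 Q))
            (trans (cong ∣_∣ (sym (S-one (+ Q) (+ (1 * W))))) (trans S'≡ (cong (_^ t') b≡)))
        3Q≡ : ∀ {d} → 3 * Q ≡ 1 * W + d → d ≡ 3 ^ t'
        3Q≡ {d} e = trans (sym (trans (cong (λ z → ∣ + z ℤ.- + (1 * W) ∣) e) (cong ∣_∣ (identity (+ (1 * W)) (+ d))))) S₁≡
          where
          identity : ∀ n d → n ℤ.+ d ℤ.- n ≡ d
          identity = solve-∀
        open NS.+-*-Solver
        E'≡-from : ∀ {m n} → W ≡ m → Q ≡ n → D.E' + m ≡ 4 * n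
        E'≡-from e e' = subst₂ (λ W Q → D.E' + W ≡ 4 * Q) e e' E'+w'≡
        by-q : Q ≡ suc (1 * W) ⊎ 1 * W ≡ suc Q → a ≡ 5 ⊎ a ≡ 13
        -- q' = w' + 1 gives S' = 2w' + 3, hence w' = 3, q' = 4 and E' = 13.
        by-q (inj₁ e) = inj₂ (a≡ (from-yes (prime? 13))
            (N.+-cancelʳ-≡ 3 D.E' 13 (E'≡-from W≡ (trans e (cong (λ W → suc (1 * W)) W≡)))))
          where
          W≡ : W ≡ 3
          W≡ = w≡3 2 W (pred Y) t' N.≤-refl W≡3^ (inj₁ (3Q≡ (trans (cong (3 *_) e)
            (solve 1 (λ w → con 3 :* (con 1 :+ con 1 :* w) := con 1 :* w :+ (con 2 :* w :+ con 3)) refl W))))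
        -- q' = w' - 1 gives S' = 2w' - 3, hence w' = 3, q' = 2 and E' = 5.
        by-q (inj₂ e) = inj₁ (a≡ (from-yes (prime? 5))
            (N.+-cancelʳ-≡ 3 D.E' 5 (E'≡-from W≡ (N.suc-injective (trans (sym e) (cong (1 *_) W≡))))))
          where
          3^≡ : 2 * Q ∸ 1 ≡ 3 ^ t'
          3^≡ = 3Q≡ (trans (sym (N.m+n∸n≡m (3 * Q) 1)) (trans (cong (_∸ 1)
            (trans (solve 1 (λ q → con 3 :* q :+ con 1 := (con 1 :+ q) :+ con 2 :* q) refl Q) (cong (_+ 2 * Q) (sym e))))
            (N.+-∸-assoc (1 * W) (N.≤-trans z<s (N.*-monoʳ-≤ 2 2≤q')))))
          2W≡ : 2 * W ≡ 3 ^ t' + 3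
          2W≡ = trans (trans (cong (2 *_) (trans (sym (N.*-identityˡ W)) e))
              (solve 1 (λ q → con 2 :* (con 1 :+ q) := con 2 :* q :+ con 2) refl Q))
            (trans (cong (_+ 2) (trans (sym (N.m∸n+n≡m {2 * Q} {1} (N.≤-trans z<s (N.*-monoʳ-≤ 2 2≤q'))))
                (cong (_+ 1) 3^≡))) (N.+-assoc (3 ^ t') 1 2))
          W≡ : W ≡ 3
          W≡ = w≡3 2 W (pred Y) t' N.≤-refl W≡3^ (inj₂ 2W≡)

  no-odd-power₂ : ∀ {a b} → Prime a → Prime b → a ≢ 2 → b ≢ 2 → a ≢ b →
    ∀ x y n → 0 < x → 0 < y → 0 < n → a ^ x + b ^ y ≡ 4 * 2 ^ n → ∀ h r s →
    ∣ R (+ (2 ^ n)) (+ (1 * b ^ y)) h ∣ ≡ a ^ r → ∣ S (+ (2 ^ n)) (+ (1 * b ^ y)) h ∣ ≡ b ^ s →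
    h ≡ 0 ⊎ Exceptional a b ⊎ Exceptional b a
  no-odd-power₂ {a} {b} pa pb a≢2 b≢2 a≢b x y n 0<x 0<y 0<n eq h r s R≡ S≡ with b ∣? suc (h + h) | a ∣? suc (h + h)
  ... | yes b∣m | _ = inj₂ (inj₁ (exceptional pa pb a≢2 b≢2 a≢b x y n 0<x 0<y 0<n eq h r s R≡ S≡ b∣m))
  ... | no _ | yes a∣m = inj₂ (inj₂ (exceptional pb pa b≢2 a≢2 (λ e → a≢b (sym e)) y x n 0<y 0<x 0<n
      (trans (N.+-comm (b ^ y) (a ^ x)) eq) h s r
      (trans (proj₁ swapped) S≡) (trans (proj₂ swapped) R≡) a∣m))
    where
    swapped = swap-abs (a ^ x) (b ^ y) (2 ^ n) eq h
  ... | no b∤m | no a∤m = inj₁ (unit-power 1 (a ^ x) (b ^ y) (2 ^ n) (trans (N.*-identityˡ _) eq) (prime^≥ prime[2] 0<n) h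
      (unit-value {s = r} pa R≡ λ a∣R → ∤⇒∤S pa (2 ^ n) (1 * a ^ x) h (N.∣n⇒∣m*n 1 (∣prime^ 0<x)) (odd-prime∤2^ pa a≢2 n) a∤m
        (subst (a ∣_) (sym (proj₂ (swap-abs (a ^ x) (b ^ y) (2 ^ n) eq h))) a∣R))
      (unit-value {s = s} pb S≡ (∤⇒∤S pb (2 ^ n) (1 * b ^ y) h (N.∣n⇒∣m*n 1 (∣prime^ 0<y)) (odd-prime∤2^ pb b≢2 n) b∤m)))

-- The Euclidean descent on the exponent.

module NormForms where
  open import Data.Nat as ℕ using (_<_; _≤_; s≤s; z<s; _≤?_)
  open import Data.Integer hiding (suc; sign; _<_; _≤_; _≤?_)
  open import Data.Integer.Divisibility.Signed using () renaming (_∣_ to _∣ᶻ_)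
  open PrimePowers
  open AbsoluteValues
  open Powers using (R; P; S)

  ±-root : ∀ a b → a * a ≡ b * b → a ≡ 1ℤ * b ⊎ a ≡ - 1ℤ * b
  ±-root a b eq with Z.i*j≡0⇒i≡0∨j≡0 (a - b) (trans (id₁ a b) (trans (cong (_- b * b) eq) (Z.+-inverseʳ (b * b))))
    where
    id₁ : ∀ a b → (a - b) * (a + b) ≡ a * a - b * b
    id₁ = solve-∀
  ... | inj₁ p = inj₁ (trans (id₂ a b) (trans (cong (_+ 1ℤ * b) p) (Z.+-identityˡ _)))
    where
    id₂ : ∀ a b → a ≡ (a - b) + 1ℤ * b
    id₂ = solve-∀
  ... | inj₂ p = inj₂ (trans (id₂ a b) (trans (cong (_+ - 1ℤ * b) p) (Z.+-identityˡ _)))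
    where
    id₂ : ∀ a b → a ≡ (a + b) + - 1ℤ * b
    id₂ = solve-∀

  -- The elements X√e + Y√-f of norm g²c^k, where g = c^γ is 1, or 2 when c = 2 (the case of halves).
  module _ (c : ℕ) (pc : Prime c) (e f ℓ : ℤ) (γ : ℕ) (gℓ≡2 : (+ c) ^ γ * ℓ ≡ + 2)
    (c∤e : ¬ + c ∣ᶻ e) (c∤f : ¬ + c ∣ᶻ f) (c∤ℓ : ¬ + c ∣ᶻ ℓ) where

    private
      g : ℤ
      g = (+ c) ^ γ

    C≢0 : ∀ k → NonZero ((+ c) ^ k)
    C≢0 k = ℕ.≢-nonZero λ ∣C∣≡0 →
        N.<⇒≢ (N.m^n>0 c ⦃ prime⇒nonZero pc ⦄ k) (sym (trans (sym (abs-^ (+ c) k)) ∣C∣≡0))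

    norm : ℤ → ℤ → ℤ
    norm X Y = e * (X * X) + f * (Y * Y)

    euclid : ∀ i j → + c ∣ᶻ i * j → + c ∣ᶻ i ⊎ + c ∣ᶻ j
    euclid i j c∣ with euclidsLemma ∣ i ∣ ∣ j ∣ pc (subst (c ∣_) (Z.abs-* i j) (Z.∣⇒∣ᵤ c∣))
    ... | inj₁ p = inj₁ (Z.∣ᵤ⇒∣ {+ c} {i} p)
    ... | inj₂ p = inj₂ (Z.∣ᵤ⇒∣ {+ c} {j} p)

    ∤-* : ∀ i j → ¬ + c ∣ᶻ i → ¬ + c ∣ᶻ j → ¬ + c ∣ᶻ i * j
    ∤-* i j c∤i c∤j c∣ with euclid i j c∣
    ... | inj₁ p = c∤i p
    ... | inj₂ p = c∤j p

    cancel : ∀ k {v t} → ¬ + c ∣ᶻ v → (+ c) ^ k ∣ᶻ v * t → (+ c) ^ k ∣ᶻ t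
    cancel k {v} {t} c∤v div = Z.∣ᵤ⇒∣ (Coprime.coprime-divisor
      (subst (λ m → Coprime m ∣ v ∣) (sym (abs-^ (+ c) k)) (∤⇒coprime-^ pc (λ c∣ → c∤v (Z.∣ᵤ⇒∣ {+ c} {v} c∣)) k))
      (subst (∣ (+ c) ^ k ∣ ∣_) (Z.abs-* v t) (Z.∣⇒∣ᵤ div)))

    cancelᵍ : ∀ n {v t} → ¬ + c ∣ᶻ v → g * (+ c) ^ n ∣ᶻ v * t → g * (+ c) ^ n ∣ᶻ t
    cancelᵍ n {v} {t} c∤v div = subst (_∣ᶻ t) (Z.^-distribˡ-+-* (+ c) γ n)
      (cancel (γ ℕ.+ n) c∤v (subst (_∣ᶻ v * t) (sym (Z.^-distribˡ-+-* (+ c) γ n)) div))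

    c∣C : ∀ {n} → 0 < n → + c ∣ᶻ (+ c) ^ n
    c∣C {suc n} _ = Z.divides ((+ c) ^ n) (Z.*-comm (+ c) _)

    ∣-*ˡ : ∀ {i j} k → i ∣ᶻ j → i ∣ᶻ k * j
    ∣-*ˡ k p = Z.∣n⇒∣m*n k p

    C-+ : ∀ m n → (+ c) ^ (m ℕ.+ n) ≡ (+ c) ^ m * (+ c) ^ n
    C-+ = Z.^-distribˡ-+-* (+ c)

    cancel-gC : ∀ n {i j} → g * (+ c) ^ n * i ≡ g * (+ c) ^ n * j → i ≡ j
    cancel-gC n {i} {j} = Z.*-cancelˡ-≡ (g * (+ c) ^ n) i j ⦃ subst NonZero (C-+ γ n) (C≢0 (γ ℕ.+ n)) ⦄

    cancel-g : ∀ {i j} → g * i ≡ g * j → i ≡ j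
    cancel-g {i} {j} = Z.*-cancelˡ-≡ g i j ⦃ C≢0 γ ⦄

    ∤-norm : ∀ X Y {t} → norm X Y ≡ t → + c ∣ᶻ t → ¬ + c ∣ᶻ Y → ¬ + c ∣ᶻ X
    ∤-norm X Y {t} norm≡t c∣t c∤Y c∣X = [ c∤f , ∤-* Y Y c∤Y c∤Y ]′ (euclid f (Y * Y) c∣fY²)
      where
      c∣eX² : + c ∣ᶻ e * (X * X)
      c∣eX² = ∣-*ˡ e (Z.∣m⇒∣m*n X c∣X)
      c∣fY² : + c ∣ᶻ f * (Y * Y)
      c∣fY² = Z.∣m+n∣m⇒∣n {m = e * (X * X)} (subst (+ c ∣ᶻ_) (sym norm≡t) c∣t) c∣eX²

    -- `minimal` rules out remainders of smaller positive exponent, and `unit` makes a quotient of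
    -- norm 1 equal to ±1. `Q` is a property of exponents that survives lowering by 2n and serves to
    -- exclude exponent 0: it may be trivial when no element has exponent 0, but for f = g = 1 the
    -- element √-1 does, and oddness has to keep it out.
    module Generator (u v : ℤ) (n : ℕ) (norm-uv : norm u v ≡ g * g * (+ c) ^ n) (0<n : 0 < n) (c∤v : ¬ + c ∣ᶻ v)
      (minimal : ∀ k X Y → 0 < k → k < n → norm X Y ≢ g * g * (+ c) ^ k)
      (unit : ∀ a d → a * a + e * f * (d * d) ≡ g * g → d ≡ 0ℤ)
      (Q : ℕ → Set) (Q-step : ∀ z → Q (n ℕ.+ (n ℕ.+ z)) → Q z)
      (Q-zero : Q 0 → ∀ X Y → norm X Y ≢ g * g) where

      q w ω : ℤ
      q = (+ c) ^ n
      w = f * (v * v)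
      ω = ℓ * ℓ * w

      cancel-gq : ∀ {i j} → g * q * i ≡ g * q * j → i ≡ j
      cancel-gq = cancel-gC n

      c∣q : + c ∣ᶻ q
      c∣q = c∣C 0<n

      IsPower : ℤ → ℤ → Set
      IsPower X Y = ∃[ h ] ∃[ σ ] (∣ σ ∣ ≡ 1 × X ≡ σ * (u * R q ω h) × Y ≡ σ * (v * S q ω h))

      -- The quotient (a + d√-ef)/g of X√e + Y√-f by u√e + v√-f.
      module Quotient (X Y d qr : ℤ) (norm-XY : norm X Y ≡ g * g * (q * qr)) (c∤Y : ¬ + c ∣ᶻ Y)
        (d-eq : u * Y - v * X ≡ d * (g * q)) where

        -- Multiplied by v, the left side is Y times the norm of (u, v) minus eu(uY - vX), both
        -- divisible by gq; and v is prime to c.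
        a-div : g * q ∣ᶻ e * (X * u) + f * (Y * v)
        a-div = cancelᵍ n c∤v (Z.divides (g * Y - e * u * d)
          (trans (id₁ e f u v X Y) (trans (cong₂ (λ A B → Y * A - e * u * B) norm-uv d-eq) (id₂ g q Y (e * u) d))))
          where
          id₁ : ∀ e f u v X Y → v * (e * (X * u) + f * (Y * v)) ≡ Y * (e * (u * u) + f * (v * v)) - e * u * (u * Y - v * X)
          id₁ = solve-∀
          id₂ : ∀ g q Y z d → Y * (g * g * q) - z * (d * (g * q)) ≡ (g * Y - z * d) * (g * q)
          id₂ = solve-∀

        abstract
          a : ℤ
          a = Z._∣_.quotient a-div
          a-eq : e * (X * u) + f * (Y * v) ≡ a * (g * q)
          a-eq = Z._∣_.equality a-div

        norm-ad : a * a + e * f * (d * d) ≡ g * g * qr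
        norm-ad = cancel-gq (cancel-gq
          (trans (id₁ (g * q) a d (e * f)) (trans (cong₂ (λ A D → A * A + e * f * (D * D)) (sym a-eq) (sym d-eq))
          (trans (id₂ e f u v X Y) (trans (cong₂ _*_ norm-uv norm-XY) (id₃ g q qr))))))
          where
          id₁ : ∀ M a d z → M * (M * (a * a + z * (d * d))) ≡ (a * M) * (a * M) + z * ((d * M) * (d * M))
          id₁ = solve-∀
          id₂ : ∀ e f u v X Y → (e * (X * u) + f * (Y * v)) * (e * (X * u) + f * (Y * v)) + e * f *
              ((u * Y - v * X) * (u * Y - v * X))
            ≡ (e * (u * u) + f * (v * v)) * (e * (X * X) + f * (Y * Y))
          id₂ = solve-∀
          id₃ : ∀ g q r → g * g * q * (g * g * (q * r)) ≡ g * q * (g * q * (g * g * r))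
          id₃ = solve-∀

        gX≡ : g * X ≡ a * u - f * d * v
        gX≡ = cancel-gq (trans (id₁ g q X) (trans (cong (X *_) (sym norm-uv))
          (trans (id₂ e f u v X Y) (trans (cong₂ (λ A D → u * A - f * v * D) a-eq d-eq) (id₃ u v f (g * q) a d)))))
          where
          id₁ : ∀ g q X → g * q * (g * X) ≡ X * (g * g * q)
          id₁ = solve-∀
          id₂ : ∀ e f u v X Y → X * (e * (u * u) + f * (v * v)) ≡ u * (e * (X * u) + f * (Y * v)) - f * v * (u * Y - v * X)
          id₂ = solve-∀
          id₃ : ∀ u v f M a d → u * (a * M) - f * v * (d * M) ≡ M * (a * u - f * d * v)
          id₃ = solve-∀

        gY≡ : g * Y ≡ a * v + e * d * u
        gY≡ = cancel-gq (trans (id₁ g q Y) (trans (cong (Y *_) (sym norm-uv))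
          (trans (id₂ e f u v X Y) (trans (cong₂ (λ A D → v * A + e * u * D) a-eq d-eq) (id₃ u v e (g * q) a d)))))
          where
          id₁ : ∀ g q X → g * q * (g * X) ≡ X * (g * g * q)
          id₁ = solve-∀
          id₂ : ∀ e f u v X Y → Y * (e * (u * u) + f * (v * v)) ≡ v * (e * (X * u) + f * (Y * v)) + e * u * (u * Y - v * X)
          id₂ = solve-∀
          id₃ : ∀ u v e M a d → v * (a * M) + e * u * (d * M) ≡ M * (a * v + e * d * u)
          id₃ = solve-∀

        -- The factor edu - av is a numerator of the next division. Its product with gY = av + edu
        -- involves only the two norms, so cancelling Y shows that a power of c divides it.
        cross : Y * (e * d * u - a * v) ≡ g * (e * (d * d) * q - v * v * qr)
        cross = cancel-g (trans (sym (Z.*-assoc g Y _)) (trans (cong (_* (e * d * u - a * v)) gY≡)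
          (trans (id₁ e f u v a d) (trans (cong₂ (λ A B → e * (d * d) * A - v * v * B) norm-uv norm-ad)
              (id₂ g q qr (e * (d * d)) (v * v))))))
          where
          id₁ : ∀ e f u v a d → (a * v + e * d * u) * (e * d * u - a * v)
            ≡ e * (d * d) * (e * (u * u) + f * (v * v)) - v * v * (a * a + e * f * (d * d))
          id₁ = solve-∀
          id₂ : ∀ g q r y z → y * (g * g * q) - z * (g * g * r) ≡ g * (g * (y * q - z * r))
          id₂ = solve-∀

        -- A second division by the generator; if the quotient is too small for it, it divides the generator
        -- instead, contradicting minimality.
        module Again (m : ℕ) (q̂ q̃ : ℤ) (q≡ : q ≡ (+ c) ^ m * q̂) (qr≡ : qr ≡ (+ c) ^ m * q̃) where
          M : ℤ
          M = g * (+ c) ^ m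
          cancel-M : ∀ {i j} → M * i ≡ M * j → i ≡ j
          cancel-M = cancel-gC m

          y-div : M ∣ᶻ e * d * u - a * v
          y-div = cancelᵍ m c∤Y (Z.divides (e * (d * d) * q̂ - v * v * q̃)
            (trans cross (trans (cong₂ (λ A B → g * (e * (d * d) * A - v * v * B)) q≡ qr≡)
                (id₁ g ((+ c) ^ m) q̂ q̃ (e * (d * d)) (v * v)))))
            where
            id₁ : ∀ g C x y s t → g * (s * (C * x) - t * (C * y)) ≡ (s * x - t * y) * (g * C)
            id₁ = solve-∀
          abstract
            y : ℤ
            y = Z._∣_.quotient y-div
            y-eq : e * d * u - a * v ≡ y * M
            y-eq = Z._∣_.equality y-div

          x-div : M ∣ᶻ a * u + f * d * v
          x-div = cancelᵍ m c∤v (Z.divides (d * g * q̂ - u * y)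
            (trans (id₁ e f u v a d) (trans (cong₂ (λ A B → d * A - u * B) (trans norm-uv (cong (g * g *_) q≡)) y-eq)
                (id₂ g ((+ c) ^ m) q̂ d u y))))
            where
            id₁ : ∀ e f u v a d → v * (a * u + f * d * v) ≡ d * (e * (u * u) + f * (v * v)) - u * (e * d * u - a * v)
            id₁ = solve-∀
            id₂ : ∀ g C x d u y → d * (g * g * (C * x)) - u * (y * (g * C)) ≡ (d * g * x - u * y) * (g * C)
            id₂ = solve-∀
          abstract
            x : ℤ
            x = Z._∣_.quotient x-div
            x-eq : a * u + f * d * v ≡ x * M
            x-eq = Z._∣_.equality x-div

          norm-xy : norm x y ≡ g * g * (q̂ * q̃)
          norm-xy = cancel-M (cancel-M
            (trans (id₁ e f M x y) (trans (cong₂ (λ A B → e * (A * A) + f * (B * B)) (sym x-eq) (sym y-eq))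
            (trans (id₂ e f u v a d) (trans (cong₂ _*_ (trans norm-ad (cong (g * g *_) qr≡))
                (trans norm-uv (cong (g * g *_) q≡)))
              (id₃ g ((+ c) ^ m) q̂ q̃))))))
            where
            id₁ : ∀ e f M x y → M * (M * (e * (x * x) + f * (y * y))) ≡ e * ((x * M) * (x * M)) + f * ((y * M) * (y * M))
            id₁ = solve-∀
            id₂ : ∀ e f u v a d → e * ((a * u + f * d * v) * (a * u + f * d * v)) + f *
                ((e * d * u - a * v) * (e * d * u - a * v))
              ≡ (a * a + e * f * (d * d)) * (e * (u * u) + f * (v * v))
            id₂ = solve-∀
            id₃ : ∀ g C x y → g * g * (C * y) * (g * g * (C * x)) ≡ g * C * (g * C * (g * g * (x * y)))
            id₃ = solve-∀

      -- The quotient has norm 1, so it is ±1.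
      power-zero : ∀ X Y → norm X Y ≡ g * g * (q * 1ℤ) → ¬ + c ∣ᶻ Y → g * q ∣ᶻ u * Y - v * X → IsPower X Y
      power-zero X Y norm-XY c∤Y (Z.divides d d-eq) = finish (±-root a g a²≡)
        where
        open Quotient X Y d 1ℤ norm-XY c∤Y d-eq
        d≡0 : d ≡ 0ℤ
        d≡0 = unit a d (trans norm-ad (Z.*-identityʳ (g * g)))
        a²≡ : a * a ≡ g * g
        a²≡ = trans (id₁ (a * a) (e * f)) (trans (cong (λ d → a * a + e * f * (d * d)) (sym d≡0))
            (trans norm-ad (Z.*-identityʳ (g * g))))
          where
          id₁ : ∀ a z → a ≡ a + z * (0ℤ * 0ℤ)
          id₁ = solve-∀
        with-sign : ∀ σ → ∣ σ ∣ ≡ 1 → a ≡ σ * g → IsPower X Y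
        with-sign σ ∣σ∣ a≡ = 0 , σ , ∣σ∣
          , cancel-g (trans gX≡ (trans (cong₂ (λ a d → a * u - f * d * v) a≡ d≡0) (id₁ σ g u f v)))
          , cancel-g (trans gY≡ (trans (cong₂ (λ a d → a * v + e * d * u) a≡ d≡0) (id₂ σ g u e v)))
          where
          id₁ : ∀ σ g u f v → σ * g * u - f * 0ℤ * v ≡ g * (σ * (u * 1ℤ))
          id₁ = solve-∀
          id₂ : ∀ σ g u e v → σ * g * v + e * 0ℤ * u ≡ g * (σ * (v * (+ 2 * 1ℤ - 1ℤ)))
          id₂ = solve-∀
        finish : a ≡ 1ℤ * g ⊎ a ≡ - 1ℤ * g → IsPower X Y
        finish (inj₁ p) = with-sign 1ℤ refl p
        finish (inj₂ p) = with-sign (- 1ℤ) refl p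

      -- Multiplication by α² = (eu² - w + 2uv√-ef)/g², cleared of denominators.
      R-step : ∀ h → g * g * R q ω (suc h) ≡ (e * (u * u) - w) * R q ω h - + 2 * w * S q ω h
      R-step h = trans (id₁ g ℓ q w r p) (trans (cong₂ (λ A B → A * r - B * B * w * p) (sym norm-uv) gℓ≡2)
          (id₂ (e * (u * u)) w r p))
        where
        r = R q ω h
        p = P q ω h
        id₁ : ∀ g ℓ q w r p → g * g * (q * r - ℓ * ℓ * w * p) ≡ g * g * q * r - (g * ℓ) * (g * ℓ) * w * p
        id₁ = solve-∀
        id₂ : ∀ E w r p → (E + w) * r - + 2 * + 2 * w * p ≡ (E - w) * r - + 2 * w * (+ 2 * p - r)
        id₂ = solve-∀

      S-step : ∀ h → g * g * S q ω (suc h) ≡ (e * (u * u) - w) * S q ω h + + 2 * (e * (u * u)) * R q ω h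
      S-step h = trans (id₁ g ℓ q w r p) (trans (cong₂ (λ A B → + 2 * A * (r + p) - A * r - B * B * w * p) (sym norm-uv)
          gℓ≡2) (id₂ (e * (u * u)) w r p))
        where
        r = R q ω h
        p = P q ω h
        id₁ : ∀ g ℓ q w r p → g * g * (+ 2 * (q * (r + p) - ℓ * ℓ * w * p) - (q * r - ℓ * ℓ * w * p))
          ≡ + 2 * (g * g * q) * (r + p) - g * g * q * r - (g * ℓ) * (g * ℓ) * w * p
        id₁ = solve-∀
        id₂ : ∀ E w r p → + 2 * (E + w) * (r + p) - (E + w) * r - + 2 * + 2 * w * p ≡ (E - w) * (+ 2 * p - r) + + 2 * E * r
        id₂ = solve-∀

      -- Each turn divides by α twice: the first quotient is (a + d√-ef)/g, the second is again of
      -- the shape x√e + y√-f, with exponent lowered by 2n. Here r is the excess of the exponent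
      -- over that of α, and the divisibility hypothesis selects α rather than its conjugate.
      power : ∀ fuel r → r < fuel → ∀ X Y → norm X Y ≡ g * g * (q * (+ c) ^ r) → ¬ + c ∣ᶻ Y →
        g * q ∣ᶻ u * Y - v * X → Q (n ℕ.+ r) → IsPower X Y
      power (suc fuel) zero _ X Y norm-XY c∤Y div _ = power-zero X Y norm-XY c∤Y div
      power (suc fuel) r@(suc _) (s≤s r≤fuel) X Y norm-XY c∤Y (Z.divides d d-eq) Qz = by-size (n ≤? r)
        where
        by-size : Dec (n ≤ r) → IsPower X Y
        by-size (no n≰r) = ⊥-elim (minimal (n ℕ.∸ r) x y (N.m<n⇒0<n∸m (N.≰⇒> n≰r))
            (N.∸-monoʳ-< {n} {r} {0} z<s (N.<⇒≤ (N.≰⇒> n≰r)))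
            (trans norm-xy (cong (g * g *_) (Z.*-identityʳ _))))
          where
          open Quotient X Y d ((+ c) ^ r) norm-XY c∤Y d-eq
          open Again r ((+ c) ^ (n ℕ.∸ r)) 1ℤ (trans (cong ((+ c) ^_) (sym (N.m+[n∸m]≡n (N.<⇒≤ (N.≰⇒> n≰r))))) (C-+ r (n ℕ.∸ r))) (sym (Z.*-identityʳ _))
        by-size (yes n≤r) = next (r ℕ.∸ n) refl
          where
          r≡ : r ≡ n ℕ.+ (r ℕ.∸ n)
          r≡ = sym (N.m+[n∸m]≡n n≤r)
          open Quotient X Y d ((+ c) ^ r) norm-XY c∤Y d-eq
          open Again n 1ℤ ((+ c) ^ (r ℕ.∸ n)) (sym (Z.*-identityʳ q)) (trans (cong ((+ c) ^_) r≡) (C-+ n (r ℕ.∸ n)))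
          norm-xy' : norm x y ≡ g * g * (+ c) ^ (r ℕ.∸ n)
          norm-xy' = trans norm-xy (cong (g * g *_) (Z.*-identityˡ _))
          Qr : Q (r ℕ.∸ n)
          Qr = Q-step _ (subst (λ r → Q (n ℕ.+ r)) r≡ Qz)
          gd≡ : u * y + v * x ≡ g * d
          gd≡ = cancel-gq (trans (id₁ (g * q) u v x y) (trans (cong₂ (λ A B → u * A + v * B) (sym y-eq) (sym x-eq))
            (trans (id₂ e f u v a d) (trans (cong (d *_) norm-uv) (id₃ g q d)))))
            where
            id₁ : ∀ M u v x y → M * (u * y + v * x) ≡ u * (y * M) + v * (x * M)
            id₁ = solve-∀
            id₂ : ∀ e f u v a d → u * (e * d * u - a * v) + v * (a * u + f * d * v) ≡ d * (e * (u * u) + f * (v * v))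
            id₂ = solve-∀
            id₃ : ∀ g q d → d * (g * g * q) ≡ g * q * (g * d)
            id₃ = solve-∀
          ga≡ : e * (u * x) - f * (v * y) ≡ g * a
          ga≡ = cancel-gq (trans (id₁ (g * q) e f u v x y)
              (trans (cong₂ (λ A B → e * u * A - f * v * B) (sym x-eq) (sym y-eq))
            (trans (id₂ e f u v a d) (trans (cong (a *_) norm-uv) (id₃ g q a)))))
            where
            id₁ : ∀ M e f u v x y → M * (e * (u * x) - f * (v * y)) ≡ e * u * (x * M) - f * v * (y * M)
            id₁ = solve-∀
            id₂ : ∀ e f u v a d → e * u * (a * u + f * d * v) - f * v * (e * d * u - a * v) ≡ a * (e * (u * u) + f * (v * v))
            id₂ = solve-∀
            id₃ : ∀ g q d → d * (g * g * q) ≡ g * q * (g * d)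
            id₃ = solve-∀
          ℓedu≡ : ℓ * (e * d * u) ≡ Y + q * y
          ℓedu≡ = cancel-g (trans (sym (Z.*-assoc g ℓ _)) (trans (cong (_* (e * d * u)) gℓ≡2)
            (trans (id₁ (e * d * u) (a * v)) (trans (cong₂ _+_ (sym gY≡) y-eq) (id₂ g Y y q)))))
            where
            id₁ : ∀ s t → + 2 * s ≡ (t + s) + (s - t)
            id₁ = solve-∀
            id₂ : ∀ g Y y q → g * Y + y * (g * q) ≡ g * (Y + q * y)
            id₂ = solve-∀
          -- As ℓedu = Y + qy and c ∣ q, divisibility of d would pass to Y.
          c∤d : ¬ + c ∣ᶻ d
          c∤d c∣d = c∤Y (Z.∣m+n∣n⇒∣m (subst (+ c ∣ᶻ_) ℓedu≡ (∣-*ˡ ℓ (Z.∣m⇒∣m*n u (∣-*ˡ e c∣d)))) (Z.∣m⇒∣m*n y c∣q))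
          next : ∀ r' → r ℕ.∸ n ≡ r' → IsPower X Y
          next zero r'≡ = ⊥-elim (Q-zero (subst Q r'≡ Qr) x y
            (trans norm-xy' (trans (cong (λ r → g * g * (+ c) ^ r) r'≡) (Z.*-identityʳ (g * g)))))
          next r'@(suc _) r'≡ = by-size' (n ≤? r')
            where
            by-size' : Dec (n ≤ r') → IsPower X Y
            by-size' (no n≰r') = ⊥-elim (minimal r' x y z<s (N.≰⇒> n≰r')
                (trans norm-xy' (cong (λ r → g * g * (+ c) ^ r) r'≡)))
            by-size' (yes n≤r') = ascend (power fuel r″ r″<fuel x y norm-xy″ c∤y aligned Qr″)
                where
                r″ = r' ℕ.∸ n
                r″≡ : r' ≡ n ℕ.+ r″
                r″≡ = sym (N.m+[n∸m]≡n n≤r')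
                r″<fuel : r″ < fuel
                r″<fuel = N.<-≤-trans (N.≤-<-trans (N.m∸n≤m r' n)
                  (subst (_< r) r'≡ (N.∸-monoʳ-< {r} {n} {0} 0<n n≤r))) r≤fuel
                C-r' : (+ c) ^ (r ℕ.∸ n) ≡ q * (+ c) ^ r″
                C-r' = trans (cong ((+ c) ^_) (trans r'≡ r″≡)) (C-+ n r″)
                norm-xy″ : norm x y ≡ g * g * (q * (+ c) ^ r″)
                norm-xy″ = trans norm-xy' (cong (g * g *_) C-r')
                Qr″ : Q (n ℕ.+ r″)
                Qr″ = subst Q (trans r'≡ r″≡) Qr
                -- The product e(uy + vx)(uy - vx) is divisible by g²q, and uy + vx = gd with d
                -- prime to c. The whole of q therefore falls on uy - vx: the same conjugate of α
                -- divides again.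
                crossed : e * d * (u * y - v * x) ≡ (y * y - v * v * (+ c) ^ r″) * (g * q)
                crossed = cancel-g (trans (id₁ g e d (u * y - v * x)) (trans (cong (λ t → e * t * (u * y - v * x)) (sym gd≡))
                  (trans (id₂ e f u v x y) (trans (cong₂ (λ A B → A * (y * y) - v * v * B) norm-uv norm-xy″)
                      (id₃ g q y v ((+ c) ^ r″))))))
                  where
                  id₁ : ∀ g e d t → g * (e * d * t) ≡ e * (g * d) * t
                  id₁ = solve-∀
                  id₂ : ∀ e f u v x y → e * (u * y + v * x) * (u * y - v * x)
                    ≡ (e * (u * u) + f * (v * v)) * (y * y) - v * v * (e * (x * x) + f * (y * y))
                  id₂ = solve-∀
                  id₃ : ∀ g q y v r → g * g * q * (y * y) - v * v * (g * g * (q * r)) ≡ g * ((y * y - v * v * r) * (g * q))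
                  id₃ = solve-∀
                abstract
                  aligned : g * q ∣ᶻ u * y - v * x
                  aligned = cancelᵍ n (∤-* e d c∤e c∤d) (Z.divides (y * y - v * v * (+ c) ^ r″) crossed)
                c∤y : ¬ + c ∣ᶻ y
                c∤y c∣y = c∤d (Z.∣m+n∣n⇒∣m (subst (+ c ∣ᶻ_) ℓuy≡ (∣-*ˡ ℓ (∣-*ˡ u c∣y))) (Z.∣m⇒∣m*n t c∣q))
                  where
                  t : ℤ
                  t = Z._∣_.quotient aligned
                  ℓuy≡ : ℓ * (u * y) ≡ d + q * t
                  ℓuy≡ = cancel-g (trans (sym (Z.*-assoc g ℓ _)) (trans (cong (_* (u * y)) gℓ≡2)
                    (trans (id₁ (u * y) (v * x)) (trans (cong₂ _+_ gd≡ (Z._∣_.equality aligned)) (id₂ g d t q)))))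
                    where
                    id₁ : ∀ s t → + 2 * s ≡ (s + t) + (s - t)
                    id₁ = solve-∀
                    id₂ : ∀ g d t q → g * d + t * (g * q) ≡ g * (d + q * t)
                    id₂ = solve-∀
                ascend : IsPower x y → IsPower X Y
                ascend (h , σ , ∣σ∣ , x≡ , y≡) = suc h , σ , ∣σ∣
                  , cancel-g (cancel-g (trans (cong (g *_) gX≡) (trans (id₁ g a d u v f)
                      (trans (cong₂ (λ A D → A * u - f * D * v) (sym ga≡) (sym gd≡))
                      (trans (cong₂ (λ x y → (e * (u * x) - f * (v * y)) * u - f * (u * y + v * x) * v) x≡ y≡)
                      (trans (id₂ e f u v σ r₀ s₀) (trans (cong (λ t → σ * (u * t)) (sym (R-step h)))
                          (id₃ g σ u (R q ω (suc h))))))))))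
                  , cancel-g (cancel-g (trans (cong (g *_) gY≡) (trans (id₄ g a d u v e)
                      (trans (cong₂ (λ A D → A * v + e * D * u) (sym ga≡) (sym gd≡))
                      (trans (cong₂ (λ x y → (e * (u * x) - f * (v * y)) * v + e * (u * y + v * x) * u) x≡ y≡)
                      (trans (id₅ e f u v σ r₀ s₀) (trans (cong (λ t → σ * (v * t)) (sym (S-step h)))
                          (id₃ g σ v (S q ω (suc h))))))))))
                  where
                  r₀ = R q ω h
                  s₀ = S q ω h
                  id₁ : ∀ g a d u v f → g * (a * u - f * d * v) ≡ g * a * u - f * (g * d) * v
                  id₁ = solve-∀
                  id₂ : ∀ e f u v σ r s → (e * (u * (σ * (u * r))) - f * (v * (σ * (v * s)))) * u - f *
                      (u * (σ * (v * s)) + v * (σ * (u * r))) * v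
                    ≡ σ * (u * ((e * (u * u) - f * (v * v)) * r - + 2 * (f * (v * v)) * s))
                  id₂ = solve-∀
                  id₃ : ∀ g σ u t → σ * (u * (g * g * t)) ≡ g * (g * (σ * (u * t)))
                  id₃ = solve-∀
                  id₄ : ∀ g a d u v e → g * (a * v + e * d * u) ≡ g * a * v + e * (g * d) * u
                  id₄ = solve-∀
                  id₅ : ∀ e f u v σ r s → (e * (u * (σ * (u * r))) - f * (v * (σ * (v * s)))) * v + e *
                      (u * (σ * (v * s)) + v * (σ * (u * r))) * u
                    ≡ σ * (v * ((e * (u * u) - f * (v * v)) * s + + 2 * (e * (u * u)) * r))
                  id₅ = solve-∀

      -- Trivial for g = 1; for g = c = 2 the difference of two odd numbers is even.
      module _ (g∣difference : ∀ i j → ¬ + c ∣ᶻ i → ¬ + c ∣ᶻ j → g ∣ᶻ i - j) where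

        c∤u : ¬ + c ∣ᶻ u
        c∤u = ∤-norm u v norm-uv (∣-*ˡ (g * g) c∣q) c∤v

        -- The sign of X decides between α and its conjugate. The quotients i and j of uY - vX and
        -- uY + vX by g satisfy q ∣ ij and i + j = ℓuY, which is prime to c; so one of them is prime
        -- to c and the other takes all of q.
        align : ∀ X Y r → norm X Y ≡ g * g * (q * (+ c) ^ r) → ¬ + c ∣ᶻ Y →
          g * q ∣ᶻ u * Y - v * X ⊎ g * q ∣ᶻ u * Y - v * (- X)
        align X Y r norm-XY c∤Y = by-quotients (g∣difference (u * Y) (v * X) c∤uY c∤vX)
            (g∣difference (u * Y) (v * (- X)) c∤uY c∤v-X)
          where
          c∤X : ¬ + c ∣ᶻ X
          c∤X = ∤-norm X Y norm-XY (∣-*ˡ (g * g) (Z.∣m⇒∣m*n ((+ c) ^ r) c∣q)) c∤Y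
          c∤uY : ¬ + c ∣ᶻ u * Y
          c∤uY = ∤-* u Y c∤u c∤Y
          c∤vX : ¬ + c ∣ᶻ v * X
          c∤vX = ∤-* v X c∤v c∤X
          c∤v-X : ¬ + c ∣ᶻ v * (- X)
          c∤v-X = ∤-* v (- X) c∤v (λ p → c∤X (subst (+ c ∣ᶻ_) (Z.neg-involutive X) (Z.∣m⇒∣-m p)))
          by-quotients : g ∣ᶻ u * Y - v * X → g ∣ᶻ u * Y - v * (- X) →
            g * q ∣ᶻ u * Y - v * X ⊎ g * q ∣ᶻ u * Y - v * (- X)
          by-quotients (Z.divides i i-eq) (Z.divides j j-eq) = choose (c ∣? ∣ i ∣)
            where
            eij : q ∣ᶻ e * (i * j)
            eij = Z.divides (Y * Y - v * v * (+ c) ^ r) (cancel-g (cancel-g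
              (trans (id₁ g e i j) (trans (cong₂ (λ A B → e * (A * B)) (sym i-eq) (sym j-eq)) (trans (id₂ e f u v X Y)
              (trans (cong₂ (λ A B → Y * Y * A - v * v * B) norm-uv norm-XY) (id₃ g q (Y * Y) (v * v) ((+ c) ^ r))))))))
              where
              id₁ : ∀ g e i j → g * (g * (e * (i * j))) ≡ e * (i * g * (j * g))
              id₁ = solve-∀
              id₂ : ∀ e f u v X Y → e * ((u * Y - v * X) * (u * Y - v * (- X)))
                ≡ Y * Y * (e * (u * u) + f * (v * v)) - v * v * (e * (X * X) + f * (Y * Y))
              id₂ = solve-∀
              id₃ : ∀ g q y v r → y * (g * g * q) - v * (g * g * (q * r)) ≡ g * (g * ((y - v * r) * q))
              id₃ = solve-∀
            q∣ij : q ∣ᶻ i * j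
            q∣ij = cancel n {e} {i * j} c∤e eij
            j-i≡ : i + j ≡ ℓ * (u * Y)
            j-i≡ = cancel-g (trans (id₁ g i j) (trans (cong₂ _+_ (sym i-eq) (sym j-eq))
              (trans (id₂ (u * Y) v X) (trans (cong (_* (u * Y)) (sym gℓ≡2)) (Z.*-assoc g ℓ (u * Y))))))
              where
              id₁ : ∀ g i j → g * (i + j) ≡ i * g + j * g
              id₁ = solve-∀
              id₂ : ∀ s v X → (s - v * X) + (s - v * (- X)) ≡ + 2 * s
              id₂ = solve-∀
            lift : ∀ t i → t ≡ i * g → q ∣ᶻ i → g * q ∣ᶻ t
            lift t i t-eq (Z.divides k k-eq) = Z.divides k (trans t-eq (trans (cong (_* g) k-eq) (id₁ g q k)))
              where
              id₁ : ∀ g q k → k * q * g ≡ k * (g * q)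
              id₁ = solve-∀
            choose : Dec (c ∣ ∣ i ∣) → g * q ∣ᶻ u * Y - v * X ⊎ g * q ∣ᶻ u * Y - v * (- X)
            choose (no c∤i) = inj₂ (lift (u * Y - v * (- X)) j j-eq (cancel n {i} {j} (λ p → c∤i (Z.∣⇒∣ᵤ p)) q∣ij))
            choose (yes c∣i) = inj₁ (lift (u * Y - v * X) i i-eq (cancel n {j} {i} c∤j (subst (q ∣ᶻ_) (Z.*-comm i j) q∣ij)))
              where
              c∤j : ¬ + c ∣ᶻ j
              c∤j c∣j = ∤-* ℓ (u * Y) c∤ℓ (∤-* u Y c∤u c∤Y)
                (subst (+ c ∣ᶻ_) j-i≡ (Z.∣m∣n⇒∣m+n (Z.∣ᵤ⇒∣ {+ c} {i} c∣i) c∣j))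

        is-power : ∀ X Y z → 0 < z → norm X Y ≡ g * g * (+ c) ^ z → ¬ + c ∣ᶻ Y → Q z →
          ∃[ h ] (∣ X ∣ ≡ ∣ u ∣ ℕ.* ∣ R q ω h ∣ × ∣ Y ∣ ≡ ∣ v ∣ ℕ.* ∣ S q ω h ∣)
        is-power X Y z 0<z norm-XY c∤Y Qz with n ≤? z
        ... | no n≰z = ⊥-elim (minimal z X Y 0<z (N.≰⇒> n≰z) norm-XY)
        ... | yes n≤z = finish (align X Y r norm-XY' c∤Y)
          where
          r = z ℕ.∸ n
          z≡ : z ≡ n ℕ.+ r
          z≡ = sym (N.m+[n∸m]≡n n≤z)
          norm-XY' : norm X Y ≡ g * g * (q * (+ c) ^ r)
          norm-XY' = trans norm-XY (cong (g * g *_) (trans (cong ((+ c) ^_) z≡) (C-+ n r)))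
          norm-neg : norm (- X) Y ≡ norm X Y
          norm-neg = id₁ e f X Y
            where
            id₁ : ∀ e f X Y → e * (- X * - X) + f * (Y * Y) ≡ e * (X * X) + f * (Y * Y)
            id₁ = solve-∀
          Qz' : Q (n ℕ.+ r)
          Qz' = subst Q z≡ Qz
          ∣σ*t∣ : ∀ σ s t → ∣ σ ∣ ≡ 1 → ∣ σ * (s * t) ∣ ≡ ∣ s ∣ ℕ.* ∣ t ∣
          ∣σ*t∣ σ s t ∣σ∣ = trans (Z.abs-* σ (s * t)) (trans (cong (ℕ._* ∣ s * t ∣) ∣σ∣)
              (trans (N.*-identityˡ _) (Z.abs-* s t)))
          finish : g * q ∣ᶻ u * Y - v * X ⊎ g * q ∣ᶻ u * Y - v * (- X) →
            ∃[ h ] (∣ X ∣ ≡ ∣ u ∣ ℕ.* ∣ R q ω h ∣ × ∣ Y ∣ ≡ ∣ v ∣ ℕ.* ∣ S q ω h ∣)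
          finish (inj₁ p) with power (suc r) r N.≤-refl X Y norm-XY' c∤Y p Qz'
          ... | h , σ , ∣σ∣ , x≡ , y≡ = h , trans (cong ∣_∣ x≡) (∣σ*t∣ σ u (R q ω h) ∣σ∣) , trans (cong ∣_∣ y≡)
              (∣σ*t∣ σ v (S q ω h) ∣σ∣)
          finish (inj₂ p) with power (suc r) r N.≤-refl (- X) Y (trans norm-neg norm-XY') c∤Y p Qz'
          ... | h , σ , ∣σ∣ , x≡ , y≡ = h , trans (sym (Z.∣-i∣≡∣i∣ X)) (trans (cong ∣_∣ x≡) (∣σ*t∣ σ u (R q ω h) ∣σ∣)) ,
              trans (cong ∣_∣ y≡) (∣σ*t∣ σ v (S q ω h) ∣σ∣)

-- Uniqueness of representations by a form over ℕ.

module Representations where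
  open import Data.Nat
  open import Data.Integer as ℤ using (+_; ∣_∣)
  open import Data.Integer.Divisibility.Signed using () renaming (_∣_ to _∣ᶻ_)
  open PrimePowers
  open AbsoluteValues
  open Powers using (R; S)

  form : ℕ → ℕ → ℕ → ℕ → ℕ
  form e f X Y = e * (X * X) + f * (Y * Y)

  +form : ∀ e f X Y → + form e f ∣ X ∣ ∣ Y ∣ ≡ + e ℤ.* (X ℤ.* X) ℤ.+ + f ℤ.* (Y ℤ.* Y)
  +form e f X Y = trans (Z.pos-+ (e * (∣ X ∣ * ∣ X ∣)) _) (cong₂ ℤ._+_
    (trans (Z.pos-* e _) (cong (+ e ℤ.*_) (+∣i∣² X))) (trans (Z.pos-* f _) (cong (+ f ℤ.*_) (+∣i∣² Y))))

  -- The bound `g²<ef` forces d = 0 in a² + efd² = g², so that ±1 are the only quotients of norm 1.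
  module Rep (c : ℕ) (pc : Prime c) (e f ℓ γ : ℕ) (gℓ≡2 : c ^ γ * ℓ ≡ 2)
    (c∤e : ¬ c ∣ e) (c∤f : ¬ c ∣ f) (c∤ℓ : ¬ c ∣ ℓ) (g²<ef : c ^ γ * c ^ γ < e * f)
    (g∣difference : ∀ i j → ¬ + c ∣ᶻ i → ¬ + c ∣ᶻ j → (+ c) ℤ.^ γ ∣ᶻ i ℤ.- j) where

    g κ : ℕ
    g = c ^ γ
    κ = ℓ * ℓ

    +gℓ≡2 : (+ c) ℤ.^ γ ℤ.* + ℓ ≡ + 2
    +gℓ≡2 = trans (cong (ℤ._* + ℓ) (sym (pos-^ c γ))) (trans (sym (Z.pos-* (c ^ γ) ℓ)) (cong +_ gℓ≡2))

    ∤⇒∤ᶻ : ∀ {i} → ¬ c ∣ i → ¬ + c ∣ᶻ + i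
    ∤⇒∤ᶻ c∤i p = c∤i (Z.∣⇒∣ᵤ p)

    +g²c^ : ∀ k → + (g * g * c ^ k) ≡ (+ c) ℤ.^ γ ℤ.* (+ c) ℤ.^ γ ℤ.* (+ c) ℤ.^ k
    +g²c^ k = trans (Z.pos-* (g * g) (c ^ k)) (cong₂ ℤ._*_ (trans (Z.pos-* g g) (cong₂ ℤ._*_ (pos-^ c γ) (pos-^ c γ)))
        (pos-^ c k))

    g²≡g²c^0 : g * g ≡ g * g * c ^ 0
    g²≡g²c^0 = sym (N.*-identityʳ (g * g))

    open NormForms using (module Generator)

    abs-norm : ∀ X Y k → + e ℤ.* (X ℤ.* X) ℤ.+ + f ℤ.* (Y ℤ.* Y) ≡ (+ c) ℤ.^ γ ℤ.* (+ c) ℤ.^ γ ℤ.* (+ c) ℤ.^ k →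
      form e f ∣ X ∣ ∣ Y ∣ ≡ g * g * c ^ k
    abs-norm X Y k eq = Z.+-injective (trans (+form e f X Y) (trans eq (sym (+g²c^ k))))

    pos-norm : ∀ X Y k → form e f X Y ≡ g * g * c ^ k →
      + e ℤ.* (+ X ℤ.* + X) ℤ.+ + f ℤ.* (+ Y ℤ.* + Y) ≡ (+ c) ℤ.^ γ ℤ.* (+ c) ℤ.^ γ ℤ.* (+ c) ℤ.^ k
    pos-norm X Y k eq = trans (sym (+form e f (+ X) (+ Y))) (trans (cong +_ eq) (+g²c^ k))

    unit : ∀ a d → a ℤ.* a ℤ.+ + e ℤ.* + f ℤ.* (d ℤ.* d) ≡ (+ c) ℤ.^ γ ℤ.* (+ c) ℤ.^ γ → d ≡ 0ℤ
    unit a d eq = Z.∣i∣≡0⇒i≡0 (small ∣ d ∣ eqℕ)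
      where
      eqℕ : ∣ a ∣ * ∣ a ∣ + e * f * (∣ d ∣ * ∣ d ∣) ≡ g * g
      eqℕ = Z.+-injective (trans (Z.pos-+ (∣ a ∣ * ∣ a ∣) _) (trans (cong₂ ℤ._+_ (+∣i∣² a)
        (trans (Z.pos-* (e * f) _) (cong₂ ℤ._*_ (Z.pos-* e f) (+∣i∣² d)))) (trans eq (sym
        (trans (Z.pos-* g g) (cong₂ ℤ._*_ (pos-^ c γ) (pos-^ c γ)))))))
      small : ∀ m → ∣ a ∣ * ∣ a ∣ + e * f * (m * m) ≡ g * g → m ≡ 0
      small zero    _ = refl
      small (suc m) p = ⊥-elim (N.<⇒≱ g²<ef (N.≤-trans (N.m≤m*n (e * f) (suc m * suc m))
        (N.≤-trans (N.m≤n+m _ (∣ a ∣ * ∣ a ∣)) (N.≤-reflexive p))))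

    IsPower : ℕ → ℕ → ℕ → ℕ → ℕ → Set
    IsPower u v n X Y = ∃[ h ] (X ≡ u * ∣ R (+ (c ^ n)) (+ (κ * (f * (v * v)))) h ∣
                              × Y ≡ v * ∣ S (+ (c ^ n)) (+ (κ * (f * (v * v)))) h ∣)

    powers : ∀ u v n → form e f u v ≡ g * g * c ^ n → 0 < n → ¬ c ∣ v →
      (∀ k X Y → 0 < k → k < n → form e f X Y ≢ g * g * c ^ k) →
      (Q : ℕ → Set) → (∀ z → Q (n + (n + z)) → Q z) → (Q 0 → ∀ X Y → form e f X Y ≢ g * g) →
      ∀ X Y z → 0 < z → form e f X Y ≡ g * g * c ^ z → ¬ c ∣ Y → Q z → IsPower u v n X Y
    powers u v n norm-uv 0<n c∤v minimal Q Q-step Q-zero X Y z 0<z norm-XY c∤Y Qz = convert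
      (Generator.is-power c pc (+ e) (+ f) (+ ℓ) γ +gℓ≡2 (∤⇒∤ᶻ c∤e) (∤⇒∤ᶻ c∤f) (∤⇒∤ᶻ c∤ℓ)
        (+ u) (+ v) n (pos-norm u v n norm-uv) 0<n (∤⇒∤ᶻ c∤v)
        (λ k X Y 0<k k<n eq → minimal k ∣ X ∣ ∣ Y ∣ 0<k k<n (abs-norm X Y k eq))
        unit Q Q-step
        (λ Q0 X Y eq → Q-zero Q0 ∣ X ∣ ∣ Y ∣ (trans (abs-norm X Y 0 (trans eq (sym (Z.*-identityʳ _)))) (sym g²≡g²c^0)))
        g∣difference (+ X) (+ Y) z 0<z (pos-norm X Y z norm-XY) (∤⇒∤ᶻ c∤Y) Qz)
      where
      ω≡ : + ℓ ℤ.* + ℓ ℤ.* (+ f ℤ.* (+ v ℤ.* + v)) ≡ + (κ * (f * (v * v)))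
      ω≡ = sym (trans (Z.pos-* κ _) (cong₂ ℤ._*_ (Z.pos-* ℓ ℓ) (trans (Z.pos-* f _) (cong (+ f ℤ.*_) (Z.pos-* v v)))))
      convert : ∃[ h ] (X ≡ u * ∣ R ((+ c) ℤ.^ n) (+ ℓ ℤ.* + ℓ ℤ.* (+ f ℤ.* (+ v ℤ.* + v))) h ∣
                      × Y ≡ v * ∣ S ((+ c) ℤ.^ n) (+ ℓ ℤ.* + ℓ ℤ.* (+ f ℤ.* (+ v ℤ.* + v))) h ∣) → IsPower u v n X Y
      convert (h , eqX , eqY) = h ,
        trans eqX (cong₂ (λ q ω → u * ∣ R q ω h ∣) (sym (pos-^ c n)) ω≡) ,
        trans eqY (cong₂ (λ q ω → v * ∣ S q ω h ∣) (sym (pos-^ c n)) ω≡)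

    g²>0 : 0 < g * g
    g²>0 = N.*-mono-≤ {1} {g} {1} {g} g>0 g>0
      where
      g>0 : 0 < g
      g>0 = N.m^n>0 c ⦃ prime⇒nonZero pc ⦄ γ

    -- `Good` will say that the coordinates are powers of the two primes, and `trivial` that no
    -- proper power is `Good`. `no-unit` excludes exponent 0, and `no-c` excludes exponent -1, which
    -- arises when c divides both coordinates of an element of exponent 1.
    module Unique (no-unit : ∀ X Y → form e f X Y ≢ g * g) (no-c : ∀ X Y → c * form e f X Y ≢ g * g)
      (Good : ℕ → ℕ → Set) (Good⇒∤ : ∀ {X Y} → Good X Y → ¬ c ∣ Y)
      (trivial : ∀ u v n h → form e f u v ≡ g * g * c ^ n → 0 < n →
        Good (u * ∣ R (+ (c ^ n)) (+ (κ * (f * (v * v)))) h ∣) (v * ∣ S (+ (c ^ n)) (+ (κ * (f * (v * v)))) h ∣) → h ≡ 0) where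

      0<exponent : ∀ X Y z → form e f X Y ≡ g * g * c ^ z → 0 < z
      0<exponent X Y zero  eq = ⊥-elim (no-unit X Y (trans eq (sym g²≡g²c^0)))
      0<exponent X Y (suc z) _ = s≤s z≤n

      same-as-generator : ∀ u v n → form e f u v ≡ g * g * c ^ n → 0 < n → ¬ c ∣ v →
        (∀ k X Y → k < n → form e f X Y ≢ g * g * c ^ k) →
        ∀ X Y z → form e f X Y ≡ g * g * c ^ z → Good X Y → X ≡ u × Y ≡ v × z ≡ n
      same-as-generator u v n norm-uv 0<n c∤v minimal X Y z norm-XY good
        with powers u v n norm-uv 0<n c∤v (λ k X Y _ → minimal k X Y) (λ _ → ⊤) (λ _ _ → tt) (λ _ → no-unit)
               X Y z (0<exponent X Y z norm-XY) norm-XY (Good⇒∤ good) tt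
      ... | h , eqX , eqY with trivial u v n h norm-uv 0<n (subst₂ Good eqX eqY good)
      ... | refl = X≡u , Y≡v , ^-injectiveʳ (prime>1 pc) (N.*-cancelˡ-≡ _ _ (g * g) ⦃ >-nonZero g²>0 ⦄
          (trans (sym norm-XY) (trans (cong₂ (form e f) X≡u Y≡v) norm-uv)))
        where
        X≡u : X ≡ u
        X≡u = trans eqX (N.*-identityʳ u)
        Y≡v : Y ≡ v
        Y≡v = trans eqY (N.*-identityʳ v)

      open NS.+-*-Solver

      -- If c divides v, it divides u too, and removing c from both coordinates lowers the exponent
      -- by 2. An element of least exponent thus has v prime to c.
      shrink : ∀ u v n → form e f u v ≡ g * g * c ^ n → 0 < n → c ∣ v →
        ∃[ k ] ∃[ X ] ∃[ Y ] (k < n × form e f X Y ≡ g * g * c ^ k)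
      shrink u v (suc n) norm-uv _ c∣v = from-quotients (c∣u (euclidsLemma e (u * u) pc c∣eu²)) c∣v
        where
        c∣eu² : c ∣ e * (u * u)
        c∣eu² = N.∣m+n∣m⇒∣n
          (subst (c ∣_) (trans (sym norm-uv) (N.+-comm (e * (u * u)) _)) (N.∣n⇒∣m*n (g * g) (N.m∣m*n (c ^ n))))
          (N.∣n⇒∣m*n f (N.∣m⇒∣m*n v c∣v))
        c∣u : (c ∣ e) ⊎ (c ∣ u * u) → c ∣ u
        c∣u (inj₁ c∣e)  = ⊥-elim (c∤e c∣e)
        c∣u (inj₂ c∣u²) = prime∣^⇒∣ pc 2 (subst (c ∣_) (cong (u *_) (sym (N.*-identityʳ u))) c∣u²)
        swap : ∀ n → g * g * c ^ suc n ≡ c * (g * g * c ^ n)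
        swap n = solve 3 (λ g c C → g :* (c :* C) := c :* (g :* C)) refl (g * g) c (c ^ n)
        cancel-c : ∀ {m n} → c * m ≡ c * n → m ≡ n
        cancel-c {m} {n} = N.*-cancelˡ-≡ m n c ⦃ prime⇒nonZero pc ⦄
        from-quotients : c ∣ u → c ∣ v → ∃[ k ] ∃[ X ] ∃[ Y ] (k < suc n × form e f X Y ≡ g * g * c ^ k)
        from-quotients (divides U u≡) (divides V v≡) = by-exponent n (cancel-c (trans
            (solve 5 (λ c e f U V → c :* (c :* (e :* (U :* U) :+ f :* (V :* V))) := e :* ((U :* c) :* (U :* c)) :+ f :*
                ((V :* c) :* (V :* c))) refl c e f U V)
            (trans (sym (cong₂ (form e f) u≡ v≡)) (trans norm-uv (swap n)))))
          where
          by-exponent : ∀ n → c * form e f U V ≡ g * g * c ^ n → ∃[ k ] ∃[ X ] ∃[ Y ]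
              (k < suc n × form e f X Y ≡ g * g * c ^ k)
          by-exponent zero    eq = ⊥-elim (no-c U V (trans eq (sym g²≡g²c^0)))
          by-exponent (suc n) eq = n , U , V , N.m<n+m n {2} z<s , cancel-c (trans eq (swap n))

      -- A generator of least exponent is never searched for. The conclusion is decidable, so its
      -- negation may be assumed; well-founded induction then shows that no exponent is represented
      -- at all, against X, Y and z.
      unique : ∀ X Y z X' Y' z' → form e f X Y ≡ g * g * c ^ z → form e f X' Y' ≡ g * g * c ^ z' →
        Good X Y → Good X' Y' → X ≡ X' × Y ≡ Y' × z ≡ z'
      unique X Y z X' Y' z' eq eq' good good' =
        decidable-stable (X ≟ X' ×-dec (Y ≟ Y' ×-dec z ≟ z')) λ distinct →
          <-rec (λ n → ∀ u v → form e f u v ≢ g * g * c ^ n)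
            (λ n rec u v norm-uv → distinct (conclude n (λ k X Y k<n → rec k<n X Y) u v norm-uv (c ∣? v)))
            z X Y eq
        where
        conclude : ∀ n → (∀ k X Y → k < n → form e f X Y ≢ g * g * c ^ k) → ∀ u v → form e f u v ≡ g * g * c ^ n →
          Dec (c ∣ v) → X ≡ X' × Y ≡ Y' × z ≡ z'
        conclude n minimal u v norm-uv (yes c∣v) with shrink u v n norm-uv (0<exponent u v n norm-uv) c∣v
        ... | k , U , V , k<n , eq = ⊥-elim (minimal k U V k<n eq)
        conclude n minimal u v norm-uv (no c∤v)
          with same-as-generator u v n norm-uv (0<exponent u v n norm-uv) c∤v minimal X Y z eq good
             | same-as-generator u v n norm-uv (0<exponent u v n norm-uv) c∤v minimal X' Y' z' eq' good'
        ... | refl , refl , refl | refl , refl , refl = refl , refl , refl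

-- Odd integers and the 2-adic estimate.

module OddIntegers where
  open import Data.Nat as ℕ using ()
  open import Data.Integer hiding (suc; sign)
  open PrimePowers

  Odd : ℤ → Set
  Odd i = ∃[ k ] i ≡ 1ℤ + + 2 * k

  odd-* : ∀ {i j} → Odd i → Odd j → Odd (i * j)
  odd-* (k , refl) (m , refl) = k + m + + 2 * k * m , identity k m
    where
    identity : ∀ k m → (1ℤ + + 2 * k) * (1ℤ + + 2 * m) ≡ 1ℤ + + 2 * (k + m + + 2 * k * m)
    identity = solve-∀

  odd-+2* : ∀ {i} j → Odd i → Odd (i + + 2 * j)
  odd-+2* j (k , refl) = k + j , identity k j
    where
    identity : ∀ k j → 1ℤ + + 2 * k + + 2 * j ≡ 1ℤ + + 2 * (k + j)
    identity = solve-∀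

  odd-^ : ∀ {i} k → Odd i → Odd (i ^ k)
  odd-^ zero    _ = 0ℤ , refl
  odd-^ (suc k) p = odd-* p (odd-^ k p)

  odd-neg : ∀ {i} → Odd i → Odd (- i)
  odd-neg (k , refl) = - 1ℤ - k , identity k
    where
    identity : ∀ k → - (1ℤ + + 2 * k) ≡ 1ℤ + + 2 * (- 1ℤ - k)
    identity = solve-∀

  odd≢even : ∀ {i} j → Odd i → i ≢ + 2 * j
  odd≢even j (k , eq) e = absurd (N.∣1⇒≡1 (Z.∣⇒∣ᵤ {+ 2} {1ℤ}
      (Z.divides (j - k) (trans (identity k) (trans (cong (_- + 2 * k) (trans (sym eq) e)) (identity' j k))))))
    where
    absurd : 2 ≢ 1
    absurd ()
    identity : ∀ k → 1ℤ ≡ 1ℤ + + 2 * k - + 2 * k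
    identity = solve-∀
    identity' : ∀ j k → + 2 * j - + 2 * k ≡ (j - k) * + 2
    identity' = solve-∀

  ∣odd∣ : ∀ {i k} → ∣ i ∣ ≡ suc (k ℕ.+ k) → Odd i
  ∣odd∣ {+ n} {k} refl = + k , identity (+ k)
    where
    identity : ∀ k → 1ℤ + (k + k) ≡ 1ℤ + + 2 * k
    identity = solve-∀
  ∣odd∣ { -[1+ n ]} {k} eq = subst Odd (cong (λ m → - (+ m)) (sym eq)) (odd-neg (∣odd∣ {+ suc (k ℕ.+ k)} {k} refl))

  2∤⇒odd : ∀ i → ¬ 2 ∣ ∣ i ∣ → Odd i
  2∤⇒odd i 2∤i with odd⊎even ∣ i ∣
  ... | k , inj₁ eq = ⊥-elim (2∤i (divides k (trans eq (trans (cong (k ℕ.+_) (sym (N.+-identityʳ k))) (N.*-comm 2 k)))))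
  ... | k , inj₂ eq = ∣odd∣ {i} {k} eq

  ∣i∣≡1⇒ : ∀ i → ∣ i ∣ ≡ 1 → i ≡ 1ℤ ⊎ i ≡ - 1ℤ
  ∣i∣≡1⇒ (+ 1) refl = inj₁ refl
  ∣i∣≡1⇒ -[1+ 0 ] refl = inj₂ refl

-- α = √E + √-1 with E even and α^(2k) = ρ_k + σ_k√-E: the 2-adic valuation of σ_k is 1 + v(k), while that of
-- norm(α)^(2k) - 1 is at least 3 + v(k).
module TwoAdic (E₀ : ℤ) where
  open import Data.Nat as ℕ using ()
  open import Data.Integer hiding (suc; sign)
  open OddIntegers
  open Powers using (R; P; S)

  E q : ℤ
  E = + 2 * E₀
  q = E + 1ℤ

  ρ σ : ℕ → ℤ
  ρ zero    = 1ℤ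
  ρ (suc k) = (E - 1ℤ) * ρ k - + 2 * E * σ k
  σ zero    = 0ℤ
  σ (suc k) = (E - 1ℤ) * σ k + + 2 * ρ k

  -- The product of α^(2h+1) with α^(2k), in coordinates along √E and √-1.
  RS-+ : ∀ h k → R q (+ 4) (k ℕ.+ h) ≡ R q (+ 4) h * ρ k - S q (+ 4) h * σ k
               × S q (+ 4) (k ℕ.+ h) ≡ S q (+ 4) h * ρ k + E * R q (+ 4) h * σ k
  RS-+ h zero = id₁ (R q (+ 4) h) (S q (+ 4) h) , id₂ (R q (+ 4) h) (S q (+ 4) h) E
    where
    id₁ : ∀ r s → r ≡ r * 1ℤ - s * 0ℤ
    id₁ = solve-∀
    id₂ : ∀ r s E → s ≡ s * 1ℤ + E * r * 0ℤ
    id₂ = solve-∀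
  RS-+ h (suc k) with RS-+ h k
  ... | eqR , eqS = trans (id₁ E r p) (trans (cong₂ (λ r s → (E - 1ℤ) * r - + 2 * s) eqR eqS) (id₂ E r₀ s₀ (ρ k) (σ k)))
                  , trans (id₃ E r p) (trans (cong₂ (λ r s → (E - 1ℤ) * s + + 2 * E * r) eqR eqS) (id₄ E r₀ s₀ (ρ k) (σ k)))
    where
    r = R q (+ 4) (k ℕ.+ h)
    p = P q (+ 4) (k ℕ.+ h)
    r₀ = R q (+ 4) h
    s₀ = S q (+ 4) h
    id₁ : ∀ E r p → (E + 1ℤ) * r - + 4 * p ≡ (E - 1ℤ) * r - + 2 * (+ 2 * p - r)
    id₁ = solve-∀
    id₂ : ∀ E r s ρ σ → (E - 1ℤ) * (r * ρ - s * σ) - + 2 * (s * ρ + E * r * σ)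
      ≡ r * ((E - 1ℤ) * ρ - + 2 * E * σ) - s * ((E - 1ℤ) * σ + + 2 * ρ)
    id₂ = solve-∀
    id₃ : ∀ E r p → + 2 * ((E + 1ℤ) * (r + p) - + 4 * p) - ((E + 1ℤ) * r - + 4 * p)
      ≡ (E - 1ℤ) * (+ 2 * p - r) + + 2 * E * r
    id₃ = solve-∀
    id₄ : ∀ E r s ρ σ → (E - 1ℤ) * (s * ρ + E * r * σ) + + 2 * E * (r * ρ - s * σ)
      ≡ s * ((E - 1ℤ) * ρ - + 2 * E * σ) + E * r * ((E - 1ℤ) * σ + + 2 * ρ)
    id₄ = solve-∀

  ρσ-+ : ∀ m k → ρ (k ℕ.+ m) ≡ ρ k * ρ m - E * (σ k * σ m) × σ (k ℕ.+ m) ≡ σ k * ρ m + ρ k * σ m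
  ρσ-+ m zero = id₁ (ρ m) (σ m) E , id₂ (ρ m) (σ m)
    where
    id₁ : ∀ r s E → r ≡ 1ℤ * r - E * (0ℤ * s)
    id₁ = solve-∀
    id₂ : ∀ r s → s ≡ 0ℤ * r + 1ℤ * s
    id₂ = solve-∀
  ρσ-+ m (suc k) with ρσ-+ m k
  ... | eqρ , eqσ = trans (cong₂ (λ r s → (E - 1ℤ) * r - + 2 * E * s) eqρ eqσ) (id₁ E (ρ m) (σ m) (ρ k) (σ k))
                  , trans (cong₂ (λ r s → (E - 1ℤ) * s + + 2 * r) eqρ eqσ) (id₂ E (ρ m) (σ m) (ρ k) (σ k))
    where
    id₁ : ∀ E r s ρ σ → (E - 1ℤ) * (ρ * r - E * (σ * s)) - + 2 * E * (σ * r + ρ * s)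
      ≡ ((E - 1ℤ) * ρ - + 2 * E * σ) * r - E * (((E - 1ℤ) * σ + + 2 * ρ) * s)
    id₁ = solve-∀
    id₂ : ∀ E r s ρ σ → (E - 1ℤ) * (σ * r + ρ * s) + + 2 * (ρ * r - E * (σ * s))
      ≡ ((E - 1ℤ) * σ + + 2 * ρ) * r + ((E - 1ℤ) * ρ - + 2 * E * σ) * s
    id₂ = solve-∀

  ρσ-norm : ∀ k → ρ k * ρ k + E * (σ k * σ k) ≡ q ^ k * q ^ k
  ρσ-norm zero = identity E
    where
    identity : ∀ E → 1ℤ * 1ℤ + E * (0ℤ * 0ℤ) ≡ 1ℤ * 1ℤ
    identity = solve-∀
  ρσ-norm (suc k) = trans (id₁ E (ρ k) (σ k)) (trans (cong (q * q *_) (ρσ-norm k)) (id₂ q (q ^ k)))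
    where
    id₁ : ∀ E ρ σ → ((E - 1ℤ) * ρ - + 2 * E * σ) * ((E - 1ℤ) * ρ - + 2 * E * σ) + E *
        (((E - 1ℤ) * σ + + 2 * ρ) * ((E - 1ℤ) * σ + + 2 * ρ))
      ≡ (E + 1ℤ) * (E + 1ℤ) * (ρ * ρ + E * (σ * σ))
    id₁ = solve-∀
    id₂ : ∀ q x → q * q * (x * x) ≡ q * x * (q * x)
    id₂ = solve-∀

  ρ-odd : ∀ k → Odd (ρ k)
  ρ-odd zero = 0ℤ , refl
  ρ-odd (suc k) = subst Odd (identity E₀ (ρ k) (σ k)) (odd-+2* (E₀ * ρ k - + 2 * E₀ * σ k) (odd-neg (ρ-odd k)))
    where
    identity : ∀ E ρ σ → - ρ + + 2 * (E * ρ - + 2 * E * σ) ≡ (+ 2 * E - 1ℤ) * ρ - + 2 * (+ 2 * E) * σ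
    identity = solve-∀

  σ-mod-4 : ∀ k → ∃[ y ] σ k ≡ + 2 * + k + + 4 * y
  σ-mod-4 zero = 0ℤ , refl
  σ-mod-4 (suc k) with σ-mod-4 k | ρ-odd k
  ... | y , eqσ | x , eqρ = E₀ * + k - + k + (+ 2 * E₀ - 1ℤ) * y + x ,
      trans (cong₂ (λ s r → (E - 1ℤ) * s + + 2 * r) eqσ eqρ) (identity E₀ (+ k) x y)
    where
    identity : ∀ E k x y → (+ 2 * E - 1ℤ) * (+ 2 * k + + 4 * y) + + 2 * (1ℤ + + 2 * x)
      ≡ + 2 * (1ℤ + k) + + 4 * (E * k - k + (+ 2 * E - 1ℤ) * y + x)
    identity = solve-∀

  q-odd : Odd q
  q-odd = E₀ , Z.+-comm E 1ℤ

  -- `D` carries the 2-part of σ_k without naming its exponent. For odd k it is 2, and an odd square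
  -- minus 1 is divisible by 8. Passing from j to 2j doubles `D`, as σ becomes 2ρσ, and multiplies
  -- q^(2j) - 1 by the even number q^(2j) + 1.
  σ-valuation : ∀ k → 0 ℕ.< k → ∃[ D ] ∃[ o ] ∃[ m ]
    (∣ D ∣ ≢ 0 × σ k ≡ D * o × Odd o × q ^ k * q ^ k - 1ℤ ≡ + 4 * D * m)
  σ-valuation = <-rec _ step
    where
    open PrimePowers
    triangular : ∀ t → ∃[ m ] t * (t + 1ℤ) ≡ + 2 * m
    triangular t with odd⊎even ∣ t ∣
    ... | k , inj₂ eq = by-odd (∣odd∣ {t} {k} eq)
      where
      by-odd : Odd t → ∃[ m ] t * (t + 1ℤ) ≡ + 2 * m
      by-odd (j , refl) = (1ℤ + + 2 * j) * (1ℤ + j) , identity j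
        where
        identity : ∀ j → (1ℤ + + 2 * j) * (1ℤ + + 2 * j + 1ℤ) ≡ + 2 * ((1ℤ + + 2 * j) * (1ℤ + j))
        identity = solve-∀
    ... | k , inj₁ eq = by-even (Z.∣ᵤ⇒∣ {+ 2} {t}
        (divides k (trans eq (trans (cong (k ℕ.+_) (sym (N.+-identityʳ k))) (N.*-comm 2 k)))))
      where
      by-even : + 2 Z.∣ t → ∃[ m ] t * (t + 1ℤ) ≡ + 2 * m
      by-even (Z.divides j refl) = j * (j * + 2 + 1ℤ) , identity j
        where
        identity : ∀ j → j * + 2 * (j * + 2 + 1ℤ) ≡ + 2 * (j * (j * + 2 + 1ℤ))
        identity = solve-∀
    step : ∀ k → (∀ {j} → j ℕ.< k → 0 ℕ.< j → ∃[ D ] ∃[ o ] ∃[ m ]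
        (∣ D ∣ ≢ 0 × σ j ≡ D * o × Odd o × q ^ j * q ^ j - 1ℤ ≡ + 4 * D * m)) → 0 ℕ.< k → ∃[ D ] ∃[ o ] ∃[ m ]
      (∣ D ∣ ≢ 0 × σ k ≡ D * o × Odd o × q ^ k * q ^ k - 1ℤ ≡ + 4 * D * m)
    step k rec 0<k with odd⊎even k
    ... | j , inj₂ refl = odd-case (σ-mod-4 k) (odd-^ k q-odd)
      where
      odd-case : ∃[ y ] σ k ≡ + 2 * + k + + 4 * y → Odd (q ^ k) → _
      odd-case (y , eqσ) (t , eqq) with triangular t
      ... | m , eqt = + 2 , + k + + 2 * y , m , (λ ()) , trans eqσ (id₁ (+ k) y) , odd-+2* y (∣odd∣ {+ k} {j} refl)
          , trans (cong (λ x → x * x - 1ℤ) eqq) (trans (id₂ t) (trans (cong (+ 4 *_) eqt) (sym (Z.*-assoc (+ 4) (+ 2) m))))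
        where
        id₁ : ∀ k y → + 2 * k + + 4 * y ≡ + 2 * (k + + 2 * y)
        id₁ = solve-∀
        id₂ : ∀ t → (1ℤ + + 2 * t) * (1ℤ + + 2 * t) - 1ℤ ≡ + 4 * (t * (t + 1ℤ))
        id₂ = solve-∀
    ... | zero , inj₁ refl = ⊥-elim (N.<-irrefl refl 0<k)
    ... | j@(suc _) , inj₁ refl with rec (N.m<m+n j {j} (ℕ.s≤s ℕ.z≤n)) (ℕ.s≤s ℕ.z≤n) | odd-* (odd-^ j q-odd) (odd-^ j q-odd)
    ... | D , o , m , D≢0 , eqσ , o-odd , eqq | t , eqt = + 2 * D , ρ j * o , m * (1ℤ + t) ,
        (λ e → D≢0 (N.m*n≡0⇒m≡0 ∣ D ∣ 2 (trans (N.*-comm ∣ D ∣ 2) (trans (sym (Z.abs-* (+ 2) D)) e)))) ,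
        trans (proj₂ (ρσ-+ j j)) (trans (cong (λ s → s * ρ j + ρ j * s) eqσ) (id₁ D o (ρ j))) ,
        odd-* (ρ-odd j) o-odd ,
        trans (cong (λ x → x * x - 1ℤ) (Z.^-distribˡ-+-* q j j))
            (trans (id₂ (q ^ j * q ^ j)) (trans (cong₂ (λ x y → x * (y + 1ℤ)) eqq eqt) (id₃ D m t)))
      where
      id₁ : ∀ D o ρ → D * o * ρ + ρ * (D * o) ≡ + 2 * D * (ρ * o)
      id₁ = solve-∀
      id₂ : ∀ x → x * x - 1ℤ ≡ (x - 1ℤ) * (x + 1ℤ)
      id₂ = solve-∀
      id₃ : ∀ D m t → + 4 * D * m * (1ℤ + + 2 * t + 1ℤ) ≡ + 4 * (+ 2 * D) * (m * (1ℤ + t))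
      id₃ = solve-∀

  -- Raising the index by 2k multiplies by (ρ_k + σ_k√-E)². If both values of R are the same ε,
  -- comparison with ρ² + Eσ² = q^(2k) yields q^(2k) - 1 = 2σ(εs₀ρ + Eσ) with an odd last factor,
  -- against `σ-valuation`. Opposite signs fail modulo 4.
  same-class⇒≡ : ∀ h₀ k → ∣ R q (+ 4) h₀ ∣ ≡ 1 → ∣ R q (+ 4) (k ℕ.+ k ℕ.+ h₀) ∣ ≡ 1 → k ≡ 0
  same-class⇒≡ h₀ zero _ _ = refl
  same-class⇒≡ h₀ k@(suc _) R₀≡1 R≡1 = ⊥-elim (by-signs (∣i∣≡1⇒ r₀ R₀≡1) (∣i∣≡1⇒ (R q (+ 4) (k ℕ.+ k ℕ.+ h₀)) R≡1))
    where
    r₀ = R q (+ 4) h₀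
    s₀ = S q (+ 4) h₀
    s₀-odd : Odd s₀
    s₀-odd with Powers.S-mod-ω q (+ 4) h₀
    ... | x , eq = subst Odd (trans (id₁ (+ suc (h₀ ℕ.+ h₀) * q ^ h₀) x) (sym eq))
        (odd-+2* (+ 2 * x) (odd-* (∣odd∣ {+ suc (h₀ ℕ.+ h₀)} {h₀} refl) (odd-^ h₀ q-odd)))
      where
      id₁ : ∀ a x → a + + 2 * (+ 2 * x) ≡ a + + 4 * x
      id₁ = solve-∀
    R≡ : R q (+ 4) (k ℕ.+ k ℕ.+ h₀) ≡ r₀ * (ρ k * ρ k - E * (σ k * σ k)) - + 2 * (s₀ * ρ k * σ k)
    R≡ = trans (proj₁ (RS-+ h₀ (k ℕ.+ k))) (trans (cong₂ (λ a b → r₀ * a - s₀ * b) (proj₁ (ρσ-+ k k)) (proj₂ (ρσ-+ k k)))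
        (identity E r₀ s₀ (ρ k) (σ k)))
      where
      identity : ∀ E r s ρ σ → r * (ρ * ρ - E * (σ * σ)) - s * (σ * ρ + ρ * σ) ≡ r * (ρ * ρ - E * (σ * σ)) - + 2 *
          (s * ρ * σ)
      identity = solve-∀
    valuation : ∀ ε → ε * ε ≡ 1ℤ → Odd ε → r₀ ≡ ε → R q (+ 4) (k ℕ.+ k ℕ.+ h₀) ≡ ε → ⊥
    valuation ε ε²≡1 ε-odd r₀≡ R≡ε with σ-valuation k (ℕ.s≤s ℕ.z≤n)
    ... | D , o , m , D≢0 , eqσ , o-odd , eqq = odd≢even m (odd-* o-odd bracket-odd) (sym cancelled)
      where
      bracket : ℤ
      bracket = ε * s₀ * ρ k + + 2 * (E₀ * σ k)
      bracket-odd : Odd bracket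
      bracket-odd = odd-+2* (E₀ * σ k) (odd-* (odd-* ε-odd s₀-odd) (ρ-odd k))
      eq₁ : q ^ k * q ^ k - 1ℤ ≡ + 2 * σ k * bracket
      eq₁ = trans (cong (_- 1ℤ) (sym (ρσ-norm k))) (trans
          (cong (λ t → ρ k * ρ k + E * (σ k * σ k) - t)
          (trans (sym ε²≡1) (cong (ε *_) (trans (sym R≡ε)
          (trans R≡ (cong (λ r → r * (ρ k * ρ k - E * (σ k * σ k)) - + 2 * (s₀ * ρ k * σ k)) r₀≡))))))
        (trans (id₁ ε E (ρ k * ρ k) (σ k * σ k) (s₀ * ρ k * σ k))
            (trans (cong (λ t → ρ k * ρ k + E * (σ k * σ k) -
            (t * (ρ k * ρ k - E * (σ k * σ k)) - + 2 * (ε * (s₀ * ρ k * σ k)))) ε²≡1) (id₂ ε E₀ (ρ k) (σ k) s₀))))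
        where
        id₁ : ∀ ε E a b c → a + E * b - ε * (ε * (a - E * b) - + 2 * c) ≡ a + E * b - (ε * ε * (a - E * b) - + 2 * (ε * c))
        id₁ = solve-∀
        id₂ : ∀ ε E ρ σ s → ρ * ρ + + 2 * E * (σ * σ) - (1ℤ * (ρ * ρ - + 2 * E * (σ * σ)) - + 2 * (ε * (s * ρ * σ))) ≡ + 2
            * σ * (ε * s * ρ + + 2 * (E * σ))
        id₂ = solve-∀
      cancelled : + 2 * m ≡ o * bracket
      cancelled = Z.*-cancelˡ-≡ (+ 2 * D) _ _ ⦃ ℕ.≢-nonZero
          (λ e → D≢0 (N.m*n≡0⇒m≡0 ∣ D ∣ 2 (trans (N.*-comm ∣ D ∣ 2) (trans (sym (Z.abs-* (+ 2) D)) e)))) ⦄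
        (trans (id₁ D m) (trans (sym eqq) (trans eq₁ (trans (cong (λ s → + 2 * s * bracket) eqσ) (id₂ D o bracket)))))
        where
        id₁ : ∀ D m → + 2 * D * (+ 2 * m) ≡ + 4 * D * m
        id₁ = solve-∀
        id₂ : ∀ D o b → + 2 * (D * o) * b ≡ + 2 * D * (o * b)
        id₂ = solve-∀
    opposite : ∀ ε → Odd ε → r₀ ≡ ε → R q (+ 4) (k ℕ.+ k ℕ.+ h₀) ≡ - ε → ⊥
    opposite ε ε-odd r₀≡ R≡-ε with ρ-odd k | σ-mod-4 k
    ... | x , eqρ | y , eqσ = odd≢even _ ε-odd (Z.*-cancelˡ-≡ (+ 2) _ _
        (trans (id₁ ε E (ρ k) (σ k) s₀) (trans (cong (λ t → ε * (1ℤ - ρ k * ρ k + E * (σ k * σ k)) + + 2 *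
        (s₀ * ρ k * σ k) + (t + ε))
        (trans (sym (trans R≡ (cong (λ r → r * (ρ k * ρ k - E * (σ k * σ k)) - + 2 * (s₀ * ρ k * σ k)) r₀≡))) R≡-ε))
        (trans (cong₂ (λ ρ σ → ε * (1ℤ - ρ * ρ + E * (σ * σ)) + + 2 * (s₀ * ρ * σ) + (- ε + ε)) eqρ eqσ)
          (id₂ ε E₀ x (+ k) y s₀)))))
      where
      id₁ : ∀ ε E ρ σ s → + 2 * ε ≡ ε * (1ℤ - ρ * ρ + E * (σ * σ)) + + 2 * (s * ρ * σ) +
          (ε * (ρ * ρ - E * (σ * σ)) - + 2 * (s * ρ * σ) + ε)
      id₁ = solve-∀
      id₂ : ∀ ε E x k y s → ε * (1ℤ - (1ℤ + + 2 * x) * (1ℤ + + 2 * x) + + 2 * E *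
          ((+ 2 * k + + 4 * y) * (+ 2 * k + + 4 * y))) + + 2 * (s * (1ℤ + + 2 * x) * (+ 2 * k + + 4 * y)) + (- ε + ε)
        ≡ + 2 * (+ 2 * (- (ε * (x * x + x)) + + 2 * (ε * (E * ((k + + 2 * y) * (k + + 2 * y)))) + s * (1ℤ + + 2 * x) *
            (k + + 2 * y)))
      id₂ = solve-∀
    by-signs : r₀ ≡ 1ℤ ⊎ r₀ ≡ - 1ℤ → R q (+ 4) (k ℕ.+ k ℕ.+ h₀) ≡ 1ℤ ⊎ R q (+ 4) (k ℕ.+ k ℕ.+ h₀) ≡ - 1ℤ → ⊥
    by-signs (inj₁ p) (inj₁ p') = valuation 1ℤ refl (0ℤ , refl) p p'
    by-signs (inj₂ p) (inj₂ p') = valuation (- 1ℤ) refl (- 1ℤ , refl) p p'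
    by-signs (inj₁ p) (inj₂ p') = opposite 1ℤ (0ℤ , refl) p p'
    by-signs (inj₂ p) (inj₁ p') = opposite (- 1ℤ) (- 1ℤ , refl) p p'

-- At most one solution in each parity class.

module Uniqueness where
  open import Data.Nat
  open import Data.Integer as ℤ using (+_; ∣_∣)
  open import Data.Integer.Divisibility.Signed using () renaming (_∣_ to _∣ᶻ_)
  open PrimePowers
  open AbsoluteValues
  open Powers using (R; S)
  open TrivialPowers
  open TrivialPowers₂
  open Representations

  ∤^ : ∀ {p r} → Prime p → Prime r → p ≢ r → ∀ k → ¬ p ∣ r ^ k
  ∤^ pp pr p≢r k p∣ = p≢r (prime∣prime^⇒≡ pp pr k p∣)

  ∤⇒∤R : ∀ {p} → Prime p → ∀ q ω h → p ∣ ω → ¬ p ∣ q → ¬ p ∣ ∣ R (+ q) (+ ω) h ∣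
  ∤⇒∤R {p} pr q ω h p∣ω p∤q p∣R with Powers.R-P-mod-ω (+ q) (+ ω) h
  ... | x , _ , eq , _ = p∤q (prime∣^⇒∣ pr h (subst (p ∣_) (abs-^ (+ q) h)
      (∣-abs-+ (+ ω ℤ.* x) ((+ q) ℤ.^ h) (∣-abs-* (+ ω) x p∣ω)
        (subst (λ t → p ∣ ∣ t ∣) (trans eq (Z.+-comm ((+ q) ℤ.^ h) (+ ω ℤ.* x))) p∣R))))

  -- R ≡ q^h modulo 4w is odd.
  R-unit : ∀ q w h i → ¬ 2 ∣ q → ∣ R (+ q) (+ (4 * w)) h ∣ ≡ 2 ^ i → ∣ R (+ q) (+ (4 * w)) h ∣ ≡ 1
  R-unit q w h i 2∤q eq = unit-value {s = i} prime[2] eq (∤⇒∤R prime[2] q (4 * w) h (N.∣m⇒∣m*n w (divides 2 refl)) 2∤q)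

  ^-square : ∀ p ε i → p ^ ε * (p ^ i * p ^ i) ≡ p ^ (ε + (i + i))
  ^-square p ε i = trans (cong (p ^ ε *_) (sym (N.^-distribˡ-+-* p i i))) (sym (N.^-distribˡ-+-* p ε (i + i)))

  trivial-difference : ∀ c (i j : ℤ) → ¬ + c ∣ᶻ i → ¬ + c ∣ᶻ j → (+ c) ℤ.^ 0 ∣ᶻ i ℤ.- j
  trivial-difference c i j _ _ = Z.divides (i ℤ.- j) (sym (Z.*-identityʳ _))

  module _ {b c : ℕ} (pb : Prime b) (pc : Prime c) (b≢2 : b ≢ 2) (c≢2 : c ≢ 2) (b≢c : b ≢ c) where

    -- ε and φ fix the parities of the exponents; 2^ε and b^φ become the coefficients of the form,
    -- with g = 1.
    unique-odd : ∀ ε φ → 0 < ε → 0 < φ → ∀ i j z i' j' z' →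
      2 ^ (ε + (i + i)) + b ^ (φ + (j + j)) ≡ c ^ z → 2 ^ (ε + (i' + i')) + b ^ (φ + (j' + j')) ≡ c ^ z' →
      i ≡ i' × j ≡ j' × z ≡ z'
    unique-odd ε φ 0<ε 0<φ i j z i' j' z' eq eq'
      with Rp.Unique.unique no-unit no-c Good Good⇒∤ trivial (2 ^ i) (b ^ j) z (2 ^ i') (b ^ j') z'
             (norm i j z eq) (norm i' j' z' eq') (i , j , refl , refl) (i' , j' , refl , refl)
      where
      e f : ℕ
      e = 2 ^ ε
      f = b ^ φ
      2≤e : 2 ≤ e
      2≤e = prime^≥ prime[2] 0<ε
      2≤f : 2 ≤ f
      2≤f = N.≤-trans (prime>1 pb) (prime^≥ pb 0<φ)
      module Rp = Rep c pc e f 2 0 refl (∤^ pc prime[2] c≢2 ε) (∤^ pc pb (λ e → b≢c (sym e)) φ)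
        (λ c∣2 → c≢2 (prime∣prime⇒≡ pc prime[2] c∣2)) (N.<-≤-trans (s≤s z<s) (N.*-mono-≤ 2≤e 2≤f)) (trivial-difference c)
      norm : ∀ i j z → 2 ^ (ε + (i + i)) + b ^ (φ + (j + j)) ≡ c ^ z → form e f (2 ^ i) (b ^ j) ≡ 1 * 1 * c ^ z
      norm i j z eq = trans (cong₂ _+_ (^-square 2 ε i) (^-square b φ j)) (trans eq (sym (N.*-identityˡ _)))
      no-unit : ∀ X Y → form e f X Y ≢ 1
      no-unit zero zero eq rewrite N.*-zeroʳ e | N.*-zeroʳ f = case eq
        where
        case : 0 ≢ 1
        case ()
      no-unit (suc X) Y eq = N.<⇒≱ 2≤e (N.≤-trans (N.m≤m*n e (suc X * suc X))
          (N.≤-trans (N.m≤m+n _ (f * (Y * Y))) (N.≤-reflexive eq)))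
      no-unit zero (suc Y) eq = N.<⇒≱ 2≤f (N.≤-trans (N.m≤m*n f (suc Y * suc Y))
          (N.≤-trans (N.m≤n+m _ (e * 0)) (N.≤-reflexive eq)))
      no-c : ∀ X Y → c * form e f X Y ≢ 1
      no-c X Y eq = prime∤1 pc (subst (c ∣_) eq (N.m∣m*n (form e f X Y)))
      Good : ℕ → ℕ → Set
      Good X Y = ∃[ i ] ∃[ j ] (X ≡ 2 ^ i × Y ≡ b ^ j)
      Good⇒∤ : ∀ {X Y} → Good X Y → ¬ c ∣ Y
      Good⇒∤ (i , j , _ , refl) = ∤^ pc pb (λ e → b≢c (sym e)) j
      trivial : ∀ u v n h → form e f u v ≡ 1 * 1 * c ^ n → 0 < n →
        Good (u * ∣ R (+ (c ^ n)) (+ (4 * (f * (v * v)))) h ∣) (v * ∣ S (+ (c ^ n)) (+ (4 * (f * (v * v)))) h ∣) → h ≡ 0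
      trivial u v n h norm-uv _ (i , j , eqX , eqY) with power-product {m = u} {s = i} prime[2] eqX | power-product {m = v} {s = j} pb eqY
      ... | t , t' , refl , R≡ | s , s' , refl , S≡ =
          no-odd-power pb b≢2 (ε + (t + t)) (φ + (s + s)) (N.<-≤-trans 0<ε (N.m≤m+n ε _)) (N.<-≤-trans 0<φ (N.m≤m+n φ _))
              h s'
            (subst₂ (λ q w → ∣ R (+ q) (+ (4 * w)) h ∣ ≡ 1) q≡ (^-square b φ s)
                (R-unit (c ^ n) (f * (b ^ s * b ^ s)) h t' (∤^ prime[2] pc (λ e → c≢2 (sym e)) n) R≡))
            (subst₂ (λ q w → ∣ S (+ q) (+ (4 * w)) h ∣ ≡ b ^ s') q≡ (^-square b φ s) S≡)
        where
        q≡ : c ^ n ≡ 2 ^ (ε + (t + t)) + b ^ (φ + (s + s))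
        q≡ = trans (trans (sym (N.*-identityˡ _)) (sym norm-uv)) (cong₂ _+_ (^-square 2 ε t) (^-square b φ s))
    ... | 2^i≡ , b^j≡ , z≡ = ^-injectiveʳ (prime>1 prime[2]) 2^i≡ , ^-injectiveʳ (prime>1 pb) b^j≡ , z≡

  even-difference : ∀ (i j : ℤ) → ¬ + 2 ∣ᶻ i → ¬ + 2 ∣ᶻ j → (+ 2) ℤ.^ 1 ∣ᶻ i ℤ.- j
  even-difference i j 2∤i 2∤j with OddIntegers.2∤⇒odd i (λ p → 2∤i (Z.∣ᵤ⇒∣ {+ 2} {i} p)) | OddIntegers.2∤⇒odd j (λ p → 2∤j (Z.∣ᵤ⇒∣ {+ 2} {j} p))
  ... | k , refl | m , refl = Z.divides (k ℤ.- m) (identity k m)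
    where
    identity : ∀ k m → 1ℤ ℤ.+ + 2 ℤ.* k ℤ.- (1ℤ ℤ.+ + 2 ℤ.* m) ≡ (k ℤ.- m) ℤ.* (+ 2 ℤ.* 1ℤ)
    identity = solve-∀

  odd-prime≥3 : ∀ {p} → Prime p → p ≢ 2 → 3 ≤ p
  odd-prime≥3 pp p≢2 = N.≤∧≢⇒< (prime>1 pp) (λ e → p≢2 (sym e))

  module _ {a b : ℕ} (pa : Prime a) (pb : Prime b) (a≢2 : a ≢ 2) (b≢2 : b ≢ 2) (a≢b : a ≢ b)
    (¬exc : ¬ Exceptional a b) (¬exc' : ¬ Exceptional b a) where

    unique-two : ∀ ε φ → 0 < ε → 0 < φ → ∀ i j z i' j' z' →
      a ^ (ε + (i + i)) + b ^ (φ + (j + j)) ≡ 2 ^ (2 + z) → a ^ (ε + (i' + i')) + b ^ (φ + (j' + j')) ≡ 2 ^ (2 + z') →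
      i ≡ i' × j ≡ j' × z ≡ z'
    unique-two ε φ 0<ε 0<φ i j z i' j' z' eq eq'
      with Rp.Unique.unique no-unit no-c Good Good⇒∤ trivial (a ^ i) (b ^ j) z (a ^ i') (b ^ j') z'
             (norm i j z eq) (norm i' j' z' eq') (i , j , refl , refl) (i' , j' , refl , refl)
      where
      e f : ℕ
      e = a ^ ε
      f = b ^ φ
      3≤e : 3 ≤ e
      3≤e = N.≤-trans (odd-prime≥3 pa a≢2) (prime^≥ pa 0<ε)
      3≤f : 3 ≤ f
      3≤f = N.≤-trans (odd-prime≥3 pb b≢2) (prime^≥ pb 0<φ)
      2∤e : ¬ 2 ∣ e
      2∤e = ∤^ prime[2] pa (λ e → a≢2 (sym e)) ε
      2∤f : ¬ 2 ∣ f
      2∤f = ∤^ prime[2] pb (λ e → b≢2 (sym e)) φ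
      module Rp = Rep 2 prime[2] e f 1 1 refl 2∤e 2∤f
        (prime∤1 prime[2]) (N.<-≤-trans (s≤s (s≤s (s≤s (s≤s z<s)))) (N.*-mono-≤ 3≤e 3≤f)) even-difference
      4*2^ : ∀ z → 2 ^ (2 + z) ≡ 2 * 2 * 2 ^ z
      4*2^ z = sym (N.*-assoc 2 2 (2 ^ z))
      norm : ∀ i j z → a ^ (ε + (i + i)) + b ^ (φ + (j + j)) ≡ 2 ^ (2 + z) → form e f (a ^ i) (b ^ j) ≡ 2 * 2 * 2 ^ z
      norm i j z eq = trans (cong₂ _+_ (^-square a ε i) (^-square b φ j)) (trans eq (4*2^ z))
      no-even : ∀ n → 3 ≤ n → ¬ 2 ∣ n → ∀ X → n * (X * X) ≤ 4 → 2 ∣ n * (X * X) → X ≡ 0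
      no-even n 3≤n 2∤n zero _ _ = refl
      no-even n 3≤n 2∤n (suc zero) _ 2∣ = ⊥-elim (2∤n (subst (2 ∣_) (N.*-identityʳ n) 2∣))
      no-even n 3≤n 2∤n (suc (suc X)) ≤4 _ = ⊥-elim
          (N.<⇒≱ (from-yes (4 <? 12)) (N.≤-trans (N.*-mono-≤ 3≤n
          (N.*-mono-≤ {2} {suc (suc X)} {2} {suc (suc X)} (s≤s z<s) (s≤s z<s))) ≤4))
      -- As e, f ≥ 3, one coordinate must vanish; the other contributes an odd value at 1 and at
      -- least 12 from 2 on.
      not-small : ∀ m → m ≤ 4 → 0 < m → 2 ∣ m → ∀ X Y → form e f X Y ≢ m
      not-small m m≤4 0<m 2∣m zero Y eq = N.<⇒≢ 0<m (trans (sym zero≡) eq)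
        where
        eY : e * 0 ≡ 0
        eY = N.*-zeroʳ e
        fY²≡ : f * (Y * Y) ≡ m
        fY²≡ = trans (cong (_+ f * (Y * Y)) (sym eY)) eq
        Y≡0 : Y ≡ 0
        Y≡0 = no-even f 3≤f 2∤f Y (subst (_≤ 4) (sym fY²≡) m≤4) (subst (2 ∣_) (sym fY²≡) 2∣m)
        zero≡ : form e f 0 Y ≡ 0
        zero≡ = trans (cong (form e f 0) Y≡0) (cong₂ _+_ eY (N.*-zeroʳ f))
      not-small m m≤4 0<m 2∣m (suc X) zero eq with no-even e 3≤e 2∤e (suc X) (subst (_≤ 4) (sym eX²≡) m≤4) (subst (2 ∣_) (sym eX²≡) 2∣m)
        where
        eX²≡ : e * (suc X * suc X) ≡ m
        eX²≡ = trans (sym (N.+-identityʳ _)) (trans (cong (λ t → e * (suc X * suc X) + t) (sym (N.*-zeroʳ f))) eq)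
      ... | ()
      not-small m m≤4 0<m 2∣m (suc X) (suc Y) eq = N.<⇒≱ (from-yes (4 <? 6)) (N.≤-trans (N.+-mono-≤
        (N.≤-trans 3≤e (N.m≤m*n e (suc X * suc X))) (N.≤-trans 3≤f (N.m≤m*n f (suc Y * suc Y))))
            (N.≤-trans (N.≤-reflexive eq) m≤4))
      no-unit : ∀ X Y → form e f X Y ≢ 4
      no-unit = not-small 4 N.≤-refl z<s (divides 2 refl)
      no-c : ∀ X Y → 2 * form e f X Y ≢ 4
      no-c X Y eq = not-small 2 (s≤s z<s) z<s (divides 1 refl) X Y (N.*-cancelˡ-≡ (form e f X Y) 2 2 eq)
      Good : ℕ → ℕ → Set
      Good X Y = ∃[ i ] ∃[ j ] (X ≡ a ^ i × Y ≡ b ^ j)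
      Good⇒∤ : ∀ {X Y} → Good X Y → ¬ 2 ∣ Y
      Good⇒∤ (i , j , _ , refl) = ∤^ prime[2] pb (λ e → b≢2 (sym e)) j
      trivial : ∀ u v n h → form e f u v ≡ 2 * 2 * 2 ^ n → 0 < n →
        Good (u * ∣ R (+ (2 ^ n)) (+ (1 * (f * (v * v)))) h ∣) (v * ∣ S (+ (2 ^ n)) (+ (1 * (f * (v * v)))) h ∣) → h ≡ 0
      trivial u v n h norm-uv 0<n (i , j , eqX , eqY) with power-product {m = u} {s = i} pa eqX | power-product {m = v} {s = j} pb eqY
      ... | t , t' , refl , R≡ | s , s' , refl , S≡ = [ (λ z → z) , [ (λ x → ⊥-elim (¬exc x)) , (λ x → ⊥-elim (¬exc' x))
          ]′ ]′
          (no-odd-power₂ pa pb a≢2 b≢2 a≢b (ε + (t + t)) (φ + (s + s)) n (N.<-≤-trans 0<ε (N.m≤m+n ε _))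
              (N.<-≤-trans 0<φ (N.m≤m+n φ _)) 0<n
            (trans (sym (cong₂ _+_ (^-square a ε t) (^-square b φ s))) norm-uv) h t' s'
            (subst (λ w → ∣ R (+ (2 ^ n)) (+ (1 * w)) h ∣ ≡ a ^ t') (^-square b φ s) R≡)
            (subst (λ w → ∣ S (+ (2 ^ n)) (+ (1 * w)) h ∣ ≡ b ^ s') (^-square b φ s) S≡))
    ... | a^i≡ , b^j≡ , z≡ = ^-injectiveʳ (prime>1 pa) a^i≡ , ^-injectiveʳ (prime>1 pb) b^j≡ , z≡

-- Fermat's descent for X² + DY².

module Descent where
  open import Data.Integer hiding (suc; sign)

  norm : ℤ → ℤ → ℤ → ℤ
  norm D s t = 1ℤ * (s * s) + D * (t * t)

  -- Brahmagupta's identity: up to conjugation, the new element is (s + mK) + (t + lK)√-D times the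
  -- conjugate of its residue s + t√-D, divided by K.
  norm-quotient : ∀ D K n k s m t l → .⦃ _ : NonZero K ⦄ →
    norm D (s + m * K) (t + l * K) ≡ K * n → norm D s t ≡ K * k →
    norm D (k + (m * s + D * (l * t))) (m * t - l * s) ≡ k * n
  norm-quotient D K n k s m t l eq eq' = Z.*-cancelˡ-≡ K _ _ (Z.*-cancelˡ-≡ K _ _
    (trans (id₁ K k m s D l t)
    (trans (cong (λ z → (z + K * (m * s + D * (l * t))) * (z + K * (m * s + D * (l * t)))
        + D * ((K * (m * t - l * s)) * (K * (m * t - l * s)))) (sym eq'))
    (trans (id₂ K m s D l t) (trans (cong₂ _*_ eq eq') (id₃ K n k))))))
    where
    id₁ : ∀ K k m s D l t → K * (K * (1ℤ * ((k + (m * s + D * (l * t))) * (k + (m * s + D * (l * t)))) + D *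
        ((m * t - l * s) * (m * t - l * s))))
      ≡ (K * k + K * (m * s + D * (l * t))) * (K * k + K * (m * s + D * (l * t)))
        + D * ((K * (m * t - l * s)) * (K * (m * t - l * s)))
    id₁ = solve-∀
    id₂ : ∀ K m s D l t →
      ((1ℤ * (s * s) + D * (t * t)) + K * (m * s + D * (l * t))) * ((1ℤ * (s * s) + D * (t * t)) + K * (m * s + D * (l * t)))
        + D * ((K * (m * t - l * s)) * (K * (m * t - l * s)))
      ≡ (1ℤ * ((s + m * K) * (s + m * K)) + D * ((t + l * K) * (t + l * K))) * (1ℤ * (s * s) + D * (t * t))
    id₂ = solve-∀
    id₃ : ∀ K n k → K * n * (K * k) ≡ K * (K * (k * n))
    id₃ = solve-∀

  residue-divisible : ∀ D K n s m t l → norm D (s + m * K) (t + l * K) ≡ K * n → K Z.∣ norm D s t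
  residue-divisible D K n s m t l eq = Z.divides (n - rest)
      (trans (id₁ s m t l K D) (trans (cong (_- K * rest) eq) (id₂ K n rest)))
    where
    rest = (+ 2 * (m * s) + m * m * K) + D * (+ 2 * (l * t) + l * l * K)
    id₁ : ∀ s m t l K D → 1ℤ * (s * s) + D * (t * t) ≡
      1ℤ * ((s + m * K) * (s + m * K)) + D * ((t + l * K) * (t + l * K))
      - K * ((+ 2 * (m * s) + m * m * K) + D * (+ 2 * (l * t) + l * l * K))
    id₁ = solve-∀
    id₂ : ∀ K n r → K * n - K * r ≡ (n - r) * K
    id₂ = solve-∀

-- Fermat's descent: for D ≤ 2 the least absolute residues modulo k give a multiple of k smaller than k².
module FermatDescent (D : ℕ) (0<D : 0 N.< D) (D≤2 : D N.≤ 2) where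
  open import Data.Nat
  open import Data.Integer as ℤ using (+_; ∣_∣)
  open PrimePowers
  open AbsoluteValues
  open Representations using (form; +form)

  near : ∀ s k → 0 < k → ∃[ s' ] ∃[ m ] (+ s ≡ s' ℤ.+ m ℤ.* + k × 2 * ∣ s' ∣ ≤ k)
  near s k@(suc _) _ with 2 * (s % k) ≤? k
  ... | yes p = + (s % k) , + (s / k) , s≡ , p
    where
    s≡ : + s ≡ + (s % k) ℤ.+ + (s / k) ℤ.* + k
    s≡ = trans (cong +_ (N.m≡m%n+[m/n]*n s k)) (trans (Z.pos-+ (s % k) _) (cong (λ t → + (s % k) ℤ.+ t) (Z.pos-* (s / k) k)))
  ... | no ¬p = + (s % k) ℤ.- + k , 1ℤ ℤ.+ + (s / k) , s≡ , bound
    where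
    identity : ∀ r d k → r ℤ.+ d ℤ.* k ≡ r ℤ.- k ℤ.+ (1ℤ ℤ.+ d) ℤ.* k
    identity = solve-∀
    s≡ : + s ≡ + (s % k) ℤ.- + k ℤ.+ (1ℤ ℤ.+ + (s / k)) ℤ.* + k
    s≡ = trans (cong +_ (N.m≡m%n+[m/n]*n s k)) (trans
        (trans (Z.pos-+ (s % k) _) (cong (λ t → + (s % k) ℤ.+ t) (Z.pos-* (s / k) k)))
      (identity (+ (s % k)) (+ (s / k)) (+ k)))
    r≤k : s % k ≤ k
    r≤k = N.<⇒≤ (N.m%n<n s k)
    ∣s'∣ : ∣ + (s % k) ℤ.- + k ∣ ≡ k ∸ s % k
    ∣s'∣ = trans (Z.∣i-j∣≡∣j-i∣ (+ (s % k)) (+ k)) (cong ∣_∣ (trans (Z.m-n≡m⊖n k (s % k)) (Z.⊖-≥ r≤k)))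
    bound : 2 * ∣ + (s % k) ℤ.- + k ∣ ≤ k
    bound = N.≤-trans (N.≤-reflexive (trans (cong (2 *_) ∣s'∣) (N.*-distribˡ-∸ 2 k (s % k))))
      (N.≤-trans (N.∸-monoʳ-≤ (2 * k) (N.<⇒≤ (N.≰⇒> ¬p)))
          (N.≤-reflexive (trans (cong (_∸ k) (cong (λ t → k + t) (N.+-identityʳ k))) (N.m+n∸n≡m k k))))

  form≡0⇒ : ∀ x y → form 1 D x y ≡ 0 → x ≡ 0 × y ≡ 0
  form≡0⇒ zero    zero    _ = refl , refl
  form≡0⇒ zero    (suc y) eq = ⊥-elim (N.<⇒≢ (N.*-mono-≤ {1} {D} {1} {suc y * suc y} 0<D z<s) (sym eq))
  form≡0⇒ (suc x) y       ()

  multiple : ∀ x k x' j → + x ≡ x' ℤ.+ j ℤ.* + k → ∣ x' ∣ ≡ 0 → k ∣ x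
  multiple x k x' j x≡ ∣x'∣≡0 = Z.∣⇒∣ᵤ {+ k} {+ x} (Z.divides j (trans x≡
    (trans (cong (λ y → y ℤ.+ j ℤ.* + k) (Z.∣i∣≡0⇒i≡0 {x'} ∣x'∣≡0)) (Z.+-identityˡ (j ℤ.* + k)))))

  open NS.+-*-Solver

  -- The two representations serve different ends. That of kk', by the residues, starts the descent
  -- from a prime power; that of k'n, by the quotient, replaces k with the smaller k'.
  reduce : ∀ s t k n → 0 < k → form 1 D s t ≡ k * n → ∃[ k' ] (k' < k × (k' ≡ 0 → (k ∣ s) × (k ∣ t)) ×
    (∃[ x ] ∃[ y ] form 1 D x y ≡ k * k') × (∃[ x ] ∃[ y ] form 1 D x y ≡ k' * n))
  reduce s t k n 0<k eq with near s k 0<k | near t k 0<k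
  ... | s' , m , s≡ , 2s'≤k | t' , l , t≡ , 2t'≤k = from-quotient k∣
    where
    K = + k
    N' = Descent.norm (+ D) s' t'
    eqᵣ : Descent.norm (+ D) (s' ℤ.+ m ℤ.* K) (t' ℤ.+ l ℤ.* K) ≡ K ℤ.* + n
    eqᵣ = trans (sym (cong₂ (Descent.norm (+ D)) s≡ t≡))
        (trans (sym (+form 1 D (+ s) (+ t))) (trans (cong +_ eq) (Z.pos-* k n)))
    k∣ᶻ : K Z.∣ N'
    k∣ᶻ = Descent.residue-divisible (+ D) K (+ n) s' m t' l eqᵣ
    k∣ : k ∣ (form 1 D (∣ s' ∣) (∣ t' ∣))
    k∣ = Z.∣⇒∣ᵤ {K} {+ (form 1 D (∣ s' ∣) (∣ t' ∣))} (subst (K Z.∣_) (sym (+form 1 D s' t')) k∣ᶻ)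
    -- Four times the norm of the residues is at most (1 + D)k² ≤ 3k²; this is where D ≤ 2 enters.
    size : 4 * form 1 D ∣ s' ∣ ∣ t' ∣ < 4 * (k * k)
    size = begin-strict
      4 * form 1 D ∣ s' ∣ ∣ t' ∣
        ≡⟨ solve 3 (λ D a b → con 4 :* (con 1 :* (a :* a) :+ D :* (b :* b)) := (con 2 :* a) :* (con 2 :* a) :+ D :*
            ((con 2 :* b) :* (con 2 :* b))) refl D ∣ s' ∣ ∣ t' ∣ ⟩
      2 * ∣ s' ∣ * (2 * ∣ s' ∣) + D * (2 * ∣ t' ∣ * (2 * ∣ t' ∣))
        ≤⟨ N.+-mono-≤ (N.*-mono-≤ 2s'≤k 2s'≤k) (N.*-mono-≤ D≤2 (N.*-mono-≤ 2t'≤k 2t'≤k)) ⟩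
      k * k + 2 * (k * k)
        <⟨ N.m<n+m _ (N.*-mono-≤ 0<k 0<k) ⟩
      k * k + (k * k + 2 * (k * k))
        ≡⟨ solve 1 (λ a → a :+ (a :+ con 2 :* a) := con 4 :* a) refl (k * k) ⟩
      4 * (k * k) ∎
      where open N.≤-Reasoning
    both-divisible : form 1 D (∣ s' ∣) (∣ t' ∣) ≡ 0 → (k ∣ s) × (k ∣ t)
    both-divisible form≡0 with form≡0⇒ (∣ s' ∣) (∣ t' ∣) form≡0
    ... | s'≡0 , t'≡0 = multiple s k s' m s≡ s'≡0 , multiple t k t' l t≡ t'≡0
    from-quotient : k ∣ (form 1 D (∣ s' ∣) (∣ t' ∣)) → ∃[ k' ] (k' < k × (k' ≡ 0 → (k ∣ s) × (k ∣ t)) ×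
      (∃[ x ] ∃[ y ] form 1 D x y ≡ k * k') × (∃[ x ] ∃[ y ] form 1 D x y ≡ k' * n))
    from-quotient (divides k' k'-eq) = k'
      , N.*-cancelʳ-< k k' k (subst (_< k * k) k'-eq (N.*-cancelˡ-< 4 (form 1 D (∣ s' ∣) (∣ t' ∣)) (k * k) size))
      , (λ k'≡0 → both-divisible (trans k'-eq (cong (_* k) k'≡0)))
      , (∣ s' ∣ , ∣ t' ∣ , trans k'-eq (N.*-comm k' k))
      , (∣ A ∣ , ∣ B ∣ , Z.+-injective (trans (+form 1 D A B) (trans norm-AB (sym (Z.pos-* k' n)))))
      where
      A B : ℤ
      A = + k' ℤ.+ (m ℤ.* s' ℤ.+ + D ℤ.* (l ℤ.* t'))
      B = m ℤ.* t' ℤ.- l ℤ.* s'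
      N'≡ : N' ≡ K ℤ.* + k'
      N'≡ = trans (sym (+form 1 D s' t')) (trans (cong +_ (trans k'-eq (N.*-comm k' k))) (Z.pos-* k k'))
      norm-AB : Descent.norm (+ D) A B ≡ + k' ℤ.* + n
      norm-AB = Descent.norm-quotient (+ D) K (+ n) (+ k') s' m t' l ⦃ >-nonZero 0<k ⦄ eqᵣ N'≡

  Represented : ℕ → Set
  Represented p = ∃[ x ] ∃[ y ] form 1 D x y ≡ p

  -- If k divides both coordinates, then k² ∣ kp, so k ∣ p and k = 1.
  common-divisor : ∀ {p} → Prime p → ∀ k s t → 0 < k → k < p → form 1 D s t ≡ k * p → k ∣ s → k ∣ t → Represented p
  common-divisor {p} pr k s t 0<k k<p eq (divides S s≡) (divides T t≡) = by-divisor
      (prime⇒irreducible pr {k} (divides (S * S + D * (T * T)) p≡))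
    where
    p≡ : p ≡ (S * S + D * (T * T)) * k
    p≡ = N.*-cancelˡ-≡ p ((S * S + D * (T * T)) * k) k ⦃ >-nonZero 0<k ⦄ (trans (sym eq) (trans (cong₂ (form 1 D) s≡ t≡)
      (solve 4 (λ D S T k → con 1 :* ((S :* k) :* (S :* k)) :+ D :* ((T :* k) :* (T :* k)) := k :*
          ((S :* S :+ D :* (T :* T)) :* k)) refl D S T k)))
    by-divisor : k ≡ 1 ⊎ k ≡ p → Represented p
    by-divisor (inj₂ k≡p) = ⊥-elim (N.<⇒≢ k<p k≡p)
    by-divisor (inj₁ k≡1) = s , t , trans eq (trans (cong (_* p) k≡1) (N.*-identityˡ p))

  descend : ∀ {p} → Prime p → ∀ fuel k s t → k < fuel → 0 < k → k < p → form 1 D s t ≡ k * p → Represented p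
  descend {p} pr (suc fuel) k s t (s≤s k≤fuel) 0<k k<p eq = continue (reduce s t k p 0<k eq)
    where
    continue : ∃[ k' ] (k' < k × (k' ≡ 0 → (k ∣ s) × (k ∣ t)) ×
      (∃[ x ] ∃[ y ] form 1 D x y ≡ k * k') × (∃[ x ] ∃[ y ] form 1 D x y ≡ k' * p)) → Represented p
    continue (suc k' , k'<k , _ , _ , x , y , eq') = descend pr fuel (suc k') x y (N.<-≤-trans k'<k k≤fuel) z<s
        (N.<-trans k'<k k<p) eq'
    continue (zero , _ , k∣ , _) = common-divisor pr k s t 0<k k<p eq (proj₁ (k∣ refl)) (proj₂ (k∣ refl))

  -- Residues modulo p turn a representation of a power of p into one of kp with k < p, and k ≠ 0
  -- because p does not divide s. From there the usual descent applies.
  represents : ∀ {p} → Prime p → ∀ s t z → form 1 D s t ≡ p ^ suc z → ¬ p ∣ s → Represented p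
  represents {p} pr s t z eq p∤s = continue (reduce s t p (p ^ z) (prime>0 pr) eq)
    where
    continue : ∃[ k' ] (k' < p × (k' ≡ 0 → (p ∣ s) × (p ∣ t)) ×
      (∃[ x ] ∃[ y ] form 1 D x y ≡ p * k') × (∃[ x ] ∃[ y ] form 1 D x y ≡ k' * p ^ z)) → Represented p
    continue (zero , _ , p∣ , _) = ⊥-elim (p∤s (proj₁ (p∣ refl)))
    continue (suc k , k<p , _ , (x , y , eq') , _) = descend pr (suc (suc k)) (suc k) x y N.≤-refl z<s k<p
        (trans eq' (N.*-comm p (suc k)))

-- Forms of class number one.

-- Modulo 5 the sequence R has period 2 when q ≡ 2.
module Mod5 (n : ℤ) where
  open import Data.Integer hiding (suc; sign)
  open import Data.Nat as ℕ using ()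
  open Powers using (R; P)

  q : ℤ
  q = + 2 + + 5 * n

  One : ℤ → Set
  One i = ∃[ x ] i ≡ 1ℤ + + 5 * x

  -- Modulo 5 the pair (R, P) alternates between (1, 1) and (-2, 0).
  even-step : ∀ {r p} → One r → One p →
    let r' = q * r - + 4 * p ; p' = q * (r + p) - + 4 * p in
    One (q * r' - + 4 * p') × One (q * (r' + p') - + 4 * p')
  even-step {r} {p} (x , refl) (y , refl) =
    (q * (n * r + + 2 * x - + 4 * y) - + 2 * n - 1ℤ - + 4 * (n * (r + p) + + 2 * x - + 2 * y) , id₁ n x y) ,
    (q * (n * r + + 2 * x - + 4 * y) - + 2 * n - 1ℤ + (q - + 4) * (n * (r + p) + + 2 * x - + 2 * y) , id₂ n x y)
    where
    id₁ : ∀ n x y → let q = + 2 + + 5 * n ; r = 1ℤ + + 5 * x ; p = 1ℤ + + 5 * y in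
      q * (q * r - + 4 * p) - + 4 * (q * (r + p) - + 4 * p)
      ≡ 1ℤ + + 5 * (q * (n * r + + 2 * x - + 4 * y) - + 2 * n - 1ℤ
          - + 4 * (n * (r + p) + + 2 * x - + 2 * y))
    id₁ = solve-∀
    id₂ : ∀ n x y → let q = + 2 + + 5 * n ; r = 1ℤ + + 5 * x ; p = 1ℤ + + 5 * y in
      q * (q * r - + 4 * p + (q * (r + p) - + 4 * p)) - + 4 * (q * (r + p) - + 4 * p)
      ≡ 1ℤ + + 5 * (q * (n * r + + 2 * x - + 4 * y) - + 2 * n - 1ℤ
          + (q - + 4) * (n * (r + p) + + 2 * x - + 2 * y))
    id₂ = solve-∀

  even-case : ∀ g → One (R q (+ 4) (g ℕ.+ g)) × One (P q (+ 4) (g ℕ.+ g))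
  even-case zero    = (0ℤ , refl) , (0ℤ , refl)
  even-case (suc g) = subst (λ m → One (R q (+ 4) m) × One (P q (+ 4) m)) (cong suc (sym (N.+-suc g g)))
    (even-step (proj₁ (even-case g)) (proj₂ (even-case g)))

  odd-case : ∀ {r p} → One r → One p → ∃[ x ] q * r - + 4 * p ≡ + 5 * x - + 2
  odd-case (x , refl) (y , refl) = n * (1ℤ + + 5 * x) + + 2 * x - + 4 * y , identity n x y
    where
    identity : ∀ n x y → (+ 2 + + 5 * n) * (1ℤ + + 5 * x) - + 4 * (1ℤ + + 5 * y)
      ≡ + 5 * (n * (1ℤ + + 5 * x) + + 2 * x - + 4 * y) - + 2
    identity = solve-∀

-- The forms 2X² + Y² and 4X² + Y², for which every prime power represented comes from a representation of the prime.
module ClassNumberOne where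
  open import Data.Nat
  open import Data.Integer as ℤ using (+_; ∣_∣)
  open PrimePowers
  open AbsoluteValues
  open Powers using (R; S)
  open TrivialPowers
  open Representations
  open Uniqueness

  module _ {c : ℕ} (pc : Prime c) (c≢2 : c ≢ 2) where

    -- `Q` is oddness, because √-1 has exponent 0 in this form. The generator has exponent 1, so its
    -- minimality is vacuous.
    odd-powers : ∀ ε → 0 < ε → ∀ u v → form (2 ^ ε) 1 u v ≡ c → ∀ X Y k → form (2 ^ ε) 1 X Y ≡ c ^ suc (k + k) → ¬ c ∣ Y →
      ∃[ h ] (X ≡ u * ∣ R (+ c) (+ (4 * (v * v))) h ∣ × Y ≡ v * ∣ S (+ c) (+ (4 * (v * v))) h ∣)
    odd-powers ε 0<ε u v norm-uv X Y k norm-XY c∤Y = convert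
      (Rp.powers u v 1 (trans norm-uv (sym (trans (N.*-identityˡ _) (N.*-identityʳ c)))) z<s c∤v
        (λ k X Y 0<k k<1 _ → N.<⇒≱ k<1 0<k) (λ z → ∃[ k ] z ≡ suc (k + k)) odd-step (λ ())
        X Y (suc (k + k)) z<s (trans norm-XY (sym (N.*-identityˡ _))) c∤Y (k , refl))
      where
      e : ℕ
      e = 2 ^ ε
      c∤e : ¬ c ∣ e
      c∤e = ∤^ pc prime[2] c≢2 ε
      module Rp = Rep c pc e 1 2 0 refl c∤e (prime∤1 pc) (λ c∣2 → c≢2 (prime∣prime⇒≡ pc prime[2] c∣2))
        (N.<-≤-trans (prime^≥ prime[2] 0<ε) (N.≤-reflexive (sym (N.*-identityʳ e)))) (trivial-difference c)
      odd-step : ∀ z → (∃[ k ] 2 + z ≡ suc (k + k)) → ∃[ k ] z ≡ suc (k + k)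
      odd-step z (suc k , eq) = k , N.suc-injective (N.suc-injective (trans eq (cong (λ t → suc (suc t)) (N.+-suc k k))))
      c∣u : c ∣ v → c ∣ u
      c∣u c∣v with euclidsLemma e (u * u) pc (N.∣m+n∣m⇒∣n (subst (c ∣_) (trans (sym norm-uv) (N.+-comm (e * (u * u)) _)) N.∣-refl) (N.∣n⇒∣m*n 1 (N.∣m⇒∣m*n v c∣v)))
      ... | inj₁ c∣e = ⊥-elim (c∤e c∣e)
      ... | inj₂ p = prime∣^⇒∣ pc 2 (subst (c ∣_) (cong (u *_) (sym (N.*-identityʳ u))) p)
      c∤v : ¬ c ∣ v
      c∤v c∣v = N.<⇒≱ (N.m<m*n c c ⦃ prime⇒nonZero pc ⦄ (prime>1 pc)) (N.∣⇒≤ ⦃ prime⇒nonZero pc ⦄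
        (subst (c * c ∣_) norm-uv (N.∣m∣n⇒∣m+n (N.∣n⇒∣m*n e (N.*-pres-∣ (c∣u c∣v) (c∣u c∣v)))
            (N.∣n⇒∣m*n 1 (N.*-pres-∣ c∣v c∣v)))))
      convert : ∃[ h ] (X ≡ u * ∣ R (+ (c ^ 1)) (+ (4 * (1 * (v * v)))) h ∣ × Y ≡ v * ∣ S (+ (c ^ 1))
          (+ (4 * (1 * (v * v)))) h ∣) →
        ∃[ h ] (X ≡ u * ∣ R (+ c) (+ (4 * (v * v))) h ∣ × Y ≡ v * ∣ S (+ c) (+ (4 * (v * v))) h ∣)
      convert = subst₂ (λ q w → ∃[ h ] (X ≡ u * ∣ R (+ q) (+ (4 * w)) h ∣ × Y ≡ v * ∣ S (+ q) (+ (4 * w)) h ∣))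
          (N.*-identityʳ c) (N.*-identityˡ (v * v))

    2∤c : ¬ 2 ∣ c
    2∤c 2∣c = c≢2 (sym (prime∣prime⇒≡ prime[2] pc 2∣c))

    -- v divides a power of b. If b ∣ v, `no-odd-power` applies with w = v² and the element is α
    -- itself, so k = 0. If v = 1, then ω = 4 is prime to b and `no-odd-power` is silent; this case
    -- is handed back to be refuted by other means.
    exponent-one : ∀ ε → 0 < ε → ∀ u v → form (2 ^ ε) 1 u v ≡ c → ∀ {b} → Prime b → b ≢ 2 → c ≢ b → ∀ i j k →
      form (2 ^ ε) 1 (2 ^ i) (b ^ j) ≡ c ^ suc (k + k) →
      k ≡ 0 ⊎ (v ≡ 1 × u ≡ 2 ^ i × ∃[ h ] (∣ R (+ c) (+ 4) h ∣ ≡ 1 × ∣ S (+ c) (+ 4) h ∣ ≡ b ^ j))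
    exponent-one ε 0<ε u v norm-uv {b} pb b≢2 c≢b i j k eq =
      by-power (odd-powers ε 0<ε u v norm-uv (2 ^ i) (b ^ j) k eq (∤^ pc pb c≢b j))
      where
      by-power : ∃[ h ] (2 ^ i ≡ u * ∣ R (+ c) (+ (4 * (v * v))) h ∣ × b ^ j ≡ v * ∣ S (+ c) (+ (4 * (v * v))) h ∣) →
        k ≡ 0 ⊎ (v ≡ 1 × u ≡ 2 ^ i × ∃[ h ] (∣ R (+ c) (+ 4) h ∣ ≡ 1 × ∣ S (+ c) (+ 4) h ∣ ≡ b ^ j))
      by-power (h , eqX , eqY) with power-product {m = u} {s = i} prime[2] (sym eqX) | power-product {m = v} {s = j} pb (sym eqY)
      ... | t , t' , u≡ , R≡ | zero , s' , refl , S≡ = inj₂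
          (refl , trans (sym (trans (cong (u *_) R≡1) (N.*-identityʳ u))) (sym eqX) ,
              h , R≡1 , trans (sym (N.*-identityˡ _)) (sym eqY))
        where
        R≡1 : ∣ R (+ c) (+ 4) h ∣ ≡ 1
        R≡1 = R-unit c 1 h t' 2∤c R≡
      ... | t , t' , refl , R≡ | s@(suc _) , s' , refl , S≡ = inj₁
          (double-injective {k} {0} (N.suc-injective (^-injectiveʳ (prime>1 pc) {suc (k + k)} {1}
              (trans (sym eq) (trans (cong₂ (form (2 ^ ε) 1) X≡u Y≡v) (trans norm-uv (sym (N.*-identityʳ c))))))))
        where
        w≡ : b ^ s * b ^ s ≡ b ^ (s + s)
        w≡ = sym (N.^-distribˡ-+-* b s s)
        q≡ : c ≡ 2 ^ (ε + (t + t)) + b ^ (s + s)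
        q≡ = trans (sym norm-uv) (cong₂ _+_ (^-square 2 ε t) (trans (N.*-identityˡ _) w≡))
        h≡0 : h ≡ 0
        h≡0 = no-odd-power pb b≢2 (ε + (t + t)) (s + s) (N.<-≤-trans 0<ε (N.m≤m+n ε _)) z<s h s'
          (subst₂ (λ q w → ∣ R (+ q) (+ (4 * w)) h ∣ ≡ 1) q≡ w≡ (R-unit c (b ^ s * b ^ s) h t' 2∤c R≡))
          (subst₂ (λ q w → ∣ S (+ q) (+ (4 * w)) h ∣ ≡ b ^ s') q≡ w≡ S≡)
        X≡u : 2 ^ i ≡ 2 ^ t
        X≡u = trans eqX (trans (cong (λ h → 2 ^ t * ∣ R (+ c) (+ (4 * (b ^ s * b ^ s))) h ∣) h≡0) (N.*-identityʳ (2 ^ t)))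
        Y≡v : b ^ j ≡ b ^ s
        Y≡v = trans eqY (trans (cong (λ h → b ^ s * ∣ S (+ c) (+ (4 * (b ^ s * b ^ s))) h ∣) h≡0) (N.*-identityʳ (b ^ s)))

  0<b^⇒≢1 : ∀ {b} → Prime b → ∀ j → 0 < j → b ^ j ≢ 1
  0<b^⇒≢1 pb j 0<j eq = N.<⇒≢ (N.<-≤-trans (prime>1 pb) (prime^≥ pb 0<j)) (sym eq)

  -- The representation used is 3 = 2·1² + 1².
  base-three : ∀ {b} → Prime b → b ≢ 2 → b ≢ 3 → ∀ j k → 2 + b ^ (suc j + suc j) ≡ 3 ^ suc (k + k) → b ≡ 5
  base-three {b} pb b≢2 b≢3 j k eq =
    [ k≢0 , by-h ]′ (exponent-one pr3 (λ ()) 1 z<s 1 1 refl pb b≢2 (λ e → b≢3 (sym e)) 0 (suc j) k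
      (trans (cong (λ t → 2 + t) (trans (N.*-identityˡ _) (sym (N.^-distribˡ-+-* b (suc j) (suc j))))) eq))
    where
    pr3 = from-yes (prime? 3)
    k≢0 : k ≡ 0 → b ≡ 5
    k≢0 refl = ⊥-elim (0<b^⇒≢1 pb (suc j + suc j) z<s (N.+-cancelˡ-≡ 2 _ 1 eq))
    by-h : 1 ≡ 1 × 1 ≡ 1 × ∃[ h ] (∣ R (+ 3) (+ 4) h ∣ ≡ 1 × ∣ S (+ 3) (+ 4) h ∣ ≡ b ^ suc j) → b ≡ 5
    by-h (_ , _ , h , R≡1 , S≡) with odd⊎even h
    -- Even h is compared with R_0 = 1, odd h with R_1 = -1; the latter brings in S_1 = 5.
    ... | g , inj₁ refl with TwoAdic.same-class⇒≡ 1ℤ 0 g refl (subst (λ h → ∣ R (+ 3) (+ 4) h ∣ ≡ 1) (sym (N.+-identityʳ (g + g))) R≡1)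
    ... | refl = ⊥-elim (0<b^⇒≢1 pb (suc j) z<s (sym S≡))
    by-h (_ , _ , h , R≡1 , S≡) | g , inj₂ refl with TwoAdic.same-class⇒≡ 1ℤ 1 g refl (subst (λ h → ∣ R (+ 3) (+ 4) h ∣ ≡ 1) (N.+-comm 1 (g + g)) R≡1)
    ... | refl = prime∣prime⇒≡ pb (from-yes (prime? 5)) (subst (b ∣_) (sym S≡) (N.m∣m*n (b ^ j)))

  -- Fermat's descent gives c = x² + 2y²; the leftover case of `exponent-one` would mean x = y = 1,
  -- that is c = 3.
  two-plus-9^ : ∀ {c} → Prime c → c ≢ 2 → c ≢ 3 → ∀ j k → 2 + 3 ^ (suc j + suc j) ≡ c ^ suc (k + k) → k ≡ 0
  two-plus-9^ {c} pc c≢2 c≢3 j k eq = from-representation (represents pc (3 ^ suc j) 1 (k + k) norm c∤3^)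
    where
    open FermatDescent 2 z<s N.≤-refl using (represents)
    c∤3^ : ¬ c ∣ 3 ^ suc j
    c∤3^ = ∤^ pc (from-yes (prime? 3)) c≢3 (suc j)
    norm : form 1 2 (3 ^ suc j) 1 ≡ c ^ suc (k + k)
    norm = trans (N.+-comm (1 * (3 ^ suc j * 3 ^ suc j)) 2)
        (trans (cong (λ t → 2 + t) (trans (N.*-identityˡ _) (sym (N.^-distribˡ-+-* 3 (suc j) (suc j))))) eq)
    from-representation : ∃[ x ] ∃[ y ] form 1 2 x y ≡ c → k ≡ 0
    from-representation (x , y , xy) = [ (λ k≡0 → k≡0) , impossible ]′ (exponent-one pc c≢2 1 z<s y x
        (trans (N.+-comm (2 * (y * y)) (1 * (x * x))) xy) (from-yes (prime? 3)) (λ ()) c≢3 0 (suc j) k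
        (trans (cong (λ t → 2 + t) (trans (N.*-identityˡ _) (sym (N.^-distribˡ-+-* 3 (suc j) (suc j))))) eq))
      where
      impossible : x ≡ 1 × y ≡ 1 × _ → k ≡ 0
      impossible (refl , refl , _) = ⊥-elim (c≢3 (sym xy))

  R-mod-5 : ∀ n g → ∃[ x ] R (+ 2 ℤ.+ + 5 ℤ.* n) (+ 4) (suc (g + g)) ≡ + 5 ℤ.* x ℤ.- + 2
  R-mod-5 n g = odd-case (proj₁ (even-case g)) (proj₂ (even-case g))
    where open Mod5 n

  ∣R∣≢1-mod-5 : ∀ n g → ∣ R (+ 2 ℤ.+ + 5 ℤ.* n) (+ 4) (suc (g + g)) ∣ ≢ 1
  ∣R∣≢1-mod-5 n g R≡1 with R-mod-5 n g | OddIntegers.∣i∣≡1⇒ _ R≡1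
  ... | x , eq | inj₁ e = from-no (5 ∣? 3) (Z.∣⇒∣ᵤ {+ 5} {+ 3}
      (Z.divides x (trans (cong (ℤ._+ + 2) (trans (sym e) eq)) (identity x))))
    where
    identity : ∀ x → + 5 ℤ.* x ℤ.- + 2 ℤ.+ + 2 ≡ x ℤ.* + 5
    identity = solve-∀
  ... | x , eq | inj₂ e = from-no (5 ∣? 1) (Z.∣⇒∣ᵤ {+ 5} {+ 1}
      (Z.divides x (trans (cong (ℤ._+ + 2) (trans (sym e) eq)) (identity x))))
    where
    identity : ∀ x → + 5 ℤ.* x ℤ.- + 2 ℤ.+ + 2 ≡ x ℤ.* + 5
    identity = solve-∀

  open NS.+-*-Solver

  4^even : ∀ m → ∃[ a ] 2 ^ (m + m) * 2 ^ (m + m) ≡ 1 + 5 * a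
  4^even zero = 0 , refl
  4^even (suc m) rewrite N.+-suc m m with 4^even m
  ... | a , eq = 3 + 16 * a , trans (solve 1 (λ t → (con 2 :* (con 2 :* t)) :* (con 2 :* (con 2 :* t)) := con 16 :*
      (t :* t)) refl (2 ^ (m + m)))
      (trans (cong (16 *_) eq) (solve 1 (λ a → con 16 :* (con 1 :+ con 5 :* a) := con 1 :+ con 5 :*
          (con 3 :+ con 16 :* a)) refl a))

  double-square : ∀ u y → form (2 ^ 2) 1 u y ≡ form 1 1 (u + u) y
  double-square u y = cong (_+ 1 * (y * y)) (solve 1 (λ u → con 4 :* (u :* u) := con 1 :* ((u :+ u) :* (u :+ u))) refl u)

  odd-squares : ∀ m n → 2 ∣ form 1 1 (suc (m + m)) (suc (n + n))
  odd-squares m n = divides (1 + 2 * m + 2 * (m * m) + 2 * n + 2 * (n * n))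
    (solve 2 (λ m n → con 1 :* ((con 1 :+ (m :+ m)) :* (con 1 :+ (m :+ m))) :+ con 1 :*
        ((con 1 :+ (n :+ n)) :* (con 1 :+ (n :+ n)))
      := (con 1 :+ con 2 :* m :+ con 2 :* (m :* m) :+ con 2 :* n :+ con 2 :* (n :* n)) :* con 2) refl m n)

  -- c is a sum of two squares, exactly one of them even, so c = 4u² + y². The leftover case y = 1
  -- has c = 4^(i+1) + 1. The 2-adic estimate reduces even h to h = 0. For odd h, either c ≡ 2
  -- modulo 5, where R is never ±1, or 5 ∣ c; then c = 5, h = 1 and S = 11.
  square-plus-square : ∀ {b c} → Prime b → Prime c → b ≢ 2 → c ≢ 2 → c ≢ b → ∀ i j k →
    2 ^ (2 + (i + i)) + b ^ (suc j + suc j) ≡ c ^ suc (k + k) → k ≡ 0 ⊎ (b ≡ 11 × c ≡ 5)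
  square-plus-square {b} {c} pb pc b≢2 c≢2 c≢b i j k eq = from-representation
      (represents pc (b ^ suc j) (2 ^ suc i) (k + k) norm (∤^ pc pb c≢b (suc j)))
    where
    open FermatDescent 1 z<s z<s using (represents)
    b²≡ : 1 * (b ^ suc j * b ^ suc j) ≡ b ^ (suc j + suc j)
    b²≡ = trans (N.*-identityˡ _) (sym (N.^-distribˡ-+-* b (suc j) (suc j)))
    norm : form 1 1 (b ^ suc j) (2 ^ suc i) ≡ c ^ suc (k + k)
    norm = trans (N.+-comm _ (1 * (2 ^ suc i * 2 ^ suc i))) (trans (cong₂ _+_ (trans
      (solve 1 (λ t → con 1 :* ((con 2 :* t) :* (con 2 :* t)) := con 4 :* (t :* t)) refl (2 ^ i)) (^-square 2 2 i)) b²≡) eq)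
    norm' : form (2 ^ 2) 1 (2 ^ i) (b ^ suc j) ≡ c ^ suc (k + k)
    norm' = trans (cong₂ _+_ (^-square 2 2 i) b²≡) eq
    exceptional-case : c ≡ 4 * (2 ^ i * 2 ^ i) + 1 →
        (∃[ h ] (∣ R (+ c) (+ 4) h ∣ ≡ 1 × ∣ S (+ c) (+ 4) h ∣ ≡ b ^ suc j)) → b ≡ 11 × c ≡ 5
    exceptional-case c≡ (h , R≡1 , S≡) = by-parity (odd⊎even h) (odd⊎even i)
      where
      E₀ : ℤ
      E₀ = + (2 * (2 ^ i * 2 ^ i))
      q≡ : + c ≡ TwoAdic.q E₀
      q≡ = trans (cong +_ (trans c≡ (cong (_+ 1) (solve 1 (λ t → con 4 :* t := con 2 :* (con 2 :* t)) refl
          (2 ^ i * 2 ^ i)))))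
        (trans (Z.pos-+ (2 * (2 * (2 ^ i * 2 ^ i))) 1) (cong (ℤ._+ 1ℤ) (Z.pos-* 2 (2 * (2 ^ i * 2 ^ i)))))
      same-class : ∀ h₀ g → h ≡ g + g + h₀ → ∣ R (+ c) (+ 4) h₀ ∣ ≡ 1 → g ≡ 0
      same-class h₀ g h≡ R₀≡1 = TwoAdic.same-class⇒≡ E₀ h₀ g (subst (λ q → ∣ R q (+ 4) h₀ ∣ ≡ 1) q≡ R₀≡1)
        (subst₂ (λ q h → ∣ R q (+ 4) h ∣ ≡ 1) q≡ h≡ R≡1)
      by-parity : ∃[ g ] (h ≡ g + g ⊎ h ≡ suc (g + g)) → ∃[ m ] (i ≡ m + m ⊎ i ≡ suc (m + m)) → b ≡ 11 × c ≡ 5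
      by-parity (g , inj₁ h≡) _ = ⊥-elim (0<b^⇒≢1 pb (suc j) z<s
          (sym (trans (cong (λ h → ∣ S (+ c) (+ 4) h ∣) (sym h≡0)) S≡)))
        where
        h≡0 : h ≡ 0
        h≡0 = trans h≡ (cong (λ g → g + g) (same-class 0 g (trans h≡ (sym (N.+-identityʳ (g + g)))) refl))
      by-parity (g , inj₂ h≡) (m , inj₂ i≡) = ⊥-elim
          (∣R∣≢1-mod-5 (+ (3 + 16 * a)) g (subst₂ (λ q h → ∣ R q (+ 4) h ∣ ≡ 1) c-mod-5 h≡ R≡1))
        where
        a = proj₁ (4^even m)
        c-mod-5 : + c ≡ + 2 ℤ.+ + 5 ℤ.* + (3 + 16 * a)
        c-mod-5 = trans (cong +_ (trans c≡ (trans (cong (λ i → 4 * (2 ^ i * 2 ^ i) + 1) i≡)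
          (trans (solve 1 (λ t → con 4 :* ((con 2 :* t) :* (con 2 :* t)) :+ con 1 := con 16 :* (t :* t) :+ con 1) refl
              (2 ^ (m + m)))
          (trans (cong (λ t → 16 * t + 1) (proj₂ (4^even m)))
              (solve 1 (λ a → con 16 :* (con 1 :+ con 5 :* a) :+ con 1 := con 2 :+ con 5 :* (con 3 :+ con 16 :* a)) refl
              a))))))
          (trans (Z.pos-+ 2 (5 * (3 + 16 * a))) (cong (λ t → + 2 ℤ.+ t) (Z.pos-* 5 (3 + 16 * a))))
      by-parity (g , inj₂ h≡) (m , inj₁ i≡) = prime∣prime⇒≡ pb (from-yes (prime? 11)) b∣11 , sym 5≡c
        where
        a = proj₁ (4^even m)
        5∣c : 5 ∣ c
        5∣c = divides (1 + 4 * a) (trans c≡ (trans (cong (λ i → 4 * (2 ^ i * 2 ^ i) + 1) i≡)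
          (trans (cong (λ t → 4 * t + 1) (proj₂ (4^even m)))
              (solve 1 (λ a → con 4 :* (con 1 :+ con 5 :* a) :+ con 1 := (con 1 :+ con 4 :* a) :* con 5) refl a))))
        5≡c : 5 ≡ c
        5≡c = prime∣prime⇒≡ (from-yes (prime? 5)) pc 5∣c
        g≡0 : g ≡ 0
        g≡0 = same-class 1 g (trans h≡ (N.+-comm 1 (g + g))) (subst (λ c → ∣ R (+ c) (+ 4) 1 ∣ ≡ 1) 5≡c refl)
        b∣11 : b ∣ 11
        b∣11 = subst (b ∣_) (sym (trans (cong₂ (λ c h → ∣ S (+ c) (+ 4) h ∣) 5≡c
            (sym (trans h≡ (cong (λ g → suc (g + g)) g≡0)))) S≡)) (N.m∣m*n (b ^ j))
    even-square : ∀ u y → form (2 ^ 2) 1 u y ≡ c → k ≡ 0 ⊎ (b ≡ 11 × c ≡ 5)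
    even-square u y norm-uy = by-exponent (exponent-one pc c≢2 2 z<s u y norm-uy pb b≢2 c≢b i (suc j) k norm')
      where
      by-exponent : k ≡ 0 ⊎ (y ≡ 1 × u ≡ 2 ^ i × ∃[ h ] (∣ R (+ c) (+ 4) h ∣ ≡ 1 × ∣ S (+ c) (+ 4) h ∣ ≡ b ^ suc j)) → k ≡
          0 ⊎ (b ≡ 11 × c ≡ 5)
      by-exponent (inj₁ k≡0) = inj₁ k≡0
      by-exponent (inj₂ (y≡1 , u≡ , h)) = inj₂ (exceptional-case
          (trans (sym norm-uy) (cong₂ (λ u y → 4 * (u * u) + 1 * (y * y)) u≡ y≡1)) h)
    from-parity : ∀ x y → form 1 1 x y ≡ c → ∃[ u ] (x ≡ u + u ⊎ x ≡ suc (u + u)) → ∃[ u ] (y ≡ u + u ⊎ y ≡ suc (u + u)) →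
        k ≡ 0 ⊎ (b ≡ 11 × c ≡ 5)
    from-parity x y xy (u , inj₁ x≡) _ = even-square u y
        (trans (double-square u y) (trans (cong (λ x → form 1 1 x y) (sym x≡)) xy))
    from-parity x y xy _ (u , inj₁ y≡) = even-square u x
        (trans (double-square u x) (trans (cong (λ y → form 1 1 y x) (sym y≡))
        (trans (N.+-comm (1 * (y * y)) (1 * (x * x))) xy)))
    from-parity x y xy (m , inj₂ x≡) (n , inj₂ y≡) = ⊥-elim
        (2∤c pc c≢2 (subst (2 ∣_) (trans (cong₂ (form 1 1) (sym x≡) (sym y≡)) xy) (odd-squares m n)))
    from-representation : ∃[ x ] ∃[ y ] form 1 1 x y ≡ c → k ≡ 0 ⊎ (b ≡ 11 × c ≡ 5)
    from-representation (x , y , xy) = from-parity x y xy (odd⊎even x) (odd⊎even y)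

-- Residues of powers.

module Residues where
  open import Data.Nat
  open PrimePowers

  %-+ : ∀ m .⦃ _ : NonZero m ⦄ {X Y Z α β} → X + Y ≡ Z → X % m ≡ α → Y % m ≡ β → Z % m ≡ (α + β) % m
  %-+ m {X} {Y} refl refl refl = N.%-distribˡ-+ X Y m

  %-* : ∀ m .⦃ _ : NonZero m ⦄ {X X' Y Y'} → X % m ≡ X' % m → Y % m ≡ Y' % m → (X * Y) % m ≡ (X' * Y') % m
  %-* m {X} {X'} {Y} {Y'} eq eq' = trans (N.%-distribˡ-* X Y m)
      (trans (cong₂ (λ a b → (a * b) % m) eq eq') (sym (N.%-distribˡ-* X' Y' m)))

  %-^ : ∀ m .⦃ _ : NonZero m ⦄ {X X'} → X % m ≡ X' % m → ∀ k → (X ^ k) % m ≡ (X' ^ k) % m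
  %-^ m eq zero    = refl
  %-^ m eq (suc k) = %-* m eq (%-^ m eq k)

  module _ (m : ℕ) .⦃ _ : NonZero m ⦄ {a : ℕ} (a²≡1 : (a * a) % m ≡ 1 % m) where
    even-power : ∀ k → (a ^ (k + k)) % m ≡ 1 % m
    even-power k = trans (cong (_% m) (trans (N.^-distribˡ-+-* a k k) (sym (square-^ k))))
        (trans (%-^ m a²≡1 k) (cong (_% m) (N.^-zeroˡ k)))
      where
      square-^ : ∀ k → (a * a) ^ k ≡ a ^ k * a ^ k
      square-^ zero = refl
      square-^ (suc k) = trans (cong (a * a *_) (square-^ k))
          (solve 2 (λ a x → a :* a :* (x :* x) := a :* x :* (a :* x)) refl a (a ^ k))
        where open NS.+-*-Solver

    odd-power : ∀ k → (a ^ suc (k + k)) % m ≡ a % m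
    odd-power k = trans (%-* m {a} {a} refl (even-power k)) (cong (_% m) (N.*-identityʳ a))

  ∤⇒%≢0 : ∀ p .⦃ _ : NonZero p ⦄ a → ¬ p ∣ a → a % p ≢ 0
  ∤⇒%≢0 p a p∤a eq = p∤a (N.m%n≡0⇒n∣m a p eq)

  residue-3 : ∀ a → ¬ 3 ∣ a → a % 3 ≡ 1 ⊎ a % 3 ≡ 2
  residue-3 a 3∤a with a % 3 | N.m%n<n a 3 | ∤⇒%≢0 3 a 3∤a
  ... | 0 | _ | ≢0 = ⊥-elim (≢0 refl)
  ... | 1 | _ | _  = inj₁ refl
  ... | 2 | _ | _  = inj₂ refl
  ... | suc (suc (suc _)) | s≤s (s≤s (s≤s ())) | _

  square-3 : ∀ a → ¬ 3 ∣ a → (a * a) % 3 ≡ 1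
  square-3 a 3∤a with residue-3 a 3∤a
  ... | inj₁ eq = trans (N.%-distribˡ-* a a 3) (cong (λ r → (r * r) % 3) eq)
  ... | inj₂ eq = trans (N.%-distribˡ-* a a 3) (cong (λ r → (r * r) % 3) eq)

  odd-residue-8 : ∀ a → ¬ 2 ∣ a → ∃[ r ] (a % 8 ≡ r × (r ≡ 1 ⊎ r ≡ 3 ⊎ r ≡ 5 ⊎ r ≡ 7))
  odd-residue-8 a 2∤a = a % 8 , refl , by-residue (a % 8) refl (N.m%n<n a 8)
    where
    even : ∀ r → 2 ∣ r → a % 8 ≡ r → ⊥
    even r 2∣r eq = 2∤a (subst (2 ∣_) (sym (trans (N.m≡m%n+[m/n]*n a 8) (cong (_+ a / 8 * 8) eq)))
      (N.∣m∣n⇒∣m+n 2∣r (N.∣n⇒∣m*n (a / 8) (divides 4 refl))))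
    by-residue : ∀ r → a % 8 ≡ r → r < 8 → r ≡ 1 ⊎ r ≡ 3 ⊎ r ≡ 5 ⊎ r ≡ 7
    by-residue 0 eq _ = ⊥-elim (even 0 (divides 0 refl) eq)
    by-residue 1 eq _ = inj₁ refl
    by-residue 2 eq _ = ⊥-elim (even 2 (divides 1 refl) eq)
    by-residue 3 eq _ = inj₂ (inj₁ refl)
    by-residue 4 eq _ = ⊥-elim (even 4 (divides 2 refl) eq)
    by-residue 5 eq _ = inj₂ (inj₂ (inj₁ refl))
    by-residue 6 eq _ = ⊥-elim (even 6 (divides 3 refl) eq)
    by-residue 7 eq _ = inj₂ (inj₂ (inj₂ refl))
    by-residue (suc (suc (suc (suc (suc (suc (suc (suc r)))))))) _ lt = ⊥-elim (N.<⇒≱ lt (N.m≤m+n 8 r))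

  square-8 : ∀ a → ¬ 2 ∣ a → (a * a) % 8 ≡ 1
  square-8 a 2∤a with odd-residue-8 a 2∤a
  ... | _ , eq , inj₁ refl                 = trans (N.%-distribˡ-* a a 8) (cong (λ r → (r * r) % 8) eq)
  ... | _ , eq , inj₂ (inj₁ refl)          = trans (N.%-distribˡ-* a a 8) (cong (λ r → (r * r) % 8) eq)
  ... | _ , eq , inj₂ (inj₂ (inj₁ refl))   = trans (N.%-distribˡ-* a a 8) (cong (λ r → (r * r) % 8) eq)
  ... | _ , eq , inj₂ (inj₂ (inj₂ refl))   = trans (N.%-distribˡ-* a a 8) (cong (λ r → (r * r) % 8) eq)

  %8⇒%4 : ∀ {a r} → a % 8 ≡ r → a % 4 ≡ r % 4
  %8⇒%4 {a} eq = trans (sym (N.m∣n⇒o%n%m≡o%m 4 8 a (divides 2 refl))) (cong (_% 4) eq)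

  square-4 : ∀ a → ¬ 2 ∣ a → (a * a) % 4 ≡ 1
  square-4 a 2∤a = %8⇒%4 {a * a} (square-8 a 2∤a)

  2^[n+k]%2^n : ∀ n k .⦃ _ : NonZero (2 ^ n) ⦄ → (2 ^ (n + k)) % (2 ^ n) ≡ 0
  2^[n+k]%2^n n k = trans (cong (_% (2 ^ n)) (trans (N.^-distribˡ-+-* 2 n k) (N.*-comm (2 ^ n) (2 ^ k))))
      (N.m*n%n≡0 (2 ^ k) (2 ^ n))

  periodic : ∀ m .⦃ _ : NonZero m ⦄ a o p → (a ^ (o + p)) % m ≡ (a ^ o) % m → ∀ s t → (a ^ (o + s + t * p)) % m ≡
      (a ^ (o + s)) % m
  periodic m a o p eq s zero    = cong (λ n → (a ^ n) % m) (N.+-identityʳ (o + s))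
  periodic m a o p eq s (suc t) = trans (cong (_% m)
      (trans (cong (a ^_) rearrange) (N.^-distribˡ-+-* a (o + p) (s + t * p))))
      (trans (%-* m {Y = a ^ (s + t * p)} eq refl) (trans
          (cong (_% m) (trans (sym (N.^-distribˡ-+-* a o (s + t * p))) (cong (a ^_) (sym (N.+-assoc o s (t * p))))))
        (periodic m a o p eq s t)))
    where
    open NS.+-*-Solver
    rearrange : o + s + (p + t * p) ≡ o + p + (s + t * p)
    rearrange = solve 4 (λ o s p q → o :+ s :+ (p :+ q) := o :+ p :+ (s :+ q)) refl o s p (t * p)

-- The congruence sieve.

module Sieve where
  open import Data.Nat
  open PrimePowers
  open Residues

  -- The shape that `two-plus-9^` forces on c.
  base : ℕ → ℕ
  base j = 2 + 3 ^ (suc j + suc j)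

  Agree : (m : ℕ) .⦃ _ : NonZero m ⦄ → ℕ → ℕ → ℕ → Set
  Agree m L j l = L % m ≡ (base j % m) ^ suc (l + l) % m

  agree? : (m : ℕ) .⦃ _ : NonZero m ⦄ → ∀ L j l → Dec (Agree m L j l)
  agree? m L j l = L % m ≟ (base j % m) ^ suc (l + l) % m

  -- The true solution 2³ + 3 = 11 = 2 + 3² survives every sieve. The families therefore start at 3³
  -- and, with the power of 3 fixed at 3, at 2⁵: modulo 9 and 16 respectively those powers vanish,
  -- which sets them apart from the solution.
  lhs₁ : ℕ → ℕ → ℕ
  lhs₁ i k = 2 ^ (3 + (i + i)) + 3 ^ (3 + (k + k))

  lhs₂ : ℕ → ℕ
  lhs₂ i = 2 ^ (5 + (i + i)) + 3

  Agree₁ : ℕ → ℕ → ℕ → ℕ → Set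
  Agree₁ i k j l = Agree 5 (lhs₁ i k) j l × Agree 7 (lhs₁ i k) j l × Agree 9 (lhs₁ i k) j l × Agree 13 (lhs₁ i k) j l

  agree₁? : ∀ i k j l → Dec (Agree₁ i k j l)
  agree₁? i k j l = agree? 5 (lhs₁ i k) j l ×-dec
      (agree? 7 (lhs₁ i k) j l ×-dec (agree? 9 (lhs₁ i k) j l ×-dec agree? 13 (lhs₁ i k) j l))

  Agree₂ : ℕ → ℕ → ℕ → Set
  Agree₂ i j l = Agree 5 (lhs₂ i) j l × Agree 9 (lhs₂ i) j l × Agree 13 (lhs₂ i) j l × Agree 16 (lhs₂ i) j l

  agree₂? : ∀ i j l → Dec (Agree₂ i j l)
  agree₂? i j l = agree? 5 (lhs₂ i) j l ×-dec (agree? 9 (lhs₂ i) j l ×-dec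
      (agree? 13 (lhs₂ i) j l ×-dec agree? 16 (lhs₂ i) j l))

  -- Exponents o + 2i with i modulo 6 have period 12, and the unit groups for all the moduli used
  -- here and in `none₂` have exponent dividing 12.
  none₁ : ∀ (i k j l : Fin 6) → ¬ Agree₁ (toℕ i) (toℕ k) (toℕ j) (toℕ l)
  none₁ = from-yes (Fin.all? λ (i : Fin 6) → Fin.all? λ (k : Fin 6) → Fin.all? λ (j : Fin 6) → Fin.all? λ (l : Fin 6) →
    ¬? (agree₁? (toℕ i) (toℕ k) (toℕ j) (toℕ l)))

  none₂ : ∀ (i j l : Fin 6) → ¬ Agree₂ (toℕ i) (toℕ j) (toℕ l)
  none₂ = from-yes (Fin.all? λ (i : Fin 6) → Fin.all? λ (j : Fin 6) → Fin.all? λ (l : Fin 6) → ¬?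
      (agree₂? (toℕ i) (toℕ j) (toℕ l)))

  -- Both sides only depend on the exponents modulo 6; the powers of the base are periodic because the base is
  -- invertible modulo m.
  double-%6 : ∀ o i → o + (i + i) ≡ o + (i % 6 + i % 6) + i / 6 * 12
  double-%6 o i = trans (cong (λ i → o + (i + i)) (N.m≡m%n+[m/n]*n i 6))
    (solve 3 (λ o r t → o :+ ((r :+ t :* con 6) :+ (r :+ t :* con 6)) := o :+ (r :+ r) :+ t :* con 12) refl o (i % 6)
        (i / 6))
    where open NS.+-*-Solver

  -- The offset o lets periodicity set in late: 3 modulo 9 and 2 modulo 16 are not invertible, but
  -- their powers vanish from 3² and 2⁴ on.
  reduce-exponent : ∀ m .⦃ _ : NonZero m ⦄ a o → (a ^ (o + 12)) % m ≡ (a ^ o) % m → ∀ i →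
    (a ^ (o + (i + i))) % m ≡ (a ^ (o + (i % 6 + i % 6))) % m
  reduce-exponent m a o eq i = trans (cong (λ n → (a ^ n) % m) (double-%6 o i))
      (periodic m a o 12 eq (i % 6 + i % 6) (i / 6))

  module _ (m : ℕ) .⦃ _ : NonZero m ⦄ (9^7 : (3 ^ 14) % m ≡ (3 ^ 2) % m)
    (base-unit : ∀ (j : Fin 6) → ((base (toℕ j) % m) ^ 13) % m ≡ ((base (toℕ j) % m) ^ 1) % m) where

    reduce-base : ∀ j → base j % m ≡ base (j % 6) % m
    reduce-base j = trans (N.%-distribˡ-+ 2 _ m) (trans (cong (λ r → (2 % m + r) % m)
        (subst₂ (λ p q → (3 ^ p) % m ≡ (3 ^ q) % m) (cong suc (sym (N.+-suc j j)))
            (cong suc (sym (N.+-suc (j % 6) (j % 6)))) (reduce-exponent m 3 2 9^7 j)))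
      (sym (N.%-distribˡ-+ 2 _ m)))

    reduce-rhs : ∀ j l → (base j ^ suc (l + l)) % m ≡ ((base (j % 6) % m) ^ suc (l % 6 + l % 6)) % m
    reduce-rhs j l = trans (%-^ m (trans (reduce-base j) (sym (N.m%n%n≡m%n (base (j % 6)) m))) (suc (l + l)))
      (reduce-exponent m (base (j % 6) % m) 1
        (subst (λ j → ((base j % m) ^ 13) % m ≡ ((base j % m) ^ 1) % m) (Fin.toℕ-fromℕ< (N.m%n<n j 6))
            (base-unit (fromℕ< (N.m%n<n j 6)))) l)

    reduce₁ : (2 ^ 15) % m ≡ (2 ^ 3) % m → (3 ^ 15) % m ≡ (3 ^ 3) % m → ∀ i k j l →
      lhs₁ i k ≡ base j ^ suc (l + l) → Agree m (lhs₁ (i % 6) (k % 6)) (j % 6) (l % 6)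
    reduce₁ p2 p3 i k j l eq = trans (sym (trans (N.%-distribˡ-+ (2 ^ (3 + (i + i))) _ m) (trans (cong₂ (λ a b → (a + b) % m)
      (reduce-exponent m 2 3 p2 i) (reduce-exponent m 3 3 p3 k)) (sym (N.%-distribˡ-+ (2 ^ (3 + (i % 6 + i % 6))) _ m)))))
      (trans (cong (_% m) eq) (reduce-rhs j l))

    reduce₂ : (2 ^ 17) % m ≡ (2 ^ 5) % m → ∀ i j l → lhs₂ i ≡ base j ^ suc (l + l) → Agree m (lhs₂ (i % 6)) (j % 6) (l % 6)
    reduce₂ p2 i j l eq = trans (sym (trans (N.%-distribˡ-+ (2 ^ (5 + (i + i))) 3 m) (trans (cong (λ a → (a + 3 % m) % m)
      (reduce-exponent m 2 5 p2 i)) (sym (N.%-distribˡ-+ (2 ^ (5 + (i % 6 + i % 6))) 3 m)))))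
      (trans (cong (_% m) eq) (reduce-rhs j l))

  base-unit? : ∀ m .⦃ _ : NonZero m ⦄ → Dec (∀ (j : Fin 6) → ((base (toℕ j) % m) ^ 13) % m ≡ ((base (toℕ j) % m) ^ 1) % m)
  base-unit? m = Fin.all? λ j → ((base (toℕ j) % m) ^ 13) % m ≟ ((base (toℕ j) % m) ^ 1) % m

  ¬lhs₁ : ∀ i k j l → lhs₁ i k ≢ base j ^ suc (l + l)
  ¬lhs₁ i k j l eq = none₁ (F i) (F k) (F j) (F l) (at 5 (reduce₁ 5 refl (from-yes (base-unit? 5)) refl refl i k j l eq) ,
      at 7 (reduce₁ 7 refl (from-yes (base-unit? 7)) refl refl i k j l eq) , at 9
          (reduce₁ 9 refl (from-yes (base-unit? 9)) refl refl i k j l eq) ,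
      at 13 (reduce₁ 13 refl (from-yes (base-unit? 13)) refl refl i k j l eq))
    where
    F : ℕ → Fin 6
    F n = fromℕ< (N.m%n<n n 6)
    F≡ : ∀ n → n % 6 ≡ toℕ (F n)
    F≡ n = sym (Fin.toℕ-fromℕ< (N.m%n<n n 6))
    at : ∀ m .⦃ _ : NonZero m ⦄ → Agree m (lhs₁ (i % 6) (k % 6)) (j % 6) (l % 6) → Agree m (lhs₁ (toℕ (F i)) (toℕ (F k)))
        (toℕ (F j)) (toℕ (F l))
    at m p = subst₂ (λ L t → L % m ≡ t) (cong₂ lhs₁ (F≡ i) (F≡ k))
        (cong₂ (λ j l → (base j % m) ^ suc (l + l) % m) (F≡ j) (F≡ l)) p

  ¬lhs₂ : ∀ i j l → lhs₂ i ≢ base j ^ suc (l + l)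
  ¬lhs₂ i j l eq = none₂ (F i) (F j) (F l) (at 5 (reduce₂ 5 refl (from-yes (base-unit? 5)) refl i j l eq) ,
      at 9 (reduce₂ 9 refl (from-yes (base-unit? 9)) refl i j l eq) , at 13
          (reduce₂ 13 refl (from-yes (base-unit? 13)) refl i j l eq) ,
      at 16 (reduce₂ 16 refl (from-yes (base-unit? 16)) refl i j l eq))
    where
    F : ℕ → Fin 6
    F n = fromℕ< (N.m%n<n n 6)
    F≡ : ∀ n → n % 6 ≡ toℕ (F n)
    F≡ n = sym (Fin.toℕ-fromℕ< (N.m%n<n n 6))
    at : ∀ m .⦃ _ : NonZero m ⦄ → Agree m (lhs₂ (i % 6)) (j % 6) (l % 6) → Agree m (lhs₂ (toℕ (F i))) (toℕ (F j)) (toℕ (F l))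
    at m p = subst₂ (λ L t → L % m ≡ t) (cong lhs₂ (F≡ i)) (cong₂ (λ j l → (base j % m) ^ suc (l + l) % m) (F≡ j) (F≡ l)) p

  -- Besides the two sieved families there remains 2³ + 3, so c ∣ 11.
  base≡11 : ∀ {c} → Prime c → ∀ i j k l → 2 + 3 ^ (suc j + suc j) ≡ c → 2 ^ (3 + (i + i)) + 3 ^ suc (k + k) ≡ c ^ suc
      (l + l) → c ≡ 11
  base≡11 pc i j (suc k) l refl eq = ⊥-elim (¬lhs₁ i k j l
      (trans (cong (λ n → 2 ^ (3 + (i + i)) + 3 ^ suc (suc n)) (sym (N.+-suc k k))) eq))
  base≡11 pc (suc i) j zero l refl eq = ⊥-elim (¬lhs₂ i j l (trans (cong (λ n → 2 ^ (4 + n) + 3) (sym (N.+-suc i i))) eq))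
  base≡11 {c} pc zero j zero l _ eq = prime∣prime⇒≡ pc (from-yes (prime? 11)) (subst (c ∣_) (sym eq) (N.m∣m*n (c ^ (l + l))))

-- Differences of squares.

module Factorisations where
  open import Data.Nat
  open PrimePowers
  open Residues
  open TrivialPowers using (prime^≥)
  open Uniqueness using (∤^)
  open NS.+-*-Solver

  three-prime : Prime 3
  three-prime = from-yes (prime? 3)

  -- For positive exponents only: even ones start at 2, so that they have the form ε + 2i with ε ∈
  -- {1, 2}, as in the quadratic forms.
  data Parity : ℕ → Set where
    odd  : ∀ i → Parity (suc (i + i))
    even : ∀ i → Parity (2 + (i + i))

  exponent-parity : ∀ n → 0 < n → Parity n
  exponent-parity n 0<n with odd⊎even n
  ... | i , inj₂ refl = odd i
  ... | suc i , inj₁ refl = subst Parity (cong suc (sym (N.+-suc i i))) (even i)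
  exponent-parity n () | zero , inj₁ refl

  ^-even : ∀ a j → a ^ (2 + (j + j)) ≡ a ^ suc j * a ^ suc j
  ^-even a j = trans (cong (a ^_) (cong suc (sym (N.+-suc j j)))) (N.^-distribˡ-+-* a (suc j) (suc j))

  difference-of-squares : ∀ A B C → 0 < A → A + B * B ≡ C * C → ∃[ D ] (C ≡ D + B × D * (D + 2 * B) ≡ A)
  difference-of-squares A B C 0<A eq = C ∸ B , C≡ , N.+-cancelʳ-≡ (B * B) _ A (trans
      (solve 2 (λ D B → D :* (D :+ con 2 :* B) :+ B :* B := (D :+ B) :* (D :+ B)) refl (C ∸ B) B)
      (trans (cong (λ C → C * C) (sym C≡)) (sym eq)))
    where
    B≤C : B ≤ C
    B≤C = N.≮⇒≥ λ C<B → N.<⇒≱ (N.m<n+m (B * B) 0<A) (N.≤-trans (N.≤-reflexive eq) (N.*-mono-≤ (N.<⇒≤ C<B) (N.<⇒≤ C<B)))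
    C≡ : C ≡ C ∸ B + B
    C≡ = sym (N.m∸n+n≡m B≤C)

  -- D and D + 2B are powers of 2 whose difference is twice an odd number, so the smaller is 2.
  odd-gap : ∀ D B n → ¬ 2 ∣ B → D * (D + 2 * B) ≡ 2 ^ n → D ≡ 2 × 4 * (1 + B) ≡ 2 ^ n
  odd-gap D B n 2∤B eq = by-exponents (∣prime^⇒≡^ prime[2] n (subst (D ∣_) eq (N.m∣m*n (D + 2 * B))))
      (∣prime^⇒≡^ prime[2] n (subst (D + 2 * B ∣_) eq (N.n∣m*n D)))
    where
    2∣2^ : ∀ t → 2 ∣ 2 ^ suc t
    2∣2^ t = N.m∣m*n (2 ^ t)
    0<B : 0 < B
    0<B = N.n≢0⇒n>0 λ B≡0 → 2∤B (subst (2 ∣_) (sym B≡0) (2 N.∣0))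
    by-exponents : ∃[ s ] D ≡ 2 ^ s → ∃[ t ] D + 2 * B ≡ 2 ^ t → D ≡ 2 × 4 * (1 + B) ≡ 2 ^ n
    by-exponents (zero , D≡) (zero , S≡) = ⊥-elim (N.<⇒≢ (N.<-≤-trans 0<B (N.m≤m+n B (B + 0)))
      (sym (N.suc-injective (trans (cong (_+ 2 * B) (sym D≡)) S≡))))
    by-exponents (zero , D≡) (suc t , S≡) = ⊥-elim (prime∤1 prime[2] (N.∣m+n∣m⇒∣n
      (subst (2 ∣_) (trans (sym S≡) (trans (cong (_+ 2 * B) D≡) (N.+-comm 1 (2 * B)))) (2∣2^ t)) (N.m∣m*n B)))
    by-exponents (suc zero , D≡) _ = D≡ , trans (solve 1 (λ B → con 4 :* (con 1 :+ B) := con 2 :* (con 2 :+ con 2 :* B))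
        refl B)
      (trans (cong (λ D → D * (D + 2 * B)) (sym D≡)) eq)
    by-exponents (suc (suc s) , D≡) (t , S≡) = ⊥-elim
        (2∤B (N.*-cancelˡ-∣ 2 (N.∣m+n∣m⇒∣n (subst (4 ∣_) (sym S≡) (4∣2^ t S≡)) 4∣D)))
      where
      4∣D : 4 ∣ D
      4∣D = subst (4 ∣_) (trans (N.*-assoc 2 2 (2 ^ s)) (sym D≡)) (N.m∣m*n (2 ^ s))
      4≤D : 4 ≤ D
      4≤D = N.∣⇒≤ ⦃ >-nonZero (subst (0 <_) (sym D≡) (N.m^n>0 2 (2 + s))) ⦄ 4∣D
      4≤S : ∀ {m} → D + 2 * B ≡ m → 4 ≤ m
      4≤S e = N.≤-trans 4≤D (N.≤-trans (N.m≤m+n D _) (N.≤-reflexive e))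
      4∣2^ : ∀ t → D + 2 * B ≡ 2 ^ t → 4 ∣ 2 ^ t
      4∣2^ zero e = ⊥-elim (N.<⇒≱ (s≤s z<s) (4≤S e))
      4∣2^ (suc zero) e = ⊥-elim (N.<⇒≱ (s≤s (s≤s z<s)) (4≤S e))
      4∣2^ (suc (suc t)) _ = subst (4 ∣_) (N.*-assoc 2 2 (2 ^ t)) (N.m∣m*n (2 ^ t))

  3^%8 : ∀ n → 3 ^ n % 8 ≡ 1 ⊎ 3 ^ n % 8 ≡ 3
  3^%8 n with odd⊎even n
  ... | k , inj₁ refl = inj₁ (even-power 8 {3} refl k)
  ... | k , inj₂ refl = inj₂ (odd-power 8 {3} refl k)

  8∤1+3^ : ∀ n k → 1 + 3 ^ n ≢ 2 ^ (3 + k)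
  8∤1+3^ n k eq with 3^%8 n
  ... | inj₁ e = absurd (trans (sym (2^[n+k]%2^n 3 k)) (%-+ 8 {1} {3 ^ n} eq refl e))
    where
    absurd : 0 ≢ 2
    absurd ()
  ... | inj₂ e = absurd (trans (sym (2^[n+k]%2^n 3 k)) (%-+ 8 {1} {3 ^ n} eq refl e))
    where
    absurd : 0 ≢ 4
    absurd ()

  -- The gap 2 gives c^w = 3^(j+1) + 2 and 3^(j+1) + 1 = 4^i. Size and residues modulo 8 leave i =
  -- 1, that is 4² + 3² = 5².
  pythagorean : ∀ {c} → Prime c → ∀ i j w → 2 ^ (2 + (i + i)) + 3 ^ (2 + (j + j)) ≡ c ^ (w + w) → c ≡ 5
  pythagorean {c} pc i j w eq = from-gap (difference-of-squares (2 ^ (2 + (i + i))) (3 ^ suc j) (c ^ w)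
      (N.m^n>0 2 (2 + (i + i)))
      (trans (cong (2 ^ (2 + (i + i)) +_) (sym (^-even 3 j))) (trans eq (N.^-distribˡ-+-* c w w))))
    where
    B = 3 ^ suc j
    3≤B : 3 ≤ B
    3≤B = prime^≥ three-prime {suc j} z<s
    by-i : ∀ i → c ^ w ≡ 2 + B → 1 + B ≡ 2 ^ (i + i) → c ≡ 5
    by-i zero C≡ eq = ⊥-elim (N.<⇒≢ (N.<-≤-trans z<s 3≤B) (sym (N.suc-injective eq)))
    by-i (suc zero) C≡ eq = prime∣prime^⇒≡-5 w (trans C≡ (cong suc eq))
      where
      prime∣prime^⇒≡-5 : ∀ w → c ^ w ≡ 5 → c ≡ 5
      prime∣prime^⇒≡-5 zero ()
      prime∣prime^⇒≡-5 (suc w) e = prime∣prime⇒≡ pc (from-yes (prime? 5)) (subst (c ∣_) e (N.m∣m*n (c ^ w)))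
    by-i (suc (suc i)) C≡ eq = ⊥-elim (8∤1+3^ (suc j) (suc (i + i))
        (trans eq (cong (λ n → 2 ^ suc (suc n)) (trans (N.+-suc i (suc i)) (cong suc (N.+-suc i i))))))
    from-gap : ∃[ D ] (c ^ w ≡ D + B × D * (D + 2 * B) ≡ 2 ^ (2 + (i + i))) → c ≡ 5
    from-gap (D , C≡ , eqD) = by-i i (trans C≡ (cong (_+ B) (proj₁ gap))) (N.*-cancelˡ-≡ (1 + B) (2 ^ (i + i)) 4
        (trans (proj₂ gap) (sym (N.*-assoc 2 2 (2 ^ (i + i))))))
      where
      gap = odd-gap D B (2 + (i + i)) (∤^ prime[2] three-prime (λ ()) (suc j)) eqD

  -- The two factors are powers of 3 whose difference 2^(i+2) is prime to 3. The smaller is 1, and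
  -- 3^(2j+1) = 1 + 2^(i+2) fails modulo 4.
  no-even-odd-square : ∀ c i j w → 2 ^ (2 + (i + i)) + 3 ^ suc (j + j) ≢ c ^ (w + w)
  no-even-odd-square c i j w eq = from-gap (difference-of-squares (3 ^ suc (j + j)) (2 ^ suc i) (c ^ w)
      (N.m^n>0 3 (suc (j + j)))
      (trans (cong (3 ^ suc (j + j) +_) (sym (^-even 2 i)))
          (trans (N.+-comm (3 ^ suc (j + j)) _) (trans eq (N.^-distribˡ-+-* c w w)))))
    where
    B = 2 ^ suc i
    from-gap : ¬ (∃[ D ] (c ^ w ≡ D + B × D * (D + 2 * B) ≡ 3 ^ suc (j + j)))
    from-gap (D , _ , eqD) = by-exponents (∣prime^⇒≡^ three-prime (suc (j + j)) (subst (D ∣_) eqD (N.m∣m*n (D + 2 * B))))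
        (∣prime^⇒≡^ three-prime (suc (j + j)) (subst (D + 2 * B ∣_) eqD (N.n∣m*n D)))
      where
      by-exponents : ∃[ s ] D ≡ 3 ^ s → ∃[ t ] D + 2 * B ≡ 3 ^ t → ⊥
      by-exponents (zero , D≡) _ = absurd (trans (sym (odd-power 4 {3} refl j))
          (%-+ 4 {2 ^ (2 + i)} {1} (trans (N.+-comm (2 ^ (2 + i)) 1)
          (trans (sym (trans (cong (λ D → D * (D + 2 * B)) D≡) (N.*-identityˡ (1 + 2 * B)))) eqD)) (2^[n+k]%2^n 2 i) refl))
        where
        absurd : 3 ≢ 1
        absurd ()
      by-exponents (suc s , D≡) (zero , S≡) = N.<⇒≱
          (N.<-≤-trans (N.<-≤-trans (s≤s z<s) (prime^≥ three-prime {suc s} z<s))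
          (N.≤-trans (N.≤-reflexive (sym D≡)) (N.m≤m+n D (2 * B)))) (N.≤-reflexive S≡)
      by-exponents (suc s , D≡) (suc t , S≡) = ∤^ three-prime prime[2] (λ ()) (2 + i)
        (N.∣m+n∣m⇒∣n (subst (3 ∣_) (sym S≡) (N.m∣m*n (3 ^ t))) (subst (3 ∣_) (sym D≡) (N.m∣m*n (3 ^ s))))

  -- Modulo 8, z is odd exactly when the power of 2 is 2 itself. Then `base-three` yields 2 + 5² =
  -- 3³; otherwise two successive differences of squares yield 2⁵ + 7² = 3⁴.
  odd-even-three : ∀ {b} → Prime b → b ≢ 2 → b ≢ 3 → ∀ i j z → 2 ^ suc (i + i) + b ^ (2 + (j + j)) ≡ 3 ^ z → b ≡ 5 ⊎ b ≡ 7
  odd-even-three {b} pb b≢2 b≢3 i j z eq = by-cases i (odd⊎even z) eq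
    where
    2∤b : ¬ 2 ∣ b
    2∤b 2∣b = b≢2 (sym (prime∣prime⇒≡ prime[2] pb 2∣b))
    b²%8 : b ^ (2 + (j + j)) % 8 ≡ 1
    b²%8 = trans (cong (λ n → b ^ n % 8) (cong suc (sym (N.+-suc j j)))) (even-power 8 {b} (square-8 b 2∤b) (suc j))
    2^%8 : ∀ i → 2 ^ suc (suc i + suc i) % 8 ≡ 0
    2^%8 i = trans (cong (λ n → 2 ^ (2 + n) % 8) (N.+-suc i i)) (2^[n+k]%2^n 3 (i + i))
    B = b ^ suc j
    2∤B : ¬ 2 ∣ B
    2∤B = ∤^ prime[2] pb (λ e → b≢2 (sym e)) (suc j)
    1<B : 1 < B
    1<B = N.<-≤-trans (prime>1 pb) (prime^≥ pb {suc j} z<s)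
    seven : ∀ i w → 3 ^ w ≡ 2 + B → 1 + B ≡ 2 ^ suc (i + i) → b ≡ 7
    seven zero w _ e = ⊥-elim (N.<⇒≢ 1<B (sym (N.suc-injective e)))
    -- The first factorisation leaves 3^w = 2^n + 1 with 8 ∣ 2^n. So w is even, and factoring 3^w -
    -- 1 gives 2^n = 8.
    seven (suc i) w 3^w≡ e = by-parity (odd⊎even w)
      where
      n = suc (suc i + suc i)
      3^w≡1+2^ : 2 ^ n + 1 ≡ 3 ^ w
      3^w≡1+2^ = trans (N.+-comm (2 ^ n) 1) (trans (cong suc (sym e)) (sym 3^w≡))
      by-parity : ∃[ v ] (w ≡ v + v ⊎ w ≡ suc (v + v)) → b ≡ 7
      by-parity (v , inj₂ refl) = ⊥-elim (absurd (trans (sym (odd-power 8 {3} refl v))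
          (%-+ 8 {2 ^ n} {1} 3^w≡1+2^ (2^%8 i) refl)))
        where
        absurd : 3 ≢ 1
        absurd ()
      by-parity (v , inj₁ refl) = from-gap (difference-of-squares (2 ^ n) 1 (3 ^ v) (N.m^n>0 2 n)
          (trans 3^w≡1+2^ (N.^-distribˡ-+-* 3 v v)))
        where
        from-gap : ∃[ D ] (3 ^ v ≡ D + 1 × D * (D + 2 * 1) ≡ 2 ^ n) → b ≡ 7
        from-gap (D , _ , eqD) = prime∣prime⇒≡ pb (from-yes (prime? 7)) (subst (b ∣_) B≡7 (N.m∣m*n (b ^ j)))
          where
          B≡7 : B ≡ 7
          B≡7 = N.suc-injective (trans e (sym (proj₂ (odd-gap D 1 n (prime∤1 prime[2]) eqD))))
    by-cases : ∀ i → ∃[ w ] (z ≡ w + w ⊎ z ≡ suc (w + w)) → 2 ^ suc (i + i) + b ^ (2 + (j + j)) ≡ 3 ^ z → b ≡ 5 ⊎ b ≡ 7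
    by-cases zero (w , inj₁ refl) eq = ⊥-elim (absurd (trans (sym (even-power 8 {3} refl w)) (%-+ 8 {2} eq refl b²%8)))
      where
      absurd : 1 ≢ 3
      absurd ()
    by-cases zero (w , inj₂ refl) eq = inj₁ (ClassNumberOne.base-three pb b≢2 b≢3 j w
        (trans (cong (λ n → 2 + b ^ n) (cong suc (N.+-suc j j))) eq))
    by-cases (suc i) (w , inj₂ refl) eq = ⊥-elim (absurd
        (trans (sym (odd-power 8 {3} refl w)) (%-+ 8 {2 ^ suc (suc i + suc i)} {b ^ (2 + (j + j))} eq (2^%8 i) b²%8)))
      where
      absurd : 3 ≢ 1
      absurd ()
    by-cases (suc i) (w , inj₁ refl) eq = inj₂ (from-gap
        (difference-of-squares (2 ^ suc (suc i + suc i)) B (3 ^ w) (N.m^n>0 2 (suc (suc i + suc i)))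
        (trans (cong (2 ^ suc (suc i + suc i) +_) (sym (^-even b j))) (trans eq (N.^-distribˡ-+-* 3 w w)))))
      where
      from-gap : ∃[ D ] (3 ^ w ≡ D + B × D * (D + 2 * B) ≡ 2 ^ suc (suc i + suc i)) → b ≡ 7
      from-gap (D , C≡ , eqD) = seven i w (trans C≡ (cong (_+ B) (proj₁ gap))) (N.*-cancelˡ-≡ (1 + B) (2 ^ suc (i + i)) 4
          (trans (proj₂ gap) (trans (cong (λ n → 2 ^ (2 + n)) (N.+-suc i i)) (sym (N.*-assoc 2 2 (2 ^ suc (i + i)))))))
        where
        gap = odd-gap D B (suc (suc i + suc i)) 2∤B eqD

-- The case c = 2: comparison of 2-adic valuations.

module PowersOfTwo where
  open import Data.Nat
  open PrimePowers
  open Residues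
  open Factorisations
  open TrivialPowers using (prime^≥)
  open TrivialPowers₂ using (Exceptional)
  open Uniqueness using (unique-two; odd-prime≥3)
  open NS.+-*-Solver

  exact-power : ∀ m → 0 < m → ∃[ α ] (2 ^ α ∣ m × ¬ 2 ^ suc α ∣ m)
  exact-power = <-rec _ step
    where
    step : ∀ m → (∀ {k} → k < m → 0 < k → ∃[ α ] (2 ^ α ∣ k × ¬ 2 ^ suc α ∣ k)) → 0 < m → ∃[ α ]
        (2 ^ α ∣ m × ¬ 2 ^ suc α ∣ m)
    step m rec 0<m with 2 ∣? m
    ... | no 2∤m = 0 , N.1∣ m , λ p → 2∤m (subst (_∣ m) (N.*-identityʳ 2) p)
    ... | yes (divides k refl) with k
    ... | zero = ⊥-elim (N.<-irrefl refl 0<m)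
    ... | suc k with rec (N.m<m*n (suc k) 2 (s≤s z<s)) z<s
    ... | α , p , ¬p = suc α , subst (2 ^ suc α ∣_) (N.*-comm 2 (suc k)) (N.*-monoʳ-∣ 2 p) ,
        λ q → ¬p (N.*-cancelˡ-∣ 2 (subst (2 ^ (2 + α) ∣_) (N.*-comm (suc k) 2) q))

  -- The base is written n + 1, so that n and 2 + n stand for base minus 1 and base plus 1 without
  -- truncated subtraction.
  ^-1-factor : ∀ n j → ∃[ M ] suc n ^ (j + j) ≡ 1 + n * (2 + n) * M
  ^-1-factor n zero = 0 , cong suc (sym (N.*-zeroʳ (n * (2 + n))))
  ^-1-factor n (suc j) with ^-1-factor n j
  ... | M , eq = suc n * suc n * M + 1 , trans (cong (suc n ^_) (cong suc (N.+-suc j j)))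
      (trans (sym (N.*-assoc (suc n) (suc n) (suc n ^ (j + j))))
      (trans (cong (suc n * suc n *_) eq) (solve 2 (λ n M → (con 1 :+ n) :* (con 1 :+ n) :* (con 1 :+ n :* (con 2 :+ n) :* M)
        := con 1 :+ n :* (con 2 :+ n) :* ((con 1 :+ n) :* (con 1 :+ n) :* M :+ con 1)) refl n M)))

  -- Hence a + 1 and a^x + 1 have the same 2-part for odd x.
  odd-^+1 : ∀ n i → 2 ∣ n → ∃[ o ] (¬ 2 ∣ o × suc n ^ suc (i + i) + 1 ≡ (2 + n) * o)
  odd-^+1 n i 2∣n with ^-1-factor n i
  ... | M , eq = 1 + n * (suc n * M) , (λ 2∣ → prime∤1 prime[2]
      (N.∣m+n∣m⇒∣n (subst (2 ∣_) (N.+-comm 1 (n * (suc n * M))) 2∣) (N.∣m⇒∣m*n (suc n * M) 2∣n))) ,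
      trans (cong (λ t → suc n * t + 1) eq) (solve 2 (λ n M → (con 1 :+ n) :* (con 1 :+ n :* (con 2 :+ n) :* M) :+ con 1
        := (con 2 :+ n) :* (con 1 :+ n :* ((con 1 :+ n) :* M))) refl n M)

  odd-^-1 : ∀ n i → 2 ∣ n → ∃[ o ] (¬ 2 ∣ o × suc n ^ suc (i + i) ≡ 1 + n * o)
  odd-^-1 n i 2∣n with ^-1-factor n i
  ... | M , eq = 1 + (2 + n) * (suc n * M) , (λ 2∣ → prime∤1 prime[2]
      (N.∣m+n∣m⇒∣n (subst (2 ∣_) (N.+-comm 1 ((2 + n) * (suc n * M))) 2∣)
      (N.∣m⇒∣m*n (suc n * M) (N.∣m∣n⇒∣m+n N.∣-refl 2∣n)))) ,
      trans (cong (suc n *_) eq) (solve 2 (λ n M → (con 1 :+ n) :* (con 1 :+ n :* (con 2 :+ n) :* M)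
        := con 1 :+ n :* (con 1 :+ (con 2 :+ n) :* ((con 1 :+ n) :* M))) refl n M)

  odd-cofactor : ∀ α m o → ¬ 2 ∣ o → 2 ^ α ∣ m * o → 2 ^ α ∣ m
  odd-cofactor α m o 2∤o p = Coprime.coprime-divisor (∤⇒coprime-^ prime[2] 2∤o α) (subst (2 ^ α ∣_) (N.*-comm m o) p)

  2^-∣ : ∀ {α z} → α ≤ z → 2 ^ α ∣ 2 ^ z
  2^-∣ {α} {z} α≤z = divides (2 ^ (z ∸ α)) (trans (cong (2 ^_) (sym (N.m∸n+n≡m α≤z))) (N.^-distribˡ-+-* 2 (z ∸ α) α))

  -- 2^α ≤ a + 1 < a^x + B = 2^z. The strict inequality makes even 2^(α+1) divide the right side of
  -- the equation.
  exponent-bound : ∀ {a} → Prime a → ∀ x B z α → 0 < x → 1 < B → a ^ x + B ≡ 2 ^ z → 2 ^ α ∣ suc a → α < z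
  exponent-bound {a} pa x B z α 0<x 1<B eq 2^α∣ = N.≰⇒> λ z≤α → N.<⇒≱ (begin-strict
    2 ^ α       ≤⟨ N.∣⇒≤ 2^α∣ ⟩
    suc a       ≡⟨ N.+-comm 1 a ⟩
    a + 1       ≤⟨ N.+-monoˡ-≤ 1 (prime^≥ pa 0<x) ⟩
    a ^ x + 1   <⟨ N.+-monoʳ-< (a ^ x) 1<B ⟩
    a ^ x + B   ≡⟨ eq ⟩
    2 ^ z       ∎) (N.^-monoʳ-≤ 2 z≤α)
    where open N.≤-Reasoning

  module _ {n m : ℕ} (pa : Prime (suc n)) (pb : Prime (suc m)) (2∣n : 2 ∣ n) (2∣m : 2 ∣ m) where

    2∣2+m : 2 ∣ 2 + m
    2∣2+m = N.∣m∣n⇒∣m+n N.∣-refl 2∣m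

    1<b^ : ∀ {y} → 0 < y → 1 < suc m ^ y
    1<b^ 0<y = N.<-≤-trans (prime>1 pb) (prime^≥ pb 0<y)

    -- The 2-part of a + 1 is that of a^x + 1, hence of b^(2j) - 1, which is divisible by (b - 1)(b + 1).
    odd-even-obstruction : ∀ i j z α → suc n ^ suc (i + i) + suc m ^ (2 + (j + j)) ≡ 2 ^ z →
      2 ^ α ∣ 2 + n → ¬ 2 ^ suc α ∣ 2 + n → ¬ 2 ^ suc α ∣ m * (2 + m)
    odd-even-obstruction i j z α eq p ¬p q = from-factors (odd-^+1 n i 2∣n) (^-1-factor m (suc j))
      where
      from-factors : ∃[ o ] (¬ 2 ∣ o × suc n ^ suc (i + i) + 1 ≡ (2 + n) * o) → ∃[ M ] suc m ^ (suc j + suc j) ≡ 1 + m *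
          (2 + m) * M → ⊥
      from-factors (o , 2∤o , eqa) (M , eqb) = ¬p (odd-cofactor (suc α) (2 + n) o 2∤o (N.∣m+n∣m⇒∣n
        (subst (2 ^ suc α ∣_) (trans (sym eq) (trans (cong₂ (λ s t → s + t) refl
            (trans (cong (suc m ^_) (cong suc (sym (N.+-suc j j)))) eqb))
          (trans (sym (N.+-assoc (suc n ^ suc (i + i)) 1 _))
              (trans (N.+-comm _ (m * (2 + m) * M)) (cong (m * (2 + m) * M +_) eqa)))))
          (2^-∣ (exponent-bound pa (suc (i + i)) _ z α z<s (1<b^ {2 + (j + j)} z<s) eq p)))
        (N.∣m⇒∣m*n M q)))

    -- The other factor b + 1 is even, so 2^α ∣ b - 1 would give 2^(α+1) ∣ b² - 1.
    ¬2^∣b-1 : ∀ i j z α → suc n ^ suc (i + i) + suc m ^ (2 + (j + j)) ≡ 2 ^ z →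
      2 ^ α ∣ 2 + n → ¬ 2 ^ suc α ∣ 2 + n → ¬ 2 ^ α ∣ m
    ¬2^∣b-1 i j z α eq p ¬p q = odd-even-obstruction i j z α eq p ¬p
        (subst (_∣ m * (2 + m)) (N.*-comm (2 ^ α) 2) (N.*-pres-∣ q 2∣2+m))

    ¬2^∣b+1 : ∀ i j z α → suc n ^ suc (i + i) + suc m ^ (2 + (j + j)) ≡ 2 ^ z →
      2 ^ α ∣ 2 + n → ¬ 2 ^ suc α ∣ 2 + n → ¬ 2 ^ α ∣ 2 + m
    ¬2^∣b+1 i j z α eq p ¬p q = odd-even-obstruction i j z α eq p ¬p (N.*-pres-∣ 2∣m q)

    -- a^x + 1 and b^y - 1 add up to 2^z, and for odd exponents their 2-parts are those of a + 1 and
    -- b - 1.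
    odd-odd-divides : ∀ i j z α → suc n ^ suc (i + i) + suc m ^ suc (j + j) ≡ 2 ^ z → 2 ^ α ∣ 2 + n → 2 ^ α ∣ m
    odd-odd-divides i j z α eq p = from-factors (odd-^+1 n i 2∣n) (odd-^-1 m j 2∣m)
      where
      from-factors : ∃[ o ] (¬ 2 ∣ o × suc n ^ suc (i + i) + 1 ≡ (2 + n) * o) → ∃[ o ]
          (¬ 2 ∣ o × suc m ^ suc (j + j) ≡ 1 + m * o) → 2 ^ α ∣ m
      from-factors (o , _ , eqa) (o' , 2∤o' , eqb) = odd-cofactor α m o' 2∤o' (N.∣m+n∣m⇒∣n
        (subst (2 ^ α ∣_) (trans (sym eq) (trans (cong (suc n ^ suc (i + i) +_) eqb)
            (trans (sym (N.+-assoc (suc n ^ suc (i + i)) 1 _)) (cong (_+ m * o') eqa))))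
          (2^-∣ (N.<⇒≤ (exponent-bound pa (suc (i + i)) _ z α z<s (1<b^ {suc (j + j)} z<s) eq p))))
        (N.∣m⇒∣m*n o p))

  not-OE-OO : ∀ {n m} → Prime (suc n) → Prime (suc m) → 2 ∣ n → 2 ∣ m → ∀ i j z i' j' z' →
    suc n ^ suc (i + i) + suc m ^ (2 + (j + j)) ≡ 2 ^ z → suc n ^ suc (i' + i') + suc m ^ suc (j' + j') ≢ 2 ^ z'
  not-OE-OO {n} pa pb 2∣n 2∣m i j z i' j' z' eq eq' with exact-power (2 + n) z<s
  ... | α , p , ¬p = ¬2^∣b-1 pa pb 2∣n 2∣m i j z α eq p ¬p (odd-odd-divides pa pb 2∣n 2∣m i' j' z' α eq' p)

  -- The first solution makes the 2-part of a + 1 exceed that of b + 1, and the second does the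
  -- reverse.
  not-OE-EO : ∀ {n m} → Prime (suc n) → Prime (suc m) → 2 ∣ n → 2 ∣ m → ∀ i j z i' j' z' →
    suc n ^ suc (i + i) + suc m ^ (2 + (j + j)) ≡ 2 ^ z → suc n ^ (2 + (i' + i')) + suc m ^ suc (j' + j') ≢ 2 ^ z'
  not-OE-EO {n} {m} pa pb 2∣n 2∣m i j z i' j' z' eq eq' with exact-power (2 + n) z<s | exact-power (2 + m) z<s
  ... | α , p , ¬p | β , q , ¬q with N.≤-total α β
  ... | inj₁ α≤β = ¬2^∣b+1 pa pb 2∣n 2∣m i j z α eq p ¬p (N.∣-trans (2^-∣ α≤β) q)
  ... | inj₂ β≤α = ¬2^∣b+1 pb pa 2∣m 2∣n j' i' z' β (trans (N.+-comm (suc m ^ suc (j' + j')) _) eq') q ¬q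
      (N.∣-trans (2^-∣ β≤α) p)

  not-EE : ∀ {n m} → 2 ∣ n → 2 ∣ m → ∀ i j z → suc n ^ (2 + (i + i)) + suc m ^ (2 + (j + j)) ≢ 2 ^ (2 + z)
  not-EE {n} {m} 2∣n 2∣m i j z eq = absurd (trans (sym (2^[n+k]%2^n 2 z))
      (%-+ 4 {suc n ^ (2 + (i + i))} {suc m ^ (2 + (j + j))} eq (square n 2∣n i) (square m 2∣m j)))
    where
    absurd : 0 ≢ 2
    absurd ()
    square : ∀ n → 2 ∣ n → ∀ i → suc n ^ (2 + (i + i)) % 4 ≡ 1
    square n 2∣n i = trans (cong (λ k → suc n ^ k % 4) (cong suc (sym (N.+-suc i i))))
      (even-power 4 {suc n} (square-4 (suc n) λ 2∣ → prime∤1 prime[2] (N.∣m+n∣m⇒∣n (subst (2 ∣_) (N.+-comm 1 n) 2∣) 2∣n))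
          (suc i))

  module _ {n m : ℕ} (pa : Prime (suc n)) (pb : Prime (suc m)) (2∣n : 2 ∣ n) (2∣m : 2 ∣ m) (a≢b : suc n ≢ suc m)
    (¬exc : ¬ Exceptional (suc n) (suc m)) (¬exc' : ¬ Exceptional (suc m) (suc n)) where

    Same : ℕ → ℕ → ℕ → ℕ → ℕ → ℕ → Set
    Same x y z x' y' z' = x ≡ x' × y ≡ y' × z ≡ z'

    a≢2 : suc n ≢ 2
    a≢2 refl = prime∤1 prime[2] 2∣n
    b≢2 : suc m ≢ 2
    b≢2 refl = prime∤1 prime[2] 2∣m

    same-class : ∀ ε φ → 0 < ε → 0 < φ → ∀ i j z i' j' z' →
      suc n ^ (ε + (i + i)) + suc m ^ (φ + (j + j)) ≡ 2 ^ (2 + z) → suc n ^ (ε + (i' + i')) + suc m ^ (φ + (j' + j')) ≡ 2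
          ^ (2 + z') →
      Same (ε + (i + i)) (φ + (j + j)) (2 + z) (ε + (i' + i')) (φ + (j' + j')) (2 + z')
    same-class ε φ 0<ε 0<φ i j z i' j' z' eq eq' with unique-two pa pb a≢2 b≢2 a≢b ¬exc ¬exc' ε φ 0<ε 0<φ i j z i' j' z' eq eq'
    ... | refl , refl , refl = refl , refl , refl

    by-parity : ∀ {x y x' y'} → Parity x → Parity y → Parity x' → Parity y' → ∀ z z' →
      suc n ^ x + suc m ^ y ≡ 2 ^ (2 + z) → suc n ^ x' + suc m ^ y' ≡ 2 ^ (2 + z') → Same x y (2 + z) x' y' (2 + z')
    by-parity (even i) (even j) _ _ z z' eq eq' = ⊥-elim (not-EE 2∣n 2∣m i j z eq)
    by-parity (odd i) (odd j) (even i') (even j') z z' eq eq' = ⊥-elim (not-EE 2∣n 2∣m i' j' z' eq')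
    by-parity (odd i) (even j) (even i') (even j') z z' eq eq' = ⊥-elim (not-EE 2∣n 2∣m i' j' z' eq')
    by-parity (even i) (odd j) (even i') (even j') z z' eq eq' = ⊥-elim (not-EE 2∣n 2∣m i' j' z' eq')
    by-parity (odd i) (odd j) (odd i') (odd j') z z' eq eq' = same-class 1 1 z<s z<s i j z i' j' z' eq eq'
    by-parity (odd i) (even j) (odd i') (even j') z z' eq eq' = same-class 1 2 z<s z<s i j z i' j' z' eq eq'
    by-parity (even i) (odd j) (even i') (odd j') z z' eq eq' = same-class 2 1 z<s z<s i j z i' j' z' eq eq'
    by-parity (odd i) (even j) (odd i') (odd j') z z' eq eq' = ⊥-elim
        (not-OE-OO pa pb 2∣n 2∣m i j (2 + z) i' j' (2 + z') eq eq')
    by-parity (odd i) (odd j) (odd i') (even j') z z' eq eq' = ⊥-elim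
        (not-OE-OO pa pb 2∣n 2∣m i' j' (2 + z') i j (2 + z) eq' eq)
    by-parity (odd i) (even j) (even i') (odd j') z z' eq eq' = ⊥-elim
        (not-OE-EO pa pb 2∣n 2∣m i j (2 + z) i' j' (2 + z') eq eq')
    by-parity (even i) (odd j) (odd i') (even j') z z' eq eq' = ⊥-elim
        (not-OE-EO pa pb 2∣n 2∣m i' j' (2 + z') i j (2 + z) eq' eq)
    by-parity (even i) (odd j) (odd i') (odd j') z z' eq eq' = ⊥-elim (not-OE-OO pb pa 2∣m 2∣n j i (2 + z) j' i' (2 + z')
      (trans (N.+-comm (suc m ^ suc (j + j)) _) eq) (trans (N.+-comm (suc m ^ suc (j' + j')) _) eq'))
    by-parity (odd i) (odd j) (even i') (odd j') z z' eq eq' = ⊥-elim (not-OE-OO pb pa 2∣m 2∣n j' i' (2 + z') j i (2 + z)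
      (trans (N.+-comm (suc m ^ suc (j' + j')) _) eq') (trans (N.+-comm (suc m ^ suc (j + j)) _) eq))

  solution-unique : ∀ {a b} → Prime a → Prime b → a ≢ 2 → b ≢ 2 → a ≢ b → ¬ Exceptional a b → ¬ Exceptional b a →
    ∀ x y z x' y' z' → 0 < x → 0 < y → 0 < x' → 0 < y' → a ^ x + b ^ y ≡ 2 ^ z → a ^ x' + b ^ y' ≡ 2 ^ z' →
    x ≡ x' × y ≡ y' × z ≡ z'
  solution-unique {suc n} {suc m} pa pb a≢2 b≢2 a≢b ¬exc ¬exc' x y z x' y' z' 0<x 0<y 0<x' 0<y' eq eq' = from-exponents
      (at-least-2 z 0<x 0<y eq) (at-least-2 z' 0<x' 0<y' eq')
    where
    even-pred : ∀ {p} → Prime (suc p) → suc p ≢ 2 → 2 ∣ p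
    even-pred pp p≢2 with prime≢2⇒odd pp p≢2
    ... | k , e = divides k (trans (N.suc-injective e) (trans (cong (k +_) (sym (N.+-identityʳ k))) (N.*-comm 2 k)))
    at-least-2 : ∀ {x y} z → 0 < x → 0 < y → suc n ^ x + suc m ^ y ≡ 2 ^ z → ∃[ t ] z ≡ 2 + t
    at-least-2 (suc (suc z)) _ _ _ = z , refl
    at-least-2 {x} {y} z 0<x 0<y e = by-z z e
      where
      4≤ : 4 ≤ suc n ^ x + suc m ^ y
      4≤ = N.≤-trans (s≤s (s≤s (s≤s z<s))) (N.+-mono-≤ (N.≤-trans (odd-prime≥3 pa a≢2) (prime^≥ pa 0<x))
          (N.≤-trans (odd-prime≥3 pb b≢2) (prime^≥ pb 0<y)))
      by-z : ∀ z → suc n ^ x + suc m ^ y ≡ 2 ^ z → ∃[ t ] z ≡ 2 + t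
      by-z zero e = ⊥-elim (N.<⇒≱ (s≤s z<s) (N.≤-trans 4≤ (N.≤-reflexive e)))
      by-z (suc zero) e = ⊥-elim (N.<⇒≱ (s≤s (s≤s z<s)) (N.≤-trans 4≤ (N.≤-reflexive e)))
      by-z (suc (suc z)) _ = z , refl
    from-exponents : ∃[ t ] z ≡ 2 + t → ∃[ t ] z' ≡ 2 + t → x ≡ x' × y ≡ y' × z ≡ z'
    from-exponents (t , refl) (t' , refl) = by-parity pa pb (even-pred pa a≢2) (even-pred pb b≢2) a≢b ¬exc ¬exc'
      (exponent-parity x 0<x) (exponent-parity y 0<y) (exponent-parity x' 0<x') (exponent-parity y' 0<y') t t' eq eq'

-- The case a = 2: separating the parity classes.

module BaseTwo where
  open import Data.Nat
  open PrimePowers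
  open Residues
  open Factorisations
  open Uniqueness using (∤^; unique-odd)

  Same : ℕ → ℕ → ℕ → ℕ → ℕ → ℕ → Set
  Same x y z x' y' z' = x ≡ x' × y ≡ y' × z ≡ z'

  1≢2 : 1 ≢ 2
  1≢2 ()

  prime∤ : ∀ {p r} → Prime p → Prime r → r ≢ p → ¬ p ∣ r
  prime∤ pp pr r≢p p∣r = r≢p (sym (prime∣prime⇒≡ pp pr p∣r))

  even-exponent : ∀ m .⦃ _ : NonZero m ⦄ a → (a * a) % m ≡ 1 % m → ∀ j → a ^ (2 + (j + j)) % m ≡ 1 % m
  even-exponent m a a²≡1 j = trans (cong (λ n → a ^ n % m) (cong suc (sym (N.+-suc j j)))) (even-power m {a} a²≡1 (suc j))

  2^-even-%4 : ∀ i → 2 ^ (2 + (i + i)) % 4 ≡ 0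
  2^-even-%4 i = 2^[n+k]%2^n 2 (i + i)

  2^-odd-%8 : ∀ i → 2 ^ suc (suc i + suc i) % 8 ≡ 0
  2^-odd-%8 i = trans (cong (λ n → 2 ^ (2 + n) % 8) (N.+-suc i i)) (2^[n+k]%2^n 3 (i + i))

  module _ {b c : ℕ} (pb : Prime b) (pc : Prime c) (b≢2 : b ≢ 2) (c≢2 : c ≢ 2) (b≢c : b ≢ c) where

    same-class : ∀ ε φ → 0 < ε → 0 < φ → ∀ i j z i' j' z' →
      2 ^ (ε + (i + i)) + b ^ (φ + (j + j)) ≡ c ^ z → 2 ^ (ε + (i' + i')) + b ^ (φ + (j' + j')) ≡ c ^ z' →
      Same (ε + (i + i)) (φ + (j + j)) z (ε + (i' + i')) (φ + (j' + j')) z'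
    same-class ε φ 0<ε 0<φ i j z i' j' z' eq eq' with unique-odd pb pc b≢2 c≢2 b≢c ε φ 0<ε 0<φ i j z i' j' z' eq eq'
    ... | refl , refl , refl = refl , refl , refl

    2∤b : ¬ 2 ∣ b
    2∤b = prime∤ prime[2] pb b≢2

    2∤c : ¬ 2 ∣ c
    2∤c = prime∤ prime[2] pc c≢2

    module _ (b≢3 : b ≢ 3) (c≢3 : c ≢ 3) where

      3∤b : ¬ 3 ∣ b
      3∤b = prime∤ three-prime pb b≢3

      3∤c : ¬ 3 ∣ c
      3∤c = prime∤ three-prime pc c≢3

      -- Odd x with even y is absent, because 2 + 1 ≡ 0 modulo 3 while 3 does not divide c. The
      -- stored residues of b prevent `EO` and `OO` from coexisting, and that of c in `EE` is half
      -- of c ≡ 5 modulo 12.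
      data Class : ℕ → ℕ → ℕ → Set where
        EE : ∀ i j k → c % 3 ≡ 2 → Class (2 + (i + i)) (2 + (j + j)) (suc (k + k))
        EO : ∀ i j z → b % 3 ≡ 1 → Class (2 + (i + i)) (suc (j + j)) z
        OO : ∀ i j z → b % 3 ≡ 2 → Class (suc (i + i)) (suc (j + j)) z

      c^z%3≢0 : ∀ z → c ^ z % 3 ≢ 0
      c^z%3≢0 z = ∤⇒%≢0 3 (c ^ z) (∤^ three-prime pc (λ e → c≢3 (sym e)) z)

      classify : ∀ {x y} z → Parity x → Parity y → 2 ^ x + b ^ y ≡ c ^ z → Class x y z
      -- Two squares prime to 3 add up to 2 modulo 3, so c^z is not a square and z is odd.
      classify z (even i) (even j) eq = by-parity (odd⊎even z) eq
        where
        by-parity : ∃[ k ] (z ≡ k + k ⊎ z ≡ suc (k + k)) → 2 ^ (2 + (i + i)) + b ^ (2 + (j + j)) ≡ c ^ z → Class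
            (2 + (i + i)) (2 + (j + j)) z
        by-parity (k , inj₁ refl) eq = ⊥-elim (1≢2 (trans (sym (even-power 3 {c} (square-3 c 3∤c) k))
            (%-+ 3 {2 ^ (2 + (i + i))} {b ^ (2 + (j + j))} eq (even-exponent 3 2 refl i)
            (even-exponent 3 b (square-3 b 3∤b) j))))
        by-parity (k , inj₂ refl) eq = EE i j k (trans (sym (odd-power 3 {c} (square-3 c 3∤c) k))
            (%-+ 3 {2 ^ (2 + (i + i))} {b ^ (2 + (j + j))} eq (even-exponent 3 2 refl i)
            (even-exponent 3 b (square-3 b 3∤b) j)))
      classify z (even i) (odd j) eq with residue-3 b 3∤b
      ... | inj₁ b%3 = EO i j z b%3
      ... | inj₂ b%3 = ⊥-elim (c^z%3≢0 z (%-+ 3 {2 ^ (2 + (i + i))} {b ^ suc (j + j)} eq (even-exponent 3 2 refl i)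
          (trans (odd-power 3 {b} (square-3 b 3∤b) j) b%3)))
      classify z (odd i) (even j) eq = ⊥-elim (c^z%3≢0 z
          (%-+ 3 {2 ^ suc (i + i)} {b ^ (2 + (j + j))} eq (odd-power 3 {2} refl i) (even-exponent 3 b (square-3 b 3∤b) j)))
      classify z (odd i) (odd j) eq with residue-3 b 3∤b
      ... | inj₁ b%3 = ⊥-elim (c^z%3≢0 z (%-+ 3 {2 ^ suc (i + i)} {b ^ suc (j + j)} eq (odd-power 3 {2} refl i)
          (trans (odd-power 3 {b} (square-3 b 3∤b) j) b%3)))
      ... | inj₂ b%3 = OO i j z b%3

      c%12≡5 : c % 3 ≡ 2 → c % 4 ≡ 1 → c % 12 ≡ 5
      c%12≡5 c%3 c%4 = subst (_≡ 5) r≡ (check r (subst (λ r → r % 3 ≡ 2) (sym r≡)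
          (trans (N.m∣n⇒o%n%m≡o%m 3 12 c (divides 4 refl)) c%3))
          (subst (λ r → r % 4 ≡ 1) (sym r≡) (trans (N.m∣n⇒o%n%m≡o%m 4 12 c (divides 3 refl)) c%4)))
        where
        r : Fin 12
        r = fromℕ< (N.m%n<n c 12)
        r≡ : toℕ r ≡ c % 12
        r≡ = Fin.toℕ-fromℕ< (N.m%n<n c 12)
        check : ∀ (r : Fin 12) → toℕ r % 3 ≡ 2 → toℕ r % 4 ≡ 1 → toℕ r ≡ 5
        check = from-yes (Fin.all? λ (r : Fin 12) → (toℕ r % 3 ≟ 2) →-dec ((toℕ r % 4 ≟ 1) →-dec (toℕ r ≟ 5)))

      Conclusion : Set
      Conclusion = (c % 12 ≡ 5) ×
        (∃[ x₁ ] ∃[ y₁ ] ∃[ z₁ ] ∃[ x₂ ] ∃[ y₂ ] ∃[ z₂ ]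
          (Sol 2 b c x₁ y₁ z₁ × Sol 2 b c x₂ y₂ z₂ ×
           ¬ ((x₁ ≡ x₂) × (y₁ ≡ y₂) × (z₁ ≡ z₂)) ×
           ((x y z : ℕ) → Sol 2 b c x y z →
              ((x ≡ x₁) × (y ≡ y₁) × (z ≡ z₁)) ⊎ ((x ≡ x₂) × (y ≡ y₂) × (z ≡ z₂))) ×
           (2 ∣ x₁) × (2 ∣ y₁) × (z₁ ≡ 1) × ¬ (2 ∣ y₂)))

      2∤odd : ∀ j → ¬ 2 ∣ suc (j + j)
      2∤odd j (divides t e) = even≢odd t j (trans (cong (t +_) (sym (N.+-identityʳ t))) (trans (N.*-comm 2 t) (sym e)))

      2∣even : ∀ i → 2 ∣ 2 + (i + i)
      2∣even i = divides (suc i) (cong (2 +_) (trans (cong (i +_) (sym (N.+-identityʳ i))) (N.*-comm 2 i)))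

      2^odd%5 : ∀ i → 2 ^ suc (i + i) % 5 ≡ 2 ⊎ 2 ^ suc (i + i) % 5 ≡ 3
      2^odd%5 zero = inj₁ refl
      2^odd%5 (suc i) with 2^odd%5 i
      ... | inj₁ e = inj₂ (trans (cong (λ n → 2 ^ suc (suc n) % 5) (N.+-suc i i))
          (trans (cong (_% 5) (sym (N.*-assoc 2 2 (2 ^ suc (i + i))))) (%-* 5 {4} {4} {2 ^ suc (i + i)} {2} refl e)))
      ... | inj₂ e = inj₁ (trans (cong (λ n → 2 ^ suc (suc n) % 5) (N.+-suc i i))
          (trans (cong (_% 5) (sym (N.*-assoc 2 2 (2 ^ suc (i + i))))) (%-* 5 {4} {4} {2 ^ suc (i + i)} {3} refl e)))

      -- Because of 2² + 11² = 5³, z₁ = 1 would fail for b = 11, c = 5 if there were a solution with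
      -- odd y. As 11 ≡ 2 modulo 3, it would lie in `OO`, where 2^x + 11^y is 3 or 4 modulo 5.
      not-11-5 : ∀ {x y z} → Class x y z → ¬ 2 ∣ y → 0 < z → 2 ^ x + b ^ y ≡ c ^ z → b ≡ 11 → c ≡ 5 → ⊥
      not-11-5 (EE i j k _) 2∤y _ _ _ _ = 2∤y (2∣even j)
      not-11-5 (EO i j z b%3) _ _ _ refl _ = absurd b%3
        where
        absurd : 2 ≢ 1
        absurd ()
      not-11-5 (OO i j (suc z) _) _ _ eq refl refl = [
          (λ e → absurd 3 (λ ()) (%-+ 5 {2 ^ suc (i + i)} {11 ^ suc (j + j)} eq e 11^%5)) ,
          (λ e → absurd 4 (λ ()) (%-+ 5 {2 ^ suc (i + i)} {11 ^ suc (j + j)} eq e 11^%5)) ]′ (2^odd%5 i)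
        where
        11^%5 : 11 ^ suc (j + j) % 5 ≡ 1
        11^%5 = trans (%-^ 5 {11} {1} refl (suc (j + j))) (cong (_% 5) (N.^-zeroˡ (suc (j + j))))
        absurd : ∀ r → 0 ≢ r → 5 ^ suc z % 5 ≢ r
        absurd r 0≢r e = 0≢r (trans (sym (trans (cong (_% 5) (N.*-comm 5 (5 ^ z))) (N.m*n%n≡0 (5 ^ z) 5))) e)

      second-class : ∀ {x y z x' y' z'} → Class x y z → ¬ 2 ∣ y → Class x' y' z' → ¬ 2 ∣ y' →
        2 ^ x + b ^ y ≡ c ^ z → 2 ^ x' + b ^ y' ≡ c ^ z' → Same x y z x' y' z'
      second-class (EE i j k _) 2∤y _ _ _ _ = ⊥-elim (2∤y (2∣even j))
      second-class (EO i j z _) _ (EE i' j' k' _) 2∤y _ _ = ⊥-elim (2∤y (2∣even j'))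
      second-class (OO i j z _) _ (EE i' j' k' _) 2∤y _ _ = ⊥-elim (2∤y (2∣even j'))
      second-class (EO i j z _) _ (EO i' j' z' _) _ eq eq' = same-class 2 1 z<s z<s i j z i' j' z' eq eq'
      second-class (OO i j z _) _ (OO i' j' z' _) _ eq eq' = same-class 1 1 z<s z<s i j z i' j' z' eq eq'
      second-class (EO i j z p) _ (OO i' j' z' q) _ _ _ = ⊥-elim (1≢2 (trans (sym p) q))
      second-class (OO i j z p) _ (EO i' j' z' q) _ _ _ = ⊥-elim (1≢2 (trans (sym q) p))

      conclude : ∀ i j k {x₂ y₂ z₂} → c % 3 ≡ 2 → 2 ^ (2 + (i + i)) + b ^ (2 + (j + j)) ≡ c ^ suc (k + k) →
        Sol 2 b c x₂ y₂ z₂ → Class x₂ y₂ z₂ → ¬ 2 ∣ y₂ → Conclusion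
      conclude i j k {x₂} {y₂} {z₂} c%3 eq₁ sol₂@(_ , _ , 0<z₂ , eq₂) class₂ 2∤y₂ = c%12≡5 c%3 c%4 ,
          2 + (i + i) , 2 + (j + j) , suc (k + k) , x₂ , y₂ , z₂ , (s≤s z≤n , s≤s z≤n , s≤s z≤n , eq₁) , sol₂ ,
          (λ same → 2∤y₂ (subst (2 ∣_) (proj₁ (proj₂ same)) (2∣even j))) ,
          (λ { x y z (0<x , 0<y , 0<z , eq) → exhaustive (classify z (exponent-parity x 0<x) (exponent-parity y 0<y) eq) eq }) ,
          2∣even i , 2∣even j , cong (λ k → suc (k + k)) k≡0 , 2∤y₂
        where
        c%4 : c % 4 ≡ 1
        c%4 = trans (sym (odd-power 4 {c} (square-4 c 2∤c) k))
            (%-+ 4 {2 ^ (2 + (i + i))} eq₁ (2^-even-%4 i) (even-exponent 4 b (square-4 b 2∤b) j))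
        k≡0 : k ≡ 0
        k≡0 = [ (λ e → e) , (λ { (b≡11 , c≡5) → ⊥-elim (not-11-5 class₂ 2∤y₂ 0<z₂ eq₂ b≡11 c≡5) }) ]′
          (ClassNumberOne.square-plus-square pb pc b≢2 c≢2 (λ e → b≢c (sym e)) i j k
            (trans (cong (λ n → 2 ^ (2 + (i + i)) + b ^ n) (cong suc (N.+-suc j j))) eq₁))
        exhaustive : ∀ {x y z} → Class x y z → 2 ^ x + b ^ y ≡ c ^ z →
          Same x y z (2 + (i + i)) (2 + (j + j)) (suc (k + k)) ⊎ Same x y z x₂ y₂ z₂
        exhaustive (EE i' j' k' _) eq = inj₁ (same-class 2 2 z<s z<s i' j' _ i j _ eq eq₁)
        exhaustive class@(EO i' j' z' _) eq = inj₂ (second-class class (2∤odd j') class₂ 2∤y₂ eq eq₂)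
        exhaustive class@(OO i' j' z' _) eq = inj₂ (second-class class (2∤odd j') class₂ 2∤y₂ eq eq₂)

      two-solutions : ∀ {x y z x' y' z'} → Sol 2 b c x y z → Sol 2 b c x' y' z' → ¬ Same x y z x' y' z' →
        Class x y z → Class x' y' z' → Conclusion
      two-solutions (_ , _ , _ , eq) (_ , _ , _ , eq') distinct (EE i j k _) (EE i' j' k' _) =
        ⊥-elim (distinct (same-class 2 2 z<s z<s i j _ i' j' _ eq eq'))
      two-solutions (_ , _ , _ , eq) sol' _ (EE i j k c%3) class@(EO i' j' z' _) = conclude i j k c%3 eq sol' class
          (2∤odd j')
      two-solutions (_ , _ , _ , eq) sol' _ (EE i j k c%3) class@(OO i' j' z' _) = conclude i j k c%3 eq sol' class
          (2∤odd j')
      two-solutions sol (_ , _ , _ , eq') _ class@(EO i j z _) (EE i' j' k' c%3) = conclude i' j' k' c%3 eq' sol class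
          (2∤odd j)
      two-solutions sol (_ , _ , _ , eq') _ class@(OO i j z _) (EE i' j' k' c%3) = conclude i' j' k' c%3 eq' sol class
          (2∤odd j)
      two-solutions (_ , _ , _ , eq) (_ , _ , _ , eq') distinct class@(EO i j z _) class'@(EO i' j' z' _) =
        ⊥-elim (distinct (second-class class (2∤odd j) class' (2∤odd j') eq eq'))
      two-solutions (_ , _ , _ , eq) (_ , _ , _ , eq') distinct class@(EO i j z _) class'@(OO i' j' z' _) =
        ⊥-elim (distinct (second-class class (2∤odd j) class' (2∤odd j') eq eq'))
      two-solutions (_ , _ , _ , eq) (_ , _ , _ , eq') distinct class@(OO i j z _) class'@(EO i' j' z' _) =
        ⊥-elim (distinct (second-class class (2∤odd j) class' (2∤odd j') eq eq'))
      two-solutions (_ , _ , _ , eq) (_ , _ , _ , eq') distinct class@(OO i j z _) class'@(OO i' j' z' _) =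
        ⊥-elim (distinct (second-class class (2∤odd j) class' (2∤odd j') eq eq'))

  -- Here b = 3. Once z is known to be odd, c modulo 3 determines the parity of x; that of y is read
  -- off from c modulo 4 when x is even, and from c modulo 8 when x is odd, with one collision.
  module _ {c : ℕ} (pc : Prime c) (c≢2 : c ≢ 2) (c≢3 : c ≢ 3) (c≢5 : c ≢ 5) (c≢11 : c ≢ 11) where

    private
      2∤c' : ¬ 2 ∣ c
      2∤c' = prime∤ prime[2] pc c≢2
      3∤c' : ¬ 3 ∣ c
      3∤c' = prime∤ three-prime pc c≢3
      3^%3 : ∀ y → 3 ^ suc y % 3 ≡ 0
      3^%3 y = trans (cong (_% 3) (N.*-comm 3 (3 ^ y))) (N.m*n%n≡0 (3 ^ y) 3)
      same : ∀ ε φ → 0 < ε → 0 < φ → ∀ i j z i' j' z' →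
        2 ^ (ε + (i + i)) + 3 ^ (φ + (j + j)) ≡ c ^ z → 2 ^ (ε + (i' + i')) + 3 ^ (φ + (j' + j')) ≡ c ^ z' →
        Same (ε + (i + i)) (φ + (j + j)) z (ε + (i' + i')) (φ + (j' + j')) z'
      same = same-class three-prime pc (λ ()) c≢2 (λ e → c≢3 (sym e))

    OddExponent : ℕ → Set
    OddExponent z = ∃[ k ] z ≡ suc (k + k)

    odd-z-EE : ∀ i j z → 2 ^ (2 + (i + i)) + 3 ^ (2 + (j + j)) ≡ c ^ z → OddExponent z
    odd-z-EE i j z eq with odd⊎even z
    ... | k , inj₂ e = k , e
    ... | k , inj₁ refl = ⊥-elim (c≢5 (pythagorean pc i j k eq))

    odd-z-EO : ∀ i j z → 2 ^ (2 + (i + i)) + 3 ^ suc (j + j) ≡ c ^ z → OddExponent z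
    odd-z-EO i j z eq with odd⊎even z
    ... | k , inj₂ e = k , e
    ... | k , inj₁ refl = ⊥-elim (no-even-odd-square c i j k eq)

    odd-z-O : ∀ i y z → 2 ^ suc (i + i) + 3 ^ suc y ≡ c ^ z → OddExponent z
    odd-z-O i y z eq with odd⊎even z
    ... | k , inj₂ e = k , e
    ... | k , inj₁ refl = ⊥-elim (1≢2 (trans (sym (even-power 3 {c} (square-3 c 3∤c') k))
        (%-+ 3 {2 ^ suc (i + i)} {3 ^ suc y} eq (odd-power 3 {2} refl i) (3^%3 y))))

    c%3≡1 : ∀ i y z → OddExponent z → 2 ^ (2 + (i + i)) + 3 ^ suc y ≡ c ^ z → c % 3 ≡ 1
    c%3≡1 i y _ (k , refl) eq = trans (sym (odd-power 3 {c} (square-3 c 3∤c') k))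
        (%-+ 3 {2 ^ (2 + (i + i))} {3 ^ suc y} eq (even-exponent 3 2 refl i) (3^%3 y))

    c%3≡2 : ∀ i y z → 2 ^ suc (i + i) + 3 ^ suc y ≡ c ^ z → c % 3 ≡ 2
    c%3≡2 i y z eq with odd-z-O i y z eq
    ... | k , refl = trans (sym (odd-power 3 {c} (square-3 c 3∤c') k))
        (%-+ 3 {2 ^ suc (i + i)} {3 ^ suc y} eq (odd-power 3 {2} refl i) (3^%3 y))

    not-EE-EO : ∀ i j z i' j' z' → 2 ^ (2 + (i + i)) + 3 ^ (2 + (j + j)) ≡ c ^ z → 2 ^ (2 + (i' + i')) + 3 ^ suc (j' + j')
        ≢ c ^ z'
    not-EE-EO i j z i' j' z' eq eq' with odd-z-EE i j z eq | odd-z-EO i' j' z' eq'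
    ... | k , refl | k' , refl = absurd (trans (sym
        (trans (sym (odd-power 4 {c} (square-4 c 2∤c') k))
        (%-+ 4 {2 ^ (2 + (i + i))} eq (2^-even-%4 i) (even-exponent 4 3 refl j))))
        (trans (sym (odd-power 4 {c} (square-4 c 2∤c') k'))
            (%-+ 4 {2 ^ (2 + (i' + i'))} eq' (2^-even-%4 i') (odd-power 4 {3} refl j'))))
      where
      absurd : 1 ≢ 3
      absurd ()

    c%8-OE : ∀ i j k → 2 ^ suc (suc i + suc i) + 3 ^ (2 + (j + j)) ≡ c ^ suc (k + k) → c % 8 ≡ 1
    c%8-OE i j k eq = trans (sym (odd-power 8 {c} (square-8 c 2∤c') k))
        (%-+ 8 {2 ^ suc (suc i + suc i)} eq (2^-odd-%8 i) (even-exponent 8 3 refl j))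

    c%8-OE₀ : ∀ j k → 2 + 3 ^ (2 + (j + j)) ≡ c ^ suc (k + k) → c % 8 ≡ 3
    c%8-OE₀ j k eq = trans (sym (odd-power 8 {c} (square-8 c 2∤c') k))
        (%-+ 8 {2} {3 ^ (2 + (j + j))} eq refl (even-exponent 8 3 refl j))

    c%8-OO : ∀ i j k → 2 ^ suc (suc i + suc i) + 3 ^ suc (j + j) ≡ c ^ suc (k + k) → c % 8 ≡ 3
    c%8-OO i j k eq = trans (sym (odd-power 8 {c} (square-8 c 2∤c') k))
        (%-+ 8 {2 ^ suc (suc i + suc i)} eq (2^-odd-%8 i) (odd-power 8 {3} refl j))

    c%8-OO₀ : ∀ j k → 2 + 3 ^ suc (j + j) ≡ c ^ suc (k + k) → c % 8 ≡ 5
    c%8-OO₀ j k eq = trans (sym (odd-power 8 {c} (square-8 c 2∤c') k))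
        (%-+ 8 {2} {3 ^ suc (j + j)} eq refl (odd-power 8 {3} refl j))

    not-OE-OO : ∀ i j z i' j' z' → 2 ^ suc (i + i) + 3 ^ (2 + (j + j)) ≡ c ^ z → 2 ^ suc (i' + i') + 3 ^ suc (j' + j') ≢ c
        ^ z'
    not-OE-OO i j z i' j' z' eq eq' = by-exponents i i' (odd-z-O i (suc (j + j)) z eq) (odd-z-O i' (j' + j') z' eq') eq eq'
      where
      absurd : ∀ {m n} → c % 8 ≡ m → c % 8 ≡ n → m ≢ n → ⊥
      absurd p q m≢n = m≢n (trans (sym p) q)
      by-exponents : ∀ i i' {z z'} → OddExponent z → OddExponent z' →
        2 ^ suc (i + i) + 3 ^ (2 + (j + j)) ≡ c ^ z → 2 ^ suc (i' + i') + 3 ^ suc (j' + j') ≡ c ^ z' → ⊥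
      by-exponents zero zero (k , refl) (k' , refl) eq eq' = absurd (c%8-OE₀ j k eq) (c%8-OO₀ j' k' eq') (λ ())
      by-exponents (suc i) zero (k , refl) (k' , refl) eq eq' = absurd (c%8-OE i j k eq) (c%8-OO₀ j' k' eq') (λ ())
      by-exponents (suc i) (suc i') (k , refl) (k' , refl) eq eq' = absurd (c%8-OE i j k eq) (c%8-OO i' j' k' eq') (λ ())
      -- The collision: both solutions give c ≡ 3 modulo 8. The one with x = 1 yields c = 2 +
      -- 9^(j+1), and the sieve leaves only c = 11.
      by-exponents zero (suc i') (k , refl) (k' , refl) eq eq' = c≢11
          (Sieve.base≡11 pc i' j j' k' c≡ (trans (cong (λ n → 2 ^ (2 + n) + 3 ^ suc (j' + j')) (sym (N.+-suc i' i'))) eq'))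
        where
        eq″ : 2 + 3 ^ (suc j + suc j) ≡ c ^ suc (k + k)
        eq″ = trans (cong (λ n → 2 + 3 ^ n) (cong suc (N.+-suc j j))) eq
        c≡ : 2 + 3 ^ (suc j + suc j) ≡ c
        c≡ = trans eq″ (trans (cong (λ k → c ^ suc (k + k)) (ClassNumberOne.two-plus-9^ pc c≢2 c≢3 j k eq″))
            (N.*-identityʳ c))

    not-E-O : ∀ i y z i' y' z' → OddExponent z → 2 ^ (2 + (i + i)) + 3 ^ suc y ≡ c ^ z → 2 ^ suc (i' + i') + 3 ^ suc y' ≢
        c ^ z'
    not-E-O i y z i' y' z' odd-z eq eq' = 1≢2 (trans (sym (c%3≡1 i y z odd-z eq)) (c%3≡2 i' y' z' eq'))

    unique-b≡3 : ∀ {x y x' y'} → Parity x → Parity y → Parity x' → Parity y' → ∀ z z' →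
      2 ^ x + 3 ^ y ≡ c ^ z → 2 ^ x' + 3 ^ y' ≡ c ^ z' → Same x y z x' y' z'
    unique-b≡3 (even i) (even j) (even i') (even j') z z' eq eq' = same 2 2 z<s z<s i j z i' j' z' eq eq'
    unique-b≡3 (even i) (odd j) (even i') (odd j') z z' eq eq' = same 2 1 z<s z<s i j z i' j' z' eq eq'
    unique-b≡3 (odd i) (even j) (odd i') (even j') z z' eq eq' = same 1 2 z<s z<s i j z i' j' z' eq eq'
    unique-b≡3 (odd i) (odd j) (odd i') (odd j') z z' eq eq' = same 1 1 z<s z<s i j z i' j' z' eq eq'
    unique-b≡3 (even i) (even j) (even i') (odd j') z z' eq eq' = ⊥-elim (not-EE-EO i j z i' j' z' eq eq')
    unique-b≡3 (even i) (odd j) (even i') (even j') z z' eq eq' = ⊥-elim (not-EE-EO i' j' z' i j z eq' eq)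
    unique-b≡3 (odd i) (even j) (odd i') (odd j') z z' eq eq' = ⊥-elim (not-OE-OO i j z i' j' z' eq eq')
    unique-b≡3 (odd i) (odd j) (odd i') (even j') z z' eq eq' = ⊥-elim (not-OE-OO i' j' z' i j z eq' eq)
    unique-b≡3 (even i) (even j) (odd i') (even j') z z' eq eq' = ⊥-elim
        (not-E-O i (suc (j + j)) z i' (suc (j' + j')) z' (odd-z-EE i j z eq) eq eq')
    unique-b≡3 (even i) (even j) (odd i') (odd j') z z' eq eq' = ⊥-elim
        (not-E-O i (suc (j + j)) z i' (j' + j') z' (odd-z-EE i j z eq) eq eq')
    unique-b≡3 (even i) (odd j) (odd i') (even j') z z' eq eq' = ⊥-elim
        (not-E-O i (j + j) z i' (suc (j' + j')) z' (odd-z-EO i j z eq) eq eq')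
    unique-b≡3 (even i) (odd j) (odd i') (odd j') z z' eq eq' = ⊥-elim
        (not-E-O i (j + j) z i' (j' + j') z' (odd-z-EO i j z eq) eq eq')
    unique-b≡3 (odd i) (even j) (even i') (even j') z z' eq eq' = ⊥-elim
        (not-E-O i' (suc (j' + j')) z' i (suc (j + j)) z (odd-z-EE i' j' z' eq') eq' eq)
    unique-b≡3 (odd i) (odd j) (even i') (even j') z z' eq eq' = ⊥-elim
        (not-E-O i' (suc (j' + j')) z' i (j + j) z (odd-z-EE i' j' z' eq') eq' eq)
    unique-b≡3 (odd i) (even j) (even i') (odd j') z z' eq eq' = ⊥-elim
        (not-E-O i' (j' + j') z' i (suc (j + j)) z (odd-z-EO i' j' z' eq') eq' eq)
    unique-b≡3 (odd i) (odd j) (even i') (odd j') z z' eq eq' = ⊥-elim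
        (not-E-O i' (j' + j') z' i (j + j) z (odd-z-EO i' j' z' eq') eq' eq)

  module _ {b : ℕ} (pb : Prime b) (b≢2 : b ≢ 2) (b≢3 : b ≢ 3) (b≢5 : b ≢ 5) (b≢7 : b ≢ 7) where

    private
      3∤b' : ¬ 3 ∣ b
      3∤b' = prime∤ three-prime pb b≢3
      3^%3≡0 : ∀ {z} → 0 < z → 3 ^ z % 3 ≡ 0
      3^%3≡0 {suc z} _ = trans (cong (_% 3) (N.*-comm 3 (3 ^ z))) (N.m*n%n≡0 (3 ^ z) 3)

    data Class₃ : ℕ → ℕ → Set where
      EO : ∀ i j → b % 3 ≡ 2 → Class₃ (2 + (i + i)) (suc (j + j))
      OO : ∀ i j → b % 3 ≡ 1 → Class₃ (suc (i + i)) (suc (j + j))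

    -- The sum is divisible by 3. This excludes two even exponents and fixes b modulo 3 when y is
    -- odd; odd x with even y passes modulo 3 and needs `odd-even-three`.
    classify₃ : ∀ {x y} z → 0 < z → Parity x → Parity y → 2 ^ x + b ^ y ≡ 3 ^ z → Class₃ x y
    classify₃ z 0<z (even i) (even j) eq = ⊥-elim
        (absurd (trans (sym (3^%3≡0 0<z)) (%-+ 3 {2 ^ (2 + (i + i))} {b ^ (2 + (j + j))} eq (even-exponent 3 2 refl i)
        (even-exponent 3 b (square-3 b 3∤b') j))))
      where
      absurd : 0 ≢ 2
      absurd ()
    classify₃ z 0<z (odd i) (even j) eq = ⊥-elim ([ b≢5 , b≢7 ]′ (odd-even-three pb b≢2 b≢3 i j z eq))
    classify₃ z 0<z (even i) (odd j) eq with residue-3 b 3∤b'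
    ... | inj₂ e = EO i j e
    ... | inj₁ e = ⊥-elim (absurd (trans (sym (3^%3≡0 0<z))
        (%-+ 3 {2 ^ (2 + (i + i))} {b ^ suc (j + j)} eq (even-exponent 3 2 refl i)
        (trans (odd-power 3 {b} (square-3 b 3∤b') j) e))))
      where
      absurd : 0 ≢ 2
      absurd ()
    classify₃ z 0<z (odd i) (odd j) eq with residue-3 b 3∤b'
    ... | inj₁ e = OO i j e
    ... | inj₂ e = ⊥-elim (absurd (trans (sym (3^%3≡0 0<z))
        (%-+ 3 {2 ^ suc (i + i)} {b ^ suc (j + j)} eq (odd-power 3 {2} refl i)
        (trans (odd-power 3 {b} (square-3 b 3∤b') j) e))))
      where
      absurd : 0 ≢ 1
      absurd ()

    unique-c≡3 : ∀ {x y x' y'} → Class₃ x y → Class₃ x' y' → ∀ z z' →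
      2 ^ x + b ^ y ≡ 3 ^ z → 2 ^ x' + b ^ y' ≡ 3 ^ z' → Same x y z x' y' z'
    unique-c≡3 (EO i j _) (EO i' j' _) z z' eq eq' = same-class pb three-prime b≢2 (λ ()) b≢3 2 1 z<s z<s i j z i' j' z'
        eq eq'
    unique-c≡3 (OO i j _) (OO i' j' _) z z' eq eq' = same-class pb three-prime b≢2 (λ ()) b≢3 1 1 z<s z<s i j z i' j' z'
        eq eq'
    unique-c≡3 (EO i j p) (OO i' j' q) z z' _ _ = ⊥-elim (1≢2 (trans (sym q) p))
    unique-c≡3 (OO i j p) (EO i' j' q) z z' _ _ = ⊥-elim (1≢2 (trans (sym p) q))

-- The case distinction on which prime is 2 and which is 3.

theorem1p4 : (a b c : ℕ) → Prime a → Prime b → Prime c →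
    a ≢ b → b ≢ c → a ≢ c → a < b →
    (∃[ x ] ∃[ y ] ∃[ z ] ∃[ x′ ] ∃[ y′ ] ∃[ z′ ]
    (Sol a b c x y z × Sol a b c x′ y′ z′ × ¬ ((x ≡ x′) × (y ≡ y′) × (z ≡ z′)))) →
    ¬ ((a ≡ 2) × (b ≡ 3) × (c ≡ 5)) →
    ¬ ((a ≡ 2) × (b ≡ 3) × (c ≡ 11)) →
    ¬ ((a ≡ 2) × (b ≡ 5) × (c ≡ 3)) →
    ¬ ((a ≡ 2) × (b ≡ 7) × (c ≡ 3)) →
    ¬ ((a ≡ 3) × (b ≡ 5) × (c ≡ 2)) →
    ¬ ((a ≡ 3) × (b ≡ 13) × (c ≡ 2)) →
    (c % 12 ≡ 5) ×
    (∃[ x₁ ] ∃[ y₁ ] ∃[ z₁ ] ∃[ x₂ ] ∃[ y₂ ] ∃[ z₂ ]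
    (Sol a b c x₁ y₁ z₁ × Sol a b c x₂ y₂ z₂ ×
    ¬ ((x₁ ≡ x₂) × (y₁ ≡ y₂) × (z₁ ≡ z₂)) ×
    ((x y z : ℕ) → Sol a b c x y z →
    ((x ≡ x₁) × (y ≡ y₁) × (z ≡ z₁)) ⊎ ((x ≡ x₂) × (y ≡ y₂) × (z ≡ z₂))) ×
    (2 ∣ x₁) × (2 ∣ y₁) × (z₁ ≡ 1) × ¬ (2 ∣ y₂)))
theorem1p4 a b c pa pb pc a≢b b≢c a≢c a<b (x , y , z , x' , y' , z' , sol@(0<x , 0<y , 0<z , eq) , sol'@(0<x' , 0<y' , 0<z' , eq') , distinct)
  ¬2-3-5 ¬2-3-11 ¬2-5-3 ¬2-7-3 ¬3-5-2 ¬3-13-2 with a N.≟ 2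
-- Since b > a, both a and b are odd here, so the sum is even and c = 2.
... | no a≢2 = ⊥-elim (distinct (PowersOfTwo.solution-unique pa pb a≢2 b≢2 a≢b ¬exc ¬exc' x y z x' y' z' 0<x 0<y 0<x' 0<y'
    (trans eq (cong (N._^ z) c≡2)) (trans eq' (cong (N._^ z') c≡2))))
  where
  open Uniqueness using (∤^)
  b≢2 : b ≢ 2
  b≢2 refl = N.<⇒≱ a<b (PrimePowers.prime>1 pa)
  2∤^ : ∀ {p} → Prime p → p ≢ 2 → ∀ n → ¬ 2 ∣ p N.^ n
  2∤^ pp p≢2 = ∤^ prime[2] pp (λ e → p≢2 (sym e))
  2∣sum : ∀ {m n} → ¬ 2 ∣ m → ¬ 2 ∣ n → 2 ∣ m N.+ n
  2∣sum {m} {n} 2∤m 2∤n with PrimePowers.odd⊎even m | PrimePowers.odd⊎even n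
  ... | i , inj₁ refl | _ = ⊥-elim (2∤m (divides i (trans (cong (i N.+_) (sym (N.+-identityʳ i))) (N.*-comm 2 i))))
  ... | _ | j , inj₁ refl = ⊥-elim (2∤n (divides j (trans (cong (j N.+_) (sym (N.+-identityʳ j))) (N.*-comm 2 j))))
  ... | i , inj₂ refl | j , inj₂ refl = divides (suc (i N.+ j)) (solve 2 (λ i j → (con 1 :+ (i :+ i)) :+ (con 1 :+ (j :+ j)) := (con 1 :+ (i :+ j)) :* con 2) refl i j)
    where open NS.+-*-Solver
  c≡2 : c ≡ 2
  c≡2 = sym (PrimePowers.prime∣prime^⇒≡ prime[2] pc z (subst (2 ∣_) eq (2∣sum (2∤^ pa a≢2 x) (2∤^ pb b≢2 y))))
  ¬exc : ¬ TrivialPowers₂.Exceptional a b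
  ¬exc (inj₁ (a≡3 , b≡5)) = ¬3-5-2 (a≡3 , b≡5 , c≡2)
  ¬exc (inj₂ (refl , inj₁ refl)) = N.<⇒≱ a<b (N.m≤m+n 3 2)
  ¬exc (inj₂ (refl , inj₂ refl)) = N.<⇒≱ a<b (N.m≤m+n 3 10)
  ¬exc' : ¬ TrivialPowers₂.Exceptional b a
  ¬exc' (inj₁ (refl , refl)) = N.<⇒≱ a<b (N.m≤m+n 3 2)
  ¬exc' (inj₂ (a≡3 , inj₁ b≡5)) = ¬3-5-2 (a≡3 , b≡5 , c≡2)
  ¬exc' (inj₂ (a≡3 , inj₂ b≡13)) = ¬3-13-2 (a≡3 , b≡13 , c≡2)
... | yes refl with b N.≟ 3
... | yes refl = ⊥-elim (distinct (BaseTwo.unique-b≡3 pc (λ e → a≢c (sym e)) (λ e → b≢c (sym e)) (λ e → ¬2-3-5 (refl , refl , e)) (λ e → ¬2-3-11 (refl , refl , e))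
    (exponent-parity x 0<x) (exponent-parity y 0<y) (exponent-parity x' 0<x') (exponent-parity y' 0<y') z z' eq eq'))
  where open Factorisations using (exponent-parity)
... | no b≢3 with c N.≟ 3
... | yes refl = ⊥-elim (distinct (BaseTwo.unique-c≡3 pb b≢2 b≢3 b≢5 b≢7
    (BaseTwo.classify₃ pb b≢2 b≢3 b≢5 b≢7 z 0<z (exponent-parity x 0<x) (exponent-parity y 0<y) eq)
    (BaseTwo.classify₃ pb b≢2 b≢3 b≢5 b≢7 z' 0<z' (exponent-parity x' 0<x') (exponent-parity y' 0<y') eq') z z' eq eq'))
  where
  open Factorisations using (exponent-parity)
  b≢2 : b ≢ 2
  b≢2 e = a≢b (sym e)
  b≢5 : b ≢ 5
  b≢5 e = ¬2-5-3 (refl , e , refl)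
  b≢7 : b ≢ 7
  b≢7 e = ¬2-7-3 (refl , e , refl)
... | no c≢3 = BaseTwo.two-solutions pb pc b≢2 c≢2 b≢c b≢3 c≢3 sol sol' distinct
    (BaseTwo.classify pb pc b≢2 c≢2 b≢c b≢3 c≢3 z (exponent-parity x 0<x) (exponent-parity y 0<y) eq)
    (BaseTwo.classify pb pc b≢2 c≢2 b≢c b≢3 c≢3 z' (exponent-parity x' 0<x') (exponent-parity y' 0<y') eq')
  where
  open Factorisations using (exponent-parity)
  b≢2 : b ≢ 2
  b≢2 e = a≢b (sym e)
  c≢2 : c ≢ 2
  c≢2 e = a≢c (sym e)
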